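{- Let $m\ge1$, $T\subseteq\{0,\ldots,m-1\}$, $s=|T|$, let $W\ge1$ be the machine-word width and $n=\lceil m/W\rceil$. Consider Frobenius-factorized reduction modulo $g=x^m+\sum_{t\in T}x^t\in\mathbb{F}_2[x]$, as described in the context. Excluding the caller-owned input and output, the in-place scalar reduction can be performed with one $m$-bit state. The implementation evaluated in the paper (described in the context) allocates exactly $n+1$ plan-owned scratch-array words: $n$ state words and one zero sentinel. An explicit reusable plan stores $r$ stage records, $S_{\mathrm{fb}}$ feedback-shift records and $s$ assembly-shift records, in addition to constant-size metadata. Such a plan can be constructed in $O(s+r+S_{\mathrm{fb}})$ word-RAM operations and the same asymptotic number of records. Alternatively, the factors can be generated online with no persistent feedback or assembly schedule. This realization uses $n+1$ state words and $s$ reusable descriptor records, hence $O(n+s)$ workspace, and performs $O(s+r+S_{\mathrm{fb}})$ additional scalar descriptor-generation operations per reduction.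
   Context: The support $T$ is given as a duplicate-free list of exponents in strictly increasing order. For $t\in T$ put $\Delta_t=m-t$. For $d\ge 0$, $N^d$ is the truncated right shift on $\mathbb{F}_2^m$: $(N^dy)_i=y_{i+d}$ if $0\le i<m-d$ and $(N^dy)_i=0$ if $m-d\le i<m$; $N^d=0$ for $d\ge m$. Put $V(Y)=\sum_{t\in T}(x^tY\bmod x^m)$ for $\deg Y<m$. If $T\subseteq\{0\}$ set $r=0$; otherwise $r=\lceil\log_2(m/\Delta_{\min})\rceil$ with $\Delta_{\min}=\min\{\Delta_t:t\in T\}$. For $k\ge0$, $T_k=\{t\in T:2^k\Delta_t<m\}$, and $S_{\mathrm{fb}}=\sum_{k=0}^{r-1}|T_k|$. Frobenius-factorized reduction on input $A=L+x^mH$ ($\deg L,\deg H<m$): set $Y\leftarrow H$; for $k=0,\ldots,r-1$ replace $Y$ by $Y+\sum_{t\in T_k}N^{2^k\Delta_t}Y$ (all shifts reading the same stage input); return $L+V(Y)$, which equals $A\bmod g$. Packed representation: coefficient $i$ is bit $i\bmod W$ of word $\lfloor i/W\rfloor$ in an array of $n$ words. A reusable plan retains, for each stage $0\le k<r$, the shifts $2^k\Delta_t$ ($t\in T_k$), one record per shift, together with one record per stage and one record per tap $t\in T$ for the final assembly $L+V(Y)$. The online realization instead keeps no such precomputed data: it derives the shifts of each stage from $T$ immediately before applying the stage, overwriting a descriptor array reused at the next stage. The implementation evaluated in the paper is a scalar in-place one whose scratch array consists of the $n$ words of the state $Y$ plus one extra zero word (sentinel) used for adjacent-word reads. -}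

module Defs where

open import Data.Bool using (Bool; true; false; if_then_else_; _∧_; _xor_)
open import Data.Fin using (Fin; #_; toℕ)
import Data.Fin as Fin
open import Data.List using (List; []; _∷_; _++_; length; map; concatMap; filter; foldr; upTo; replicate)
open import Data.List.Extrema.Nat using (min)
open import Data.List.Relation.Unary.All using (all?)
open import Data.Nat using (ℕ; zero; suc; _+_; _∸_; _*_; _^_; _≤_; _<_; _<?_; _≟_; _≡ᵇ_; _<ᵇ_)
open import Data.Nat.DivMod using (_/_; _%_)
open import Data.Nat.ListAction using (sum)
open import Data.Nat.Logarithm using (⌈log₂_⌉)
open import Data.Product using (_×_; ∃-syntax; ∃₂; Σ-syntax)
open import Data.Unit using (⊤)
open import Data.Vec using (Vec; []; _∷_; tabulate; zipWith; take; drop; toList)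
import Data.Vec as Vec
open import Relation.Binary.PropositionalEquality using (_≡_; _≢_)
open import Relation.Nullary using (does)

------------------------------------------------------------------------
-- Arithmetic

-- Division made total; a zero divisor never occurs below (the machine
-- faults on it).
quot : ℕ → ℕ → ℕ
quot a zero    = 0
quot a (suc b) = a / suc b

rem : ℕ → ℕ → ℕ
rem a zero    = 0
rem a (suc b) = a % suc b

ceilDiv : ℕ → ℕ → ℕ
ceilDiv a b = quot (a + (b ∸ 1)) b

------------------------------------------------------------------------
-- Polynomials over 𝔽₂.  𝔽₂ is Bool with xor and ∧; a polynomial of
-- degree < k is its coefficient vector in Vec Bool k, lowest first.

coeff : ∀ {k} → Vec Bool k → ℕ → Bool
coeff []      _       = false
coeff (x ∷ _) zero    = x
coeff (_ ∷ v) (suc i) = coeff v i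

zeros : ∀ {k} → Vec Bool k
zeros = Vec.replicate _ false

infixl 6 _⊕_

_⊕_ : ∀ {k} → Vec Bool k → Vec Bool k → Vec Bool k
_⊕_ = zipWith _xor_

-- On Vec Bool m: down d is N^d (coeff vanishes beyond the length), and
-- up t is Y ↦ x^t Y mod x^m.  On a machine word they are the right and
-- left logical shifts.
down up : ∀ {k} → ℕ → Vec Bool k → Vec Bool k
down d v = tabulate λ i → coeff v (toℕ i + d)
up   t v = tabulate λ i → if toℕ i <ᵇ t then false else coeff v (toℕ i ∸ t)

convolve : (ℕ → Bool) → (ℕ → Bool) → ℕ → Bool
convolve p q i = foldr _xor_ false (map (λ j → p j ∧ q (i ∸ j)) (upTo (suc i)))

-- The coefficients of g = x^m + Σ_{t ∈ T} x^t.
modulus : ℕ → List ℕ → ℕ → Bool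
modulus m T i = foldr (λ t b → (t ≡ᵇ i) xor b) (m ≡ᵇ i) T

-- R = A mod g: A = Q g + R for some polynomial Q, with deg R < m = deg g.
IsRemainder : ∀ {k} (m : ℕ) (T : List ℕ) → Vec Bool k → Vec Bool m → Set
IsRemainder m T A R =
  ∃[ l ] Σ[ Q ∈ Vec Bool l ]
    (∀ i → coeff A i ≡ convolve (coeff Q) (modulus m T) i xor coeff R i)

------------------------------------------------------------------------
-- Frobenius-factorized reduction

-- The default m of the minimum is harmless, since m - t ≤ m.
Δmin : ℕ → List ℕ → ℕ
Δmin m T = min m (map (m ∸_) T)

-- ⌈log₂ (m/Δ)⌉ = ⌈log₂ ⌈m/Δ⌉⌉, the powers of two being integers.
stageCount : ℕ → List ℕ → ℕ
stageCount m T =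
  if does (all? (_≟ 0) T) then 0 else ⌈log₂ ceilDiv m (Δmin m T) ⌉

active : ℕ → List ℕ → ℕ → List ℕ
active m T k = filter (λ t → 2 ^ k * (m ∸ t) <? m) T

shifts : ℕ → List ℕ → ℕ → List ℕ
shifts m T k = map (λ t → 2 ^ k * (m ∸ t)) (active m T k)

feedbackCount : ℕ → List ℕ → ℕ
feedbackCount m T = sum (map (λ k → length (active m T k)) (upTo (stageCount m T)))

applyStage : ∀ {m} → List ℕ → Vec Bool m → Vec Bool m
applyStage ds Y = Y ⊕ foldr (λ d Z → down d Y ⊕ Z) zeros ds

stateAfter : ∀ {m} → List ℕ → ℕ → Vec Bool m → Vec Bool m
stateAfter T zero    H = H
stateAfter {m} T (suc k) H = applyStage (shifts m T k) (stateAfter T k H)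

assembleV : ∀ {m} → List ℕ → Vec Bool m → Vec Bool m
assembleV T Y = foldr (λ t Z → up t Y ⊕ Z) zeros T

-- The state after all stages, for input A = L + x^m H.
finalState : ∀ m → List ℕ → Vec Bool (m + m) → Vec Bool m
finalState m T A = stateAfter T (stageCount m T) (drop m A)

frobeniusReduce : ∀ m → List ℕ → Vec Bool (m + m) → Vec Bool m
frobeniusReduce m T A = take m A ⊕ assembleV T (finalState m T A)

------------------------------------------------------------------------
-- Packed representation

Word : ℕ → Set
Word W = Vec Bool W

pack : ∀ {k} W → Vec Bool k → List (Word W)
pack {k} W v =
  map (λ j → tabulate λ b → coeff v (j * W + toℕ b)) (upTo (ceilDiv k W))

------------------------------------------------------------------------
-- The word-RAM.  Programs are uniform: a Cmd mentions neither m, W nor T.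
-- Besides a constant number of scalar and word registers there are arrays
-- of records (one bounded scalar per record) and arrays of W-bit words.

Reg WReg : Set
Reg  = Fin 32
WReg = Fin 4

-- support holds the caller's T.
data RecArray : Set where
  support stages feedback assembly descriptors : RecArray

-- input and output are owned by the caller.
data WordArray : Set where
  input output scratch : WordArray

infix  40 $_ $ʷ_
infix  35 _at_ _atʷ_
infixl 30 _:*_ _:/_ _:%_
infixl 25 _:+_ _:-_

data Exp : Set where
  lit  : ℕ → Exp
  $_   : Reg → Exp
  _at_ : RecArray → Exp → Exp
  _:+_ _:-_ _:*_ _:/_ _:%_ : Exp → Exp → Exp

data WExp : Set where
  $ʷ_     : WReg → WExp
  _atʷ_   : WordArray → Exp → WExp
  xorʷ    : WExp → WExp → WExp
  shl shr : WExp → Exp → WExp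

infix  20 _≔_ _≔ʷ_ _[_]≔_ _[_]≔ʷ_
infixr 10 _⨾_

data Cmd : Set where
  skip      : Cmd
  _≔_       : Reg → Exp → Cmd
  _≔ʷ_      : WReg → WExp → Cmd
  _[_]≔_    : RecArray → Exp → Exp → Cmd
  _[_]≔ʷ_   : WordArray → Exp → WExp → Cmd
  allocRecs  : RecArray → Exp → Cmd
  allocWords : WordArray → Exp → Cmd
  _⨾_       : Cmd → Cmd → Cmd
  ifLt      : Exp → Exp → Cmd → Cmd → Cmd
  whileLt   : Exp → Exp → Cmd → Cmd
  -- No effect on execution: operations inside are charged as
  -- descriptor generation.
  generate  : Cmd → Cmd

record Store (W : ℕ) : Set where
  constructor store
  field
    regs  : Reg → ℕ
    wregs : WReg → Word W
    recs  : RecArray → List ℕ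
    words : WordArray → List (Word W)

open Store public

get : ∀ {A : Set} → A → List A → ℕ → A
get z []       _       = z
get z (x ∷ _)  zero    = x
get z (_ ∷ xs) (suc i) = get z xs i

put : ∀ {A : Set} → List A → ℕ → A → List A
put []       _       _ = []
put (_ ∷ xs) zero    y = y ∷ xs
put (x ∷ xs) (suc i) y = x ∷ put xs i y

sameRec : RecArray → RecArray → Bool
sameRec support     support     = true
sameRec stages      stages      = true
sameRec feedback    feedback    = true
sameRec assembly    assembly    = true
sameRec descriptors descriptors = true
sameRec _           _           = false

sameWord : WordArray → WordArray → Bool
sameWord input   input   = true
sameWord output  output  = true
sameWord scratch scratch = true
sameWord _       _       = false

module _ {W : ℕ} where

  setReg : Store W → Reg → ℕ → Store W
  setReg σ x v = record σ { regs = λ y → if does (x Fin.≟ y) then v else regs σ y }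

  setWReg : Store W → WReg → Word W → Store W
  setWReg σ x v = record σ { wregs = λ y → if does (x Fin.≟ y) then v else wregs σ y }

  setRecs : Store W → RecArray → List ℕ → Store W
  setRecs σ a xs = record σ { recs = λ b → if sameRec a b then xs else recs σ b }

  setWords : Store W → WordArray → List (Word W) → Store W
  setWords σ a xs = record σ { words = λ b → if sameWord a b then xs else words σ b }

  eval : Store W → Exp → ℕ
  eval σ (lit n)  = n
  eval σ ($ x)    = regs σ x
  eval σ (a at e) = get 0 (recs σ a) (eval σ e)
  eval σ (e :+ f) = eval σ e + eval σ f
  eval σ (e :- f) = eval σ e ∸ eval σ f
  eval σ (e :* f) = eval σ e * eval σ f
  eval σ (e :/ f) = quot (eval σ e) (eval σ f)
  eval σ (e :% f) = rem (eval σ e) (eval σ f)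

  evalʷ : Store W → WExp → Word W
  evalʷ σ ($ʷ x)     = wregs σ x
  evalʷ σ (a atʷ e)  = get zeros (words σ a) (eval σ e)
  evalʷ σ (xorʷ p q) = evalʷ σ p ⊕ evalʷ σ q
  evalʷ σ (shl p e)  = up (eval σ e) (evalʷ σ p)
  evalʷ σ (shr p e)  = down (eval σ e) (evalʷ σ p)

  -- Evaluation is fault-free: array accesses are in bounds, divisors are
  -- nonzero, and no sum or product exceeds the capacity κ of a scalar.
  Safe : ℕ → Store W → Exp → Set
  Safe κ σ (lit n)  = ⊤
  Safe κ σ ($ x)    = ⊤
  Safe κ σ (a at e) = Safe κ σ e × eval σ e < length (recs σ a)
  Safe κ σ (e :+ f) = Safe κ σ e × Safe κ σ f × eval σ e + eval σ f ≤ κ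
  Safe κ σ (e :- f) = Safe κ σ e × Safe κ σ f
  Safe κ σ (e :* f) = Safe κ σ e × Safe κ σ f × eval σ e * eval σ f ≤ κ
  Safe κ σ (e :/ f) = Safe κ σ e × Safe κ σ f × 0 < eval σ f
  Safe κ σ (e :% f) = Safe κ σ e × Safe κ σ f × 0 < eval σ f

  Safeʷ : ℕ → Store W → WExp → Set
  Safeʷ κ σ ($ʷ x)     = ⊤
  Safeʷ κ σ (a atʷ e)  = Safe κ σ e × eval σ e < length (words σ a)
  Safeʷ κ σ (xorʷ p q) = Safeʷ κ σ p × Safeʷ κ σ q
  Safeʷ κ σ (shl p e)  = Safeʷ κ σ p × Safe κ σ e
  Safeʷ κ σ (shr p e)  = Safeʷ κ σ p × Safe κ σ e

-- Unit cost per node of an expression.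
size : Exp → ℕ
size (lit n)  = 1
size ($ x)    = 1
size (a at e) = 1 + size e
size (e :+ f) = 1 + (size e + size f)
size (e :- f) = 1 + (size e + size f)
size (e :* f) = 1 + (size e + size f)
size (e :/ f) = 1 + (size e + size f)
size (e :% f) = 1 + (size e + size f)

sizeʷ : WExp → ℕ
sizeʷ ($ʷ x)     = 1
sizeʷ (a atʷ e)  = 1 + size e
sizeʷ (xorʷ p q) = 1 + (sizeʷ p + sizeʷ q)
sizeʷ (shl p e)  = 1 + (sizeʷ p + size e)
sizeʷ (shr p e)  = 1 + (sizeʷ p + size e)

-- Allocation counts only grow (nothing is ever freed), so they bound the
-- space in use at every moment of a run.
record Usage : Set where
  constructor usage
  field
    ops         : ℕ   -- outside generate
    genOps      : ℕ   -- inside generate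
    allocdRecs  : ℕ
    allocdWords : ℕ

open Usage public

infixl 6 _⊹_

_⊹_ : Usage → Usage → Usage
usage a b c d ⊹ usage a′ b′ c′ d′ = usage (a + a′) (b + b′) (c + c′) (d + d′)

cost : ℕ → Usage
cost k = usage k 0 0 0

asGenerated : Usage → Usage
asGenerated (usage a b c d) = usage 0 (a + b) c d

-- Run κ c σ σ′ u: from σ, program c halts without fault in σ′, using u.
-- Arrays are allocated zero-initialised, at one operation per cell.
data Run {W : ℕ} (κ : ℕ) : Cmd → Store W → Store W → Usage → Set where

  skip : ∀ {σ} → Run κ skip σ σ (cost 0)

  assign : ∀ {σ x e} → Safe κ σ e →
    Run κ (x ≔ e) σ (setReg σ x (eval σ e)) (cost (1 + size e))

  assignʷ : ∀ {σ x p} → Safeʷ κ σ p →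
    Run κ (x ≔ʷ p) σ (setWReg σ x (evalʷ σ p)) (cost (1 + sizeʷ p))

  write : ∀ {σ a i e} → Safe κ σ i → Safe κ σ e → eval σ i < length (recs σ a) →
    Run κ (a [ i ]≔ e) σ
        (setRecs σ a (put (recs σ a) (eval σ i) (eval σ e)))
        (cost (1 + (size i + size e)))

  writeʷ : ∀ {σ a i p} → Safe κ σ i → Safeʷ κ σ p → eval σ i < length (words σ a) →
    Run κ (a [ i ]≔ʷ p) σ
        (setWords σ a (put (words σ a) (eval σ i) (evalʷ σ p)))
        (cost (1 + (size i + sizeʷ p)))

  allocRecs : ∀ {σ a e} → Safe κ σ e →
    Run κ (allocRecs a e) σ
        (setRecs σ a (replicate (eval σ e) 0))
        (usage (1 + size e + eval σ e) 0 (eval σ e) 0)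

  allocWords : ∀ {σ a e} → Safe κ σ e →
    Run κ (allocWords a e) σ
        (setWords σ a (replicate (eval σ e) zeros))
        (usage (1 + size e + eval σ e) 0 0 (eval σ e))

  seq : ∀ {σ σ₁ σ₂ c d u v} → Run κ c σ σ₁ u → Run κ d σ₁ σ₂ v →
    Run κ (c ⨾ d) σ σ₂ (u ⊹ v)

  if-yes : ∀ {σ σ′ e f c d u} → Safe κ σ e → Safe κ σ f →
    eval σ e < eval σ f → Run κ c σ σ′ u →
    Run κ (ifLt e f c d) σ σ′ (cost (1 + (size e + size f)) ⊹ u)

  if-no : ∀ {σ σ′ e f c d u} → Safe κ σ e → Safe κ σ f →
    eval σ f ≤ eval σ e → Run κ d σ σ′ u →
    Run κ (ifLt e f c d) σ σ′ (cost (1 + (size e + size f)) ⊹ u)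

  while-yes : ∀ {σ σ₁ σ₂ e f c u v} → Safe κ σ e → Safe κ σ f →
    eval σ e < eval σ f → Run κ c σ σ₁ u → Run κ (whileLt e f c) σ₁ σ₂ v →
    Run κ (whileLt e f c) σ σ₂ (cost (1 + (size e + size f)) ⊹ u ⊹ v)

  while-no : ∀ {σ e f c} → Safe κ σ e → Safe κ σ f → eval σ f ≤ eval σ e →
    Run κ (whileLt e f c) σ σ (cost (1 + (size e + size f)))

  generate : ∀ {σ σ′ c u} → Run κ c σ σ′ u →
    Run κ (generate c) σ σ′ (asGenerated u)

-- Scalars are polynomially bounded in m + W, i.e. have O(log (m + W)) bits.
capacity : ℕ → ℕ → ℕ
capacity m W = 4 * ((m + W) * (m + W))

------------------------------------------------------------------------
-- The programs

rM rW rS rR rN rJ rI rQ rB rK rBase rCount rLen rPow rLim rShift : Reg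
rM     = # 0    -- m
rW     = # 1    -- W
rS     = # 2    -- s
rR     = # 3    -- r
rN     = # 4    -- n
rJ     = # 5
rI     = # 6
rQ     = # 7
rB     = # 8
rK     = # 9
rBase  = # 10
rCount = # 11
rLen   = # 12
rPow   = # 13
rLim   = # 14
rShift = # 15

acc : WReg
acc = # 0

for : Reg → Exp → Cmd → Cmd
for x e c = x ≔ lit 0 ⨾ whileLt ($ x) e (c ⨾ x ≔ $ x :+ lit 1)

-- How the word after the last state word is treated in an adjacent-word
-- read: tested for explicitly, or stored as an extra zero word.
data Variant : Set where
  guarded sentinel : Variant

scratchExtent : Variant → Exp
scratchExtent guarded  = $ rN
scratchExtent sentinel = $ rN :+ lit 1

setup : Variant → Cmd
setup v =
  rN ≔ ($ rM :+ ($ rW :- lit 1)) :/ $ rW ⨾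
  allocWords scratch (scratchExtent v)

splitShift : Exp → Cmd
splitShift e = rQ ≔ e :/ $ rW ⨾ rB ≔ e :% $ rW

accumulate : WExp → Cmd
accumulate p = acc ≔ʷ xorʷ ($ʷ acc) p

-- Y ← H, where H starts at bit m of the packed input.
loadHigh : Cmd
loadHigh =
  splitShift ($ rM) ⨾
  rLen ≔ ($ rM :+ $ rM :+ ($ rW :- lit 1)) :/ $ rW ⨾
  for rJ ($ rN)
    (acc ≔ʷ shr (input atʷ ($ rQ :+ $ rJ)) ($ rB) ⨾
     ifLt ($ rQ :+ $ rJ :+ lit 1) ($ rLen)
       (accumulate (shl (input atʷ ($ rQ :+ $ rJ :+ lit 1)) ($ rW :- $ rB)))
       skip ⨾
     scratch [ $ rJ ]≔ʷ $ʷ acc)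

readNext : Cmd
readNext = accumulate (shl (scratch atʷ ($ rJ :+ $ rQ :+ lit 1)) ($ rW :- $ rB))

adjacent : Variant → Cmd
adjacent sentinel = readNext
adjacent guarded  = ifLt ($ rJ :+ $ rQ :+ lit 1) ($ rN) readNext skip

-- One stage in place, with shifts a[base], …, a[base + count - 1].  Word j
-- is overwritten only after all shifts have been accumulated, and later
-- words read only positions beyond j, so every read sees the stage input.
stageInPlace : Variant → RecArray → Exp → Exp → Cmd
stageInPlace v a base count =
  for rJ ($ rN)
    (acc ≔ʷ scratch atʷ $ rJ ⨾
     for rI count
       (splitShift (a at (base :+ $ rI)) ⨾
        ifLt ($ rJ :+ $ rQ) ($ rN)
          (accumulate (shr (scratch atʷ ($ rJ :+ $ rQ)) ($ rB)) ⨾ adjacent v)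
          skip) ⨾
     scratch [ $ rJ ]≔ʷ $ʷ acc)

-- output ← L + V(Y), with taps a[0], …, a[s - 1].  The last two shifts
-- clear the bits of positions ≥ m in the last word.
assembleOutput : RecArray → Cmd
assembleOutput a =
  for rJ ($ rN)
    (acc ≔ʷ input atʷ $ rJ ⨾
     for rI ($ rS)
       (splitShift (a at $ rI) ⨾
        ifLt ($ rJ) ($ rQ) skip
          (accumulate (shl (scratch atʷ ($ rJ :- $ rQ)) ($ rB)) ⨾
           ifLt ($ rQ) ($ rJ)
             (accumulate (shr (scratch atʷ ($ rJ :- $ rQ :- lit 1)) ($ rW :- $ rB)))
             skip)) ⨾
     rLim ≔ ($ rJ :+ lit 1) :* $ rW :- $ rM ⨾
     output [ $ rJ ]≔ʷ shr (shl ($ʷ acc) ($ rLim)) ($ rLim))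

reduceWithPlan : Variant → Cmd
reduceWithPlan v =
  loadHigh ⨾
  rBase ≔ lit 0 ⨾
  for rK ($ rR)
    (rCount ≔ stages at $ rK ⨾
     stageInPlace v feedback ($ rBase) ($ rCount) ⨾
     rBase ≔ $ rBase :+ $ rCount) ⨾
  assembleOutput assembly

-- With rPow = 2^k, overwrite the descriptors by the shifts of stage k and
-- set rCount to their number.  As T increases, the active exponents form a
-- suffix of T; the scan starts from the largest and stops (by lowering
-- rLim) at the first inactive one.
stageDescriptors : Cmd
stageDescriptors =
  rCount ≔ lit 0 ⨾
  rLim ≔ $ rS ⨾
  whileLt ($ rCount) ($ rLim)
    (rShift ≔ $ rPow :* ($ rM :- support at ($ rS :- lit 1 :- $ rCount)) ⨾
     ifLt ($ rShift) ($ rM)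
       (descriptors [ $ rCount ]≔ $ rShift ⨾ rCount ≔ $ rCount :+ lit 1)
       (rLim ≔ $ rCount))

assemblyDescriptors : Cmd
assemblyDescriptors = for rI ($ rS) (descriptors [ $ rI ]≔ support at $ rI)

-- The stages end at the first k for which no exponent is active.
reduceOnline : Cmd
reduceOnline =
  setup sentinel ⨾
  loadHigh ⨾
  generate (allocRecs descriptors ($ rS) ⨾ rPow ≔ lit 1 ⨾ stageDescriptors) ⨾
  whileLt (lit 0) ($ rCount)
    (stageInPlace sentinel descriptors (lit 0) ($ rCount) ⨾
     generate (rPow ≔ $ rPow :* lit 2 ⨾ stageDescriptors)) ⨾
  generate assemblyDescriptors ⨾
  assembleOutput descriptors

------------------------------------------------------------------------
-- The reusable plan

-- Feedback records are stored stage after stage, so the record of a stage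
-- need only hold the number of its shifts.
record Plan : Set where
  constructor plan
  field
    metadata        : Vec ℕ 4
    stageRecords    : List ℕ
    feedbackRecords : List ℕ
    assemblyRecords : List ℕ

open Plan public

planFor : (W m : ℕ) → List ℕ → Plan
planFor W m T = record
  { metadata        = m ∷ W ∷ length T ∷ stageCount m T ∷ []
  ; stageRecords    = map (λ k → length (active m T k)) (upTo (stageCount m T))
  ; feedbackRecords = concatMap (shifts m T) (upTo (stageCount m T))
  ; assemblyRecords = T
  }

HoldsPlan : ∀ {W} → Plan → Store W → Set
HoldsPlan P σ =
    Vec.map (regs σ) (rM ∷ rW ∷ rS ∷ rR ∷ []) ≡ metadata P
  × recs σ stages   ≡ stageRecords P
  × recs σ feedback ≡ feedbackRecords P
  × recs σ assembly ≡ assemblyRecords P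

------------------------------------------------------------------------
-- Specifications.  Everything a store is not required to contain is
-- arbitrary; in particular the programs cannot rely on it.

GivenSupport : ∀ {W} → ℕ → List ℕ → Store W → Set
GivenSupport {W} m T σ =
  regs σ rM ≡ m × regs σ rW ≡ W × regs σ rS ≡ length T × recs σ support ≡ T

scratchTail : ∀ {W} → Variant → List (Word W)
scratchTail guarded  = []
scratchTail sentinel = zeros ∷ []

Ready : ∀ {W} → Variant → ℕ → List ℕ → Store W → Set
Ready {W} v m T σ =
    HoldsPlan (planFor W m T) σ
  × regs σ rN ≡ ceilDiv m W
  × Σ[ Y ∈ Vec (Word W) (ceilDiv m W) ] words σ scratch ≡ toList Y ++ scratchTail v

CallerArrays : ∀ {W} m → Vec Bool (m + m) → Store W → Set
CallerArrays {W} m A σ =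
  words σ input ≡ pack W A × length (words σ output) ≡ ceilDiv m W

-- Given a plan, setup allocates exactly `size` scratch words and no record.
SetupAllocates : (W : ℕ) → Variant → ℕ → List ℕ → ℕ → Set
SetupAllocates W v m T size =
  (σ : Store W) → HoldsPlan (planFor W m T) σ →
  ∃₂ λ σ′ u → Run (capacity m W) (setup v) σ σ′ u
    × Ready v m T σ′
    × length (words σ′ scratch) ≡ size
    × allocdWords u ≡ size
    × allocdRecs u ≡ 0

-- With plan and scratch in place, any input is reduced without further
-- allocation, leaving the plan and the scratch layout fit for reuse.
ReducesInPlace : (W : ℕ) → Variant → ℕ → List ℕ → Set
ReducesInPlace W v m T =
  (A : Vec Bool (m + m)) (σ : Store W) → Ready v m T σ → CallerArrays m A σ →
  ∃₂ λ σ′ u → Run (capacity m W) (reduceWithPlan v) σ σ′ u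
    × words σ′ output ≡ pack W (frobeniusReduce m T A)
    × words σ′ scratch ≡ pack W (finalState m T A) ++ scratchTail v
    × words σ′ input ≡ words σ input
    × Ready v m T σ′
    × allocdWords u ≡ 0
    × allocdRecs u ≡ 0

-- The argument of O(s + r + S_fb).  The added 1 matters only for T = ∅,
-- where the sum is 0 while any program takes a constant number of steps.
scheduleSize : ℕ → List ℕ → ℕ
scheduleSize m T = suc (length T + stageCount m T + feedbackCount m T)

BuildsPlan : Cmd → ℕ → (W m : ℕ) → List ℕ → Set
BuildsPlan build C W m T =
  (σ : Store W) → GivenSupport m T σ →
  ∃₂ λ σ′ u → Run (capacity m W) build σ σ′ u
    × HoldsPlan (planFor W m T) σ′
    × recs σ′ support ≡ T
    × ops u + genOps u ≤ C * scheduleSize m T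
    × allocdRecs u ≤ C * scheduleSize m T
    × allocdWords u ≡ 0

-- No record array except the descriptors is touched, so nothing is added
-- to the persistent ones.
ReducesOnline : ℕ → (W m : ℕ) → List ℕ → Set
ReducesOnline C W m T =
  (A : Vec Bool (m + m)) (σ : Store W) → GivenSupport m T σ → CallerArrays m A σ →
  ∃₂ λ σ′ u → Run (capacity m W) reduceOnline σ σ′ u
    × words σ′ output ≡ pack W (frobeniusReduce m T A)
    × words σ′ scratch ≡ pack W (finalState m T A) ++ scratchTail sentinel
    × words σ′ input ≡ words σ input
    × (∀ a → a ≢ descriptors → recs σ′ a ≡ recs σ a)
    × length (recs σ′ descriptors) ≡ length T
    × allocdWords u ≡ ceilDiv m W + 1
    × allocdRecs u ≡ length T
    × allocdWords u + allocdRecs u ≤ C * (ceilDiv m W + length T)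
    × genOps u ≤ C * scheduleSize m T

{-# OPTIONS --safe #-}
module Submission where

-- Over 𝔽₂ the feedback operator M = Σ_t N^(Δ_t) satisfies M^(2^k) = Σ_t N^(2^k Δ_t), so the product
-- of the stages I + M^(2^k), k < r, is inverse to I + M as soon as all 2^r Δ_t ≥ m.  The final state Y
-- therefore solves (I + M) Y = H, which says that Y is the quotient of A by g.
-- A shift by d = qW + b moves words by q and recombines two adjacent words by in-word shifts, and a
-- stage reads only words of index at least the one it writes, so it can run in place.
-- As T increases, the active exponents of a stage form a suffix of T, whence a stage's descriptors
-- cost O(1 + |T_k|) operations, and the sum over the stages is O(r + S_fb).

open import Defs
open import Algebra.Bundles using (module CommutativeRing)
open import Data.Bool using (Bool; true; false; if_then_else_; _∧_; _∨_; _xor_)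
open import Data.Bool.Properties using (xor-same; xor-comm; xor-assoc; xor-identityʳ; ∧-distribˡ-xor; ∧-zeroʳ; ∧-identityʳ; xor-∧-commutativeRing; ∨-conicalˡ; ∨-conicalʳ)
open import Data.Fin as Fin using (toℕ)
open import Data.List as List using (List; []; _∷_; _++_; length; map; foldr; foldl; upTo; applyUpTo; reverse; replicate; concatMap)
open import Data.List.Extrema.Nat using (argmin-all; min≤xs)
open import Data.List.Membership.Propositional using (find)
open import Data.List.Properties using (map-upTo; foldr-map; map-cong; map-∘; map-++; length-map; length-upTo; length-replicate; length-++; length-reverse; length-filter; unfold-reverse; upTo-∷ʳ; concatMap-++; ++-assoc; ++-identityʳ; filter-none; filter-some; filter-all; filter-reject)
open import Data.List.Relation.Binary.Permutation.Propositional as ↭ using (_↭_; ↭-sym)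
open import Data.List.Relation.Binary.Permutation.Propositional.Properties using (↭-reverse; All-resp-↭)
open import Data.List.Relation.Unary.All as All using (All; []; _∷_; all?)
open import Data.List.Relation.Unary.All.Properties using (map⁺; map⁻; all-filter; ¬Any⇒All¬)
open import Data.List.Relation.Unary.Any as Any using (Any; here; there)
open import Data.List.Relation.Unary.Linked as Linked using (Linked; []; [-]; _∷_)
open import Data.List.Relation.Unary.Linked.Properties using (Linked⇒All)
open import Data.Nat
open import Data.Nat.DivMod using (_/_; _%_; m≡m%n+[m/n]*n; m%n<n; m%n≤n; m/n≤m; m/n*n≤m; m<n*o⇒m/o<n)
open import Data.Nat.Induction using (<-rec)
open import Data.Nat.ListAction using (sum)
open import Data.Nat.ListAction.Properties using (sum-++)
open import Data.Nat.Logarithm using (⌈log₂_⌉; ⌈log₂⌉-mono-≤; ⌈log₂2^n⌉≡n; ⌈log₂⌈n/2⌉⌉≡⌈log₂n⌉∸1)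
open import Data.Nat.Properties
open import Data.Nat.Solver using (module +-*-Solver)
open import Data.Product using (_×_; _,_; proj₁; proj₂; ∃-syntax; Σ-syntax; ∃₂)
open import Data.Sum using (inj₁; inj₂; [_,_]′)
open import Data.Unit using (⊤; tt)
open import Data.Vec as Vec using (Vec; []; _∷_; tabulate; take; drop; toList)
open import Data.Vec.Properties using (tabulate-cong; zipWith-assoc; zipWith-identityʳ; toList∘fromList; length-toList)
open import Function using (_∘_; id)
open import Relation.Binary.Definitions using (tri<; tri≈; tri>)
open import Relation.Binary.PropositionalEquality hiding (J)
open import Relation.Nullary using (¬_; yes; no; does; contradiction)
open import Relation.Nullary.Decidable using (dec-true; dec-false; decidable-stable)
open import Algebra.Properties.CommutativeSemigroup (CommutativeRing.+-commutativeSemigroup xor-∧-commutativeRing) using () renaming (interchange to xor-interchange; x∙yz≈y∙xz to xor-swapˡ)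
open import Algebra.Properties.CommutativeSemigroup +-commutativeSemigroup using (xy∙z≈xz∙y) renaming (interchange to +-interchange)
open +-*-Solver using (solve; con) renaming (_:+_ to _⊞_; _:*_ to _⊠_; _:=_ to _⊜_)

-- Sums over 𝔽₂

-- The algebra lives on untruncated sequences `ℕ → Bool`, where shifts compose by addition.
-- Truncation enters only through the vanishing of the coefficients of a vector beyond its length,
-- which is also why a stage may drop its inactive shifts. Words too are taken at every index: the
-- zero words past the end justify both the sentinel and the guard. Most of the work concerns
-- programs. A syntactic check, `touches`, says which registers, arrays and costs a command can
-- affect. On a concrete command it computes, so most preservation facts are `refl`, and loop
-- invariants mention only what changes. The loop rules are parametrised by the quantity counted and
-- serve correctness and costs together. The iteration that applies stage `k` also generates the
-- descriptors of stage `k + 1`; the total stays within S_fb because stage `r` is empty. The plan is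
-- built by the same scan, with other loop bodies. The constant 100 is a round bound for the
-- coefficients obtained by counting operations. The claim of an `m`-bit state is met by the guarded
-- variant at word width one.

⨁ : ∀ {A : Set} → (A → Bool) → List A → Bool
⨁ f = foldr (λ x b → f x xor b) false

module _ {A : Set} where

  ⨁-cong : ∀ {f g : A → Bool} → (∀ x → f x ≡ g x) → ∀ xs → ⨁ f xs ≡ ⨁ g xs
  ⨁-cong eq []       = refl
  ⨁-cong eq (x ∷ xs) = cong₂ _xor_ (eq x) (⨁-cong eq xs)

  ⨁-congᴬ : ∀ {f g : A → Bool} {xs} → All (λ x → f x ≡ g x) xs → ⨁ f xs ≡ ⨁ g xs
  ⨁-congᴬ []         = refl
  ⨁-congᴬ (eq ∷ eqs) = cong₂ _xor_ eq (⨁-congᴬ eqs)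

  ⨁-xor : ∀ (f g : A → Bool) xs → ⨁ (λ x → f x xor g x) xs ≡ ⨁ f xs xor ⨁ g xs
  ⨁-xor f g []       = refl
  ⨁-xor f g (x ∷ xs) =
    trans (cong ((f x xor g x) xor_) (⨁-xor f g xs)) (xor-interchange (f x) (g x) _ _)

  ⨁-false : ∀ (xs : List A) → ⨁ (λ _ → false) xs ≡ false
  ⨁-false []       = refl
  ⨁-false (_ ∷ xs) = ⨁-false xs

  ⨁-↭ : ∀ (f : A → Bool) {xs ys} → xs ↭ ys → ⨁ f xs ≡ ⨁ f ys
  ⨁-↭ f ↭.refl         = refl
  ⨁-↭ f (↭.prep x p)   = cong (f x xor_) (⨁-↭ f p)
  ⨁-↭ f (↭.swap {xs} {ys} x y p) = begin
    f x xor (f y xor ⨁ f xs)  ≡⟨ xor-assoc (f x) (f y) _ ⟨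
    (f x xor f y) xor ⨁ f xs  ≡⟨ cong₂ _xor_ (xor-comm (f x) (f y)) (⨁-↭ f p) ⟩
    (f y xor f x) xor ⨁ f ys  ≡⟨ xor-assoc (f y) (f x) _ ⟩
    f y xor (f x xor ⨁ f ys)  ∎
    where open ≡-Reasoning
  ⨁-↭ f (↭.trans p q)  = trans (⨁-↭ f p) (⨁-↭ f q)

  -- Off-diagonal terms cancel in pairs.
  ⨁-diagonal : ∀ (g : A → A → Bool) → (∀ x y → g x y ≡ g y x) →
    ∀ xs → ⨁ (λ x → ⨁ (g x) xs) xs ≡ ⨁ (λ x → g x x) xs
  ⨁-diagonal g g-sym []       = refl
  ⨁-diagonal g g-sym (x ∷ xs) = begin
    (g x x xor R) xor ⨁ (λ y → g y x xor ⨁ (g y) xs) xs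
      ≡⟨ cong ((g x x xor R) xor_) (⨁-xor (λ y → g y x) _ xs) ⟩
    (g x x xor R) xor (⨁ (λ y → g y x) xs xor ⨁ (λ y → ⨁ (g y) xs) xs)
      ≡⟨ cong₂ (λ b c → (g x x xor R) xor (b xor c))
           (⨁-cong (λ y → g-sym y x) xs) (⨁-diagonal g g-sym xs) ⟩
    (g x x xor R) xor (R xor ⨁ (λ y → g y y) xs)
      ≡⟨ xor-interchange (g x x) R R _ ⟩
    (g x x xor R) xor (R xor ⨁ (λ y → g y y) xs)
      ≡⟨ cancel (g x x) R _ ⟩
    g x x xor ⨁ (λ y → g y y) xs ∎
    where
    open ≡-Reasoning
    R = ⨁ (g x) xs
    cancel : ∀ a b c → (a xor b) xor (b xor c) ≡ a xor c
    cancel a b c = begin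
      (a xor b) xor (b xor c)  ≡⟨ xor-assoc a b _ ⟩
      a xor (b xor (b xor c))  ≡⟨ cong (a xor_) (xor-assoc b b c) ⟨
      a xor ((b xor b) xor c)  ≡⟨ cong (λ z → a xor (z xor c)) (xor-same b) ⟩
      a xor c                  ∎

⨁-map : ∀ {A B : Set} (f : B → Bool) (g : A → B) xs → ⨁ f (map g xs) ≡ ⨁ (f ∘ g) xs
⨁-map f g []       = refl
⨁-map f g (x ∷ xs) = cong (f (g x) xor_) (⨁-map f g xs)

⨁-swap : ∀ {A B : Set} (g : A → B → Bool) xs ys →
  ⨁ (λ x → ⨁ (g x) ys) xs ≡ ⨁ (λ y → ⨁ (λ x → g x y) xs) ys
⨁-swap g []       ys = sym (⨁-false ys)
⨁-swap g (x ∷ xs) ys =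
  trans (cong (⨁ (g x) ys xor_) (⨁-swap g xs ys)) (sym (⨁-xor (g x) _ ys))

⨁-upTo-suc : ∀ (f : ℕ → Bool) n → ⨁ f (upTo (suc n)) ≡ f 0 xor ⨁ (f ∘ suc) (upTo n)
⨁-upTo-suc f n =
  cong (f 0 xor_) (trans (cong (⨁ f) (sym (map-upTo suc n))) (⨁-map f suc (upTo n)))

⨁-upTo-none : ∀ {f : ℕ → Bool} n → (∀ {j} → j < n → f j ≡ false) → ⨁ f (upTo n) ≡ false
⨁-upTo-none     zero    off = refl
⨁-upTo-none {f} (suc n) off =
  trans (⨁-upTo-suc f n) (cong₂ _xor_ (off z<s) (⨁-upTo-none n (off ∘ s<s)))

⨁-single : ∀ (f : ℕ → Bool) {a n} → a < n → (∀ {j} → j < n → j ≢ a → f j ≡ false) →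
  ⨁ f (upTo n) ≡ f a
⨁-single f {zero} {suc n} _ off = begin
  ⨁ f (upTo (suc n))             ≡⟨ ⨁-upTo-suc f n ⟩
  f 0 xor ⨁ (f ∘ suc) (upTo n)   ≡⟨ cong (f 0 xor_) (⨁-upTo-none n (λ j<n → off (s<s j<n) λ ())) ⟩
  f 0 xor false                  ≡⟨ xor-identityʳ (f 0) ⟩
  f 0                            ∎
  where open ≡-Reasoning
⨁-single f {suc a} {suc n} (s≤s a<n) off = begin
  ⨁ f (upTo (suc n))             ≡⟨ ⨁-upTo-suc f n ⟩
  f 0 xor ⨁ (f ∘ suc) (upTo n)   ≡⟨ cong₂ _xor_ (off z<s λ ())
                                      (⨁-single (f ∘ suc) a<n (λ j<n j≢a → off (s<s j<n) (j≢a ∘ suc-injective))) ⟩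
  f (suc a)                      ∎
  where open ≡-Reasoning

-- Coefficients of vectors and of truncated shifts

coeff-tabulate : ∀ k (p : ℕ → Bool) {i} → i < k → coeff (tabulate {n = k} (p ∘ toℕ)) i ≡ p i
coeff-tabulate (suc k) p {zero}  _         = refl
coeff-tabulate (suc k) p {suc i} (s≤s i<k) = coeff-tabulate k (p ∘ suc) i<k

coeff-beyond : ∀ {k} (v : Vec Bool k) {i} → k ≤ i → coeff v i ≡ false
coeff-beyond []      _         = refl
coeff-beyond (x ∷ v) (s≤s k≤i) = coeff-beyond v k≤i

coeff-ext : ∀ {k} (u v : Vec Bool k) → (∀ i → i < k → coeff u i ≡ coeff v i) → u ≡ v
coeff-ext []      []      _  = refl
coeff-ext (x ∷ u) (y ∷ v) eq =
  cong₂ _∷_ (eq 0 z<s) (coeff-ext u v (λ i i<k → eq (suc i) (s<s i<k)))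

coeff-zeros : ∀ k i → coeff (zeros {k}) i ≡ false
coeff-zeros zero    i       = refl
coeff-zeros (suc k) zero    = refl
coeff-zeros (suc k) (suc i) = coeff-zeros k i

coeff-⊕ : ∀ {k} (u v : Vec Bool k) i → coeff (u ⊕ v) i ≡ coeff u i xor coeff v i
coeff-⊕ []      []      i       = refl
coeff-⊕ (x ∷ u) (y ∷ v) zero    = refl
coeff-⊕ (x ∷ u) (y ∷ v) (suc i) = coeff-⊕ u v i

-- Valid at every `i`, because both sides vanish beyond the length. A left shift differs: it would
-- carry bits past the length, so `coeff-up` asks for `i < k`.
coeff-down : ∀ {k} d (v : Vec Bool k) i → coeff (down d v) i ≡ coeff v (i + d)
coeff-down {k} d v i with i <? k
... | yes i<k = coeff-tabulate k (λ j → coeff v (j + d)) i<k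
... | no  i≮k = trans (coeff-beyond (down d v) k≤i) (sym (coeff-beyond v (≤-trans k≤i (m≤m+n i d))))
  where k≤i = ≮⇒≥ i≮k

-- The coefficients of x^t p, not truncated at any length.
delay : ℕ → (ℕ → Bool) → ℕ → Bool
delay t p i = if i <ᵇ t then false else p (i ∸ t)

<ᵇ-true : ∀ {i t} → i < t → (i <ᵇ t) ≡ true
<ᵇ-true {i} {t} i<t = dec-true (i <? t) i<t

<ᵇ-false : ∀ {i t} → t ≤ i → (i <ᵇ t) ≡ false
<ᵇ-false {i} {t} t≤i = dec-false (i <? t) (≤⇒≯ t≤i)

delay-< : ∀ {t i} (p : ℕ → Bool) → i < t → delay t p i ≡ false
delay-< p i<t rewrite <ᵇ-true i<t = refl

delay-≥ : ∀ {t i} (p : ℕ → Bool) → t ≤ i → delay t p i ≡ p (i ∸ t)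
delay-≥ p t≤i rewrite <ᵇ-false t≤i = refl

coeff-up : ∀ {k} t (v : Vec Bool k) {i} → i < k → coeff (up t v) i ≡ delay t (coeff v) i
coeff-up {k} t v = coeff-tabulate k (delay t (coeff v))

coeff-foldr : ∀ {k} (h : ℕ → Vec Bool k) ds i →
  coeff (foldr (λ d Z → h d ⊕ Z) zeros ds) i ≡ ⨁ (λ d → coeff (h d) i) ds
coeff-foldr {k} h []       i = coeff-zeros k i
coeff-foldr     h (d ∷ ds) i =
  trans (coeff-⊕ (h d) _ i) (cong (coeff (h d) i xor_) (coeff-foldr h ds i))

coeff-applyStage : ∀ {k} ds (Y : Vec Bool k) i →
  coeff (applyStage ds Y) i ≡ coeff Y i xor ⨁ (λ d → coeff Y (i + d)) ds
coeff-applyStage ds Y i = trans (coeff-⊕ Y _ i)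
  (cong (coeff Y i xor_)
    (trans (coeff-foldr (λ d → down d Y) ds i) (⨁-cong (λ d → coeff-down d Y i) ds)))

coeff-drop : ∀ m {n} (v : Vec Bool (m + n)) i → coeff (drop m v) i ≡ coeff v (m + i)
coeff-drop zero    v       i = refl
coeff-drop (suc m) (x ∷ v) i = coeff-drop m v i

coeff-take : ∀ m {n} (v : Vec Bool (m + n)) {i} → i < m → coeff (take m v) i ≡ coeff v i
coeff-take (suc m) (x ∷ v) {zero}  _         = refl
coeff-take (suc m) (x ∷ v) {suc i} (s≤s i<m) = coeff-take m v i<m

coeff-assembleV : ∀ {m} T (Y : Vec Bool m) {i} → i < m →
  coeff (assembleV T Y) i ≡ ⨁ (λ t → delay t (coeff Y) i) T
coeff-assembleV T Y {i} i<m =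
  trans (coeff-foldr (λ t → up t Y) T i) (⨁-cong (λ t → coeff-up t Y i<m) T)

coeff-frobeniusReduce : ∀ m T (A : Vec Bool (m + m)) {i} → i < m →
  coeff (frobeniusReduce m T A) i ≡
    coeff A i xor ⨁ (λ t → delay t (coeff (finalState m T A)) i) T
coeff-frobeniusReduce m T A {i} i<m =
  trans (coeff-⊕ (take m A) _ i)
    (cong₂ _xor_ (coeff-take m A i<m) (coeff-assembleV T (finalState m T A) i<m))

-- Ceiling division, logarithms and the number of stages

ceilDiv-upper : ∀ a w → a ≤ ceilDiv a (suc w) * suc w
ceilDiv-upper a w = +-cancelˡ-≤ w _ _ (s≤s⁻¹ (begin
  suc (w + a)                        ≡⟨ cong suc (+-comm w a) ⟩
  suc (a + w)                        ≡⟨ cong suc (m≡m%n+[m/n]*n (a + w) (suc w)) ⟩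
  suc ((a + w) % suc w + q * suc w)  ≤⟨ +-monoˡ-≤ (q * suc w) (m%n<n (a + w) (suc w)) ⟩
  suc (w + q * suc w)                ∎))
  where
  open ≤-Reasoning
  q = (a + w) / suc w

-- Together with `ceilDiv-upper` this characterises `ceilDiv a W` as the least `c` with `a ≤ c * W`.
-- The five facts that follow are all drawn from these two.
ceilDiv-least : ∀ {a c w} → a ≤ c * suc w → ceilDiv a (suc w) ≤ c
ceilDiv-least {a} {c} {w} a≤cW = s≤s⁻¹ (m<n*o⇒m/o<n (begin-strict
  a + w           ≤⟨ +-monoˡ-≤ w a≤cW ⟩
  c * suc w + w   <⟨ n<1+n _ ⟩
  suc (c * suc w + w) ≡⟨ cong suc (+-comm (c * suc w) w) ⟩
  suc c * suc w   ∎))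
  where open ≤-Reasoning

<ceilDiv⇒*< : ∀ {a j w} → j < ceilDiv a (suc w) → j * suc w < a
<ceilDiv⇒*< j<n = ≰⇒> λ a≤jW → <⇒≱ j<n (ceilDiv-least a≤jW)

*<⇒<ceilDiv : ∀ {a j w} → j * suc w < a → j < ceilDiv a (suc w)
*<⇒<ceilDiv {a} {j} {w} jW<a =
  ≰⇒> λ n≤j → <⇒≱ jW<a (≤-trans (ceilDiv-upper a w) (*-monoˡ-≤ (suc w) n≤j))

ceilDiv≤⇒≤* : ∀ {a j w} → ceilDiv a (suc w) ≤ j → a ≤ j * suc w
ceilDiv≤⇒≤* {w = w} n≤j = ≤-trans (ceilDiv-upper _ w) (*-monoˡ-≤ (suc w) n≤j)

ceilDiv-≤ : ∀ {a w} → ceilDiv a (suc w) ≤ a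
ceilDiv-≤ {a} {w} = ceilDiv-least (m≤m*n a (suc w))

ceilDiv-1 : ∀ a → ceilDiv a 1 ≡ a
ceilDiv-1 a = ≤-antisym ceilDiv-≤ (≤-trans (ceilDiv-upper a 0) (≤-reflexive (*-identityʳ _)))

-- Strong induction through `⌈ n /2⌉`: the logarithm drops by one, and `n` is at most twice its
-- rounded-up half.
≤2^⌈log₂⌉ : ∀ n → n ≤ 2 ^ ⌈log₂ n ⌉
≤2^⌈log₂⌉ = <-rec _ step
  where
  open ≤-Reasoning
  step : ∀ n → (∀ {k} → k < n → k ≤ 2 ^ ⌈log₂ k ⌉) → n ≤ 2 ^ ⌈log₂ n ⌉
  step 0           _   = z≤n
  step 1           _   = m^n>0 2 ⌈log₂ 1 ⌉
  step n@(2+ n′) rec = begin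
    n                                  ≡⟨ ⌊n/2⌋+⌈n/2⌉≡n n ⟨
    ⌊ n /2⌋ + ⌈ n /2⌉                  ≤⟨ +-monoˡ-≤ ⌈ n /2⌉ (⌊n/2⌋≤⌈n/2⌉ n) ⟩
    ⌈ n /2⌉ + ⌈ n /2⌉                  ≤⟨ +-mono-≤ (rec (⌈n/2⌉<n n′)) (rec (⌈n/2⌉<n n′)) ⟩
    2 ^ ⌈log₂ ⌈ n /2⌉ ⌉ + 2 ^ ⌈log₂ ⌈ n /2⌉ ⌉
      ≡⟨ cong (2 ^ ⌈log₂ ⌈ n /2⌉ ⌉ +_) (+-identityʳ _) ⟨
    2 ^ suc ⌈log₂ ⌈ n /2⌉ ⌉
      ≡⟨ cong (2 ^_) (trans (cong suc (⌈log₂⌈n/2⌉⌉≡⌈log₂n⌉∸1 n)) (m+[n∸m]≡n (⌈log₂⌉-mono-≤ {2} {n} (s≤s (s≤s z≤n))))) ⟩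
    2 ^ ⌈log₂ n ⌉                      ∎

<⌈log₂⌉⇒2^< : ∀ {k n} → k < ⌈log₂ n ⌉ → 2 ^ k < n
<⌈log₂⌉⇒2^< {k} {n} k<log =
  ≰⇒> λ n≤2^k → <⇒≱ k<log (≤-trans (⌈log₂⌉-mono-≤ n≤2^k) (≤-reflexive (⌈log₂2^n⌉≡n k)))

n<2^n : ∀ n → n < 2 ^ n
n<2^n zero    = z<s
n<2^n (suc n) = begin-strict
  suc n          <⟨ +-mono-≤-< (m^n>0 2 n) (n<2^n n) ⟩
  2 ^ n + 2 ^ n  ≡⟨ cong (2 ^ n +_) (+-identityʳ _) ⟨
  2 ^ suc n      ∎
  where open ≤-Reasoning

module _ {m : ℕ} (1≤m : 1 ≤ m) {T : List ℕ} (T<m : All (_< m) T) where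

  private
    r = stageCount m T

  Δmin>0 : 0 < Δmin m T
  Δmin>0 = argmin-all id {P = 0 <_} 1≤m (map⁺ (All.map m<n⇒0<n∸m T<m))

  -- `2 ^ r` is at least `ceilDiv m Δmin`, and every gap `m ∸ t` is at least `Δmin`. If `T` contains
  -- nothing but 0 there are no stages, and the only possible gap is already `m`.
  stageCount-exhausts : All (λ t → m ≤ 2 ^ r * (m ∸ t)) T
  stageCount-exhausts with all? (_≟ 0) T
  ... | yes T⊆0 = All.map (λ where refl → ≤-reflexive (sym (+-identityʳ m))) T⊆0
  ... | no  _   with Δmin m T | Δmin>0 | min≤xs m (map (m ∸_) T)
  ...   | suc δ | _ | Δ≤ =
    All.map (λ {t} Δ≤Δt → ≤-trans (ceilDiv-upper m δ)
                    (*-mono-≤ (≤2^⌈log₂⌉ (ceilDiv m (suc δ))) Δ≤Δt))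
            (map⁻ Δ≤)

  private
    2^*Δmin<m : ∀ {k} → k < ⌈log₂ ceilDiv m (Δmin m T) ⌉ → 2 ^ k * Δmin m T < m
    2^*Δmin<m k<r with Δmin m T | Δmin>0
    ... | suc δ | _ = <ceilDiv⇒*< (<⌈log₂⌉⇒2^< k<r)

  -- Minimality of `r`: if every exponent were inactive, the smallest gap would be too, against
  -- `2 ^ k * Δmin m T < m`. Hence a loop that stops at the first empty stage stops no earlier than
  -- `r`; by `active-last` it stops no later.
  stage-active : ∀ {k} → k < r → Any (λ t → 2 ^ k * (m ∸ t) < m) T
  stage-active {k} k<r with all? (_≟ 0) T
  ... | no _ = decidable-stable (Any.any? (λ t → 2 ^ k * (m ∸ t) <? m) T) λ none →
    <⇒≱ (2^*Δmin<m k<r)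
      -- The default value `m` of the minimum has to satisfy the bound as well; it does, since
      -- `2 ^ k` is positive.
      (argmin-all id {P = λ Δ → m ≤ 2 ^ k * Δ} (m≤n*m m (2 ^ k) ⦃ m^n≢0 2 k ⦄)
        (map⁺ (All.map ≮⇒≥ (¬Any⇒All¬ T none))))

  active-last : active m T r ≡ []
  active-last = filter-none _ (All.map ≤⇒≯ stageCount-exhausts)

  active-some : ∀ {k} → k < r → 0 < length (active m T k)
  active-some k<r = filter-some _ (stage-active k<r)

  stage⇒2^<m : ∀ {k} → k < r → 2 ^ k < m
  stage⇒2^<m {k} k<r with find (stage-active k<r)
  ... | t , t∈T , 2^kΔ<m = ≤-<-trans
    (m≤m*n (2 ^ k) (m ∸ t) ⦃ >-nonZero (m<n⇒0<n∸m (All.lookup T<m t∈T)) ⦄) 2^kΔ<m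

  -- The scan doubles its power once more after the last stage, so `k = r` has to be covered; this
  -- costs the factor 2.
  2^≤2*m : ∀ {k} → k ≤ r → 2 ^ k ≤ 2 * m
  2^≤2*m {zero}  _   = ≤-trans 1≤m (m≤n*m m 2)
  2^≤2*m {suc k} k<r = *-monoʳ-≤ 2 (<⇒≤ (stage⇒2^<m k<r))

  stageCount≤ : r ≤ m
  -- The lemma is abstracted together with `r`, so that its hypothesis `k < r` follows the case
  -- split.
  stageCount≤ with r | (λ {k} → stage⇒2^<m {k})
  ... | zero  | _ = z≤n
  ... | suc k | h = ≤-trans (n<2^n k) (<⇒≤ (h (n<1+n k)))

length-increasing : ∀ {m a T} → Linked _<_ (a ∷ T) → All (_< m) (a ∷ T) → a + length (a ∷ T) ≤ m
length-increasing {a = a} [-]       (a<m ∷ _)   = ≤-trans (≤-reflexive (+-comm a 1)) a<m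
length-increasing {m} {a} {b ∷ T} (a<b ∷ T↗) (_ ∷ T<m) = begin
  a + suc (length (b ∷ T))  ≡⟨ +-suc a _ ⟩
  suc a + length (b ∷ T)    ≤⟨ +-monoˡ-≤ _ a<b ⟩
  b + length (b ∷ T)        ≤⟨ length-increasing T↗ T<m ⟩
  m                         ∎
  where open ≤-Reasoning

-- Keeps `s`, which serves as a loop bound and an array length, within the capacity of a scalar.
length-support : ∀ {m T} → Linked _<_ T → All (_< m) T → length T ≤ m
length-support []         _   = z≤n
length-support T↗@[-]     T<m = ≤-trans (m≤n+m _ _) (length-increasing T↗ T<m)
length-support T↗@(_ ∷ _) T<m = ≤-trans (m≤n+m _ _) (length-increasing T↗ T<m)

-- Frobenius factorisation

-- `applyStage` on untruncated sequences. Here shifts compose by adding their amounts, so the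
-- operators commute and can be squared without any boundary cases.
stageOp : List ℕ → (ℕ → Bool) → ℕ → Bool
stageOp ds p i = p i xor ⨁ (λ d → p (i + d)) ds

stageOp-cong : ∀ ds {p q : ℕ → Bool} → (∀ i → p i ≡ q i) → ∀ i → stageOp ds p i ≡ stageOp ds q i
stageOp-cong ds eq i = cong₂ _xor_ (eq i) (⨁-cong (λ d → eq (i + d)) ds)

stageOp-expand : ∀ ds es p i → stageOp ds (stageOp es p) i ≡
  (p i xor ⨁ (λ e → p (i + e)) es) xor
  (⨁ (λ d → p (i + d)) ds xor ⨁ (λ d → ⨁ (λ e → p (i + d + e)) es) ds)
stageOp-expand ds es p i = cong (stageOp es p i xor_) (⨁-xor (λ d → p (i + d)) _ ds)

stageOp-comm : ∀ ds es p i → stageOp ds (stageOp es p) i ≡ stageOp es (stageOp ds p) i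
stageOp-comm ds es p i = begin
  stageOp ds (stageOp es p) i       ≡⟨ stageOp-expand ds es p i ⟩
  (p i xor E) xor (D xor _)         ≡⟨ xor-interchange (p i) E D _ ⟩
  (p i xor D) xor (E xor _)         ≡⟨ cong (λ z → (p i xor D) xor (E xor z))
                                         (trans (⨁-swap (λ d e → p (i + d + e)) ds es)
                                           (⨁-cong (λ e → ⨁-cong (λ d → cong p (xy∙z≈xz∙y i d e)) ds) es)) ⟩
  (p i xor D) xor (E xor _)         ≡⟨ stageOp-expand es ds p i ⟨
  stageOp es (stageOp ds p) i       ∎
  where
  open ≡-Reasoning
  D = ⨁ (λ d → p (i + d)) ds
  E = ⨁ (λ e → p (i + e)) es

-- In characteristic two `(I + D)^2 = I + D^2`, and the mixed products within `D^2` cancel by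
-- `⨁-diagonal`, leaving each shift doubled.
stageOp-square : ∀ ds p i → stageOp ds (stageOp ds p) i ≡ stageOp (map (2 *_) ds) p i
stageOp-square ds p i = begin
  stageOp ds (stageOp ds p) i       ≡⟨ stageOp-expand ds ds p i ⟩
  (p i xor D) xor (D xor DD)        ≡⟨ xor-assoc (p i) D _ ⟩
  p i xor (D xor (D xor DD))        ≡⟨ cong (p i xor_) (xor-assoc D D DD) ⟨
  p i xor ((D xor D) xor DD)        ≡⟨ cong (λ z → p i xor (z xor DD)) (xor-same D) ⟩
  p i xor DD                        ≡⟨ cong (p i xor_) (⨁-diagonal (λ d e → p (i + d + e)) (λ d e → cong p (xy∙z≈xz∙y i d e)) ds) ⟩
  p i xor ⨁ (λ d → p (i + d + d)) ds
    ≡⟨ cong (p i xor_) (⨁-cong (λ d → cong p (trans (+-assoc i d d) (cong (λ z → i + (d + z)) (sym (+-identityʳ d))))) ds) ⟩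
  p i xor ⨁ (λ d → p (i + 2 * d)) ds ≡⟨ cong (p i xor_) (⨁-map (λ d → p (i + d)) (2 *_) ds) ⟨
  stageOp (map (2 *_) ds) p i       ∎
  where
  open ≡-Reasoning
  D  = ⨁ (λ d → p (i + d)) ds
  DD = ⨁ (λ d → ⨁ (λ e → p (i + d + e)) ds) ds

-- Keeps the inactive shifts: unlike `shifts`, this family is carried to the next stage by doubling
-- every member, as squaring requires.
allShifts : ℕ → List ℕ → ℕ → List ℕ
allShifts m T k = map (λ t → 2 ^ k * (m ∸ t)) T

allShifts-suc : ∀ m T k p i → stageOp (map (2 *_) (allShifts m T k)) p i ≡ stageOp (allShifts m T (suc k)) p i
allShifts-suc m T k p i = cong (p i xor_) (begin
  ⨁ (λ d → p (i + d)) (map (2 *_) (allShifts m T k))   ≡⟨ ⨁-map (λ d → p (i + d)) (2 *_) (allShifts m T k) ⟩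
  ⨁ (λ d → p (i + 2 * d)) (allShifts m T k)            ≡⟨ ⨁-map (λ d → p (i + 2 * d)) (λ t → 2 ^ k * (m ∸ t)) T ⟩
  ⨁ (λ t → p (i + 2 * (2 ^ k * (m ∸ t)))) T            ≡⟨ ⨁-cong (λ t → cong (λ z → p (i + z)) (*-assoc 2 (2 ^ k) (m ∸ t))) T ⟨
  ⨁ (λ t → p (i + 2 ^ suc k * (m ∸ t))) T              ≡⟨ ⨁-map (λ d → p (i + d)) (λ t → 2 ^ suc k * (m ∸ t)) T ⟨
  ⨁ (λ d → p (i + d)) (allShifts m T (suc k))          ∎)
  where open ≡-Reasoning

module _ {m : ℕ} where

  -- An inactive shift is at least `m`, hence reads only the zeros beyond the end of `Y`.
  ⨁-shifts : ∀ (Y : Vec Bool m) T k i →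
    ⨁ (λ d → coeff Y (i + d)) (shifts m T k) ≡ ⨁ (λ d → coeff Y (i + d)) (allShifts m T k)
  ⨁-shifts Y []      k i = refl
  ⨁-shifts Y (t ∷ T) k i with 2 ^ k * (m ∸ t) <? m
  ... | yes d<m rewrite dec-true (2 ^ k * (m ∸ t) <? m) d<m =
    cong (coeff Y (i + 2 ^ k * (m ∸ t)) xor_) (⨁-shifts Y T k i)
  ... | no  d≮m rewrite dec-false (2 ^ k * (m ∸ t) <? m) d≮m =
    trans (⨁-shifts Y T k i)
      (cong (_xor ⨁ (λ d → coeff Y (i + d)) (allShifts m T k))
        (sym (coeff-beyond Y (≤-trans (≮⇒≥ d≮m) (m≤n+m _ i)))))

  coeff-stateAfter : ∀ T k (H : Vec Bool m) i →
    coeff (stateAfter T (suc k) H) i ≡ stageOp (allShifts m T k) (coeff (stateAfter T k H)) i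
  coeff-stateAfter T k H i = trans (coeff-applyStage (shifts m T k) Y i) (cong (coeff Y i xor_) (⨁-shifts Y T k i))
    where Y = stateAfter T k H

  -- With M = Σ_t N^(Δ_t): (I + M) ∏_{j<k} (I + M^(2^j)) = I + M^(2^k).
  stages-telescope : ∀ T k (H : Vec Bool m) i →
    stageOp (allShifts m T 0) (coeff (stateAfter T k H)) i ≡ stageOp (allShifts m T k) (coeff H) i
  stages-telescope T zero    H i = refl
  stages-telescope T (suc k) H i = begin
    stageOp D₀ (coeff (stateAfter T (suc k) H)) i            ≡⟨ stageOp-cong D₀ (coeff-stateAfter T k H) i ⟩
    stageOp D₀ (stageOp Dₖ (coeff (stateAfter T k H))) i     ≡⟨ stageOp-comm D₀ Dₖ (coeff (stateAfter T k H)) i ⟩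
    stageOp Dₖ (stageOp D₀ (coeff (stateAfter T k H))) i     ≡⟨ stageOp-cong Dₖ (stages-telescope T k H) i ⟩
    stageOp Dₖ (stageOp Dₖ (coeff H)) i                      ≡⟨ stageOp-square Dₖ (coeff H) i ⟩
    stageOp (map (2 *_) Dₖ) (coeff H) i                      ≡⟨ allShifts-suc m T k (coeff H) i ⟩
    stageOp (allShifts m T (suc k)) (coeff H) i              ∎
    where
    open ≡-Reasoning
    D₀ = allShifts m T 0
    Dₖ = allShifts m T k

  finalState-solves : ∀ T (A : Vec Bool (m + m)) → 1 ≤ m → All (_< m) T → ∀ i →
    coeff A (m + i) ≡ coeff (finalState m T A) i xor ⨁ (λ t → coeff (finalState m T A) (i + (m ∸ t))) T
  finalState-solves T A 1≤m T<m i = sym (begin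
    coeff Y i xor ⨁ (λ t → coeff Y (i + (m ∸ t))) T
      ≡⟨ cong (coeff Y i xor_) (trans (⨁-map (λ d → coeff Y (i + d)) (λ t → 1 * (m ∸ t)) T)
           (⨁-cong (λ t → cong (λ z → coeff Y (i + z)) (*-identityˡ (m ∸ t))) T)) ⟨
    stageOp (allShifts m T 0) (coeff Y) i
      ≡⟨ stages-telescope T r H i ⟩
    coeff H i xor ⨁ (λ d → coeff H (i + d)) (allShifts m T r)
      -- All shifts of stage `r` are at least `m`, so the power `M^(2^r)` annihilates `H`.
      ≡⟨ cong (coeff H i xor_) (trans (⨁-map (λ d → coeff H (i + d)) (λ t → 2 ^ r * (m ∸ t)) T)
           (trans (⨁-congᴬ (All.map (λ m≤ → coeff-beyond H (≤-trans m≤ (m≤n+m _ i))) (stageCount-exhausts 1≤m T<m)))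
                  (⨁-false T))) ⟩
    coeff H i xor false  ≡⟨ xor-identityʳ _ ⟩
    coeff H i            ≡⟨ coeff-drop m A i ⟩
    coeff A (m + i)      ∎)
    where
    open ≡-Reasoning
    r = stageCount m T
    H = drop m A
    Y = finalState m T A

-- Division by the modulus

convolve-⨁ : ∀ p q i → convolve p q i ≡ ⨁ (λ j → p j ∧ q (i ∸ j)) (upTo (suc i))
convolve-⨁ p q i = foldr-map _xor_ (λ j → p j ∧ q (i ∸ j)) false (upTo (suc i))

convolve-xor : ∀ p q q′ i → convolve p (λ j → q j xor q′ j) i ≡ convolve p q i xor convolve p q′ i
convolve-xor p q q′ i = begin
  convolve p (λ j → q j xor q′ j) i    ≡⟨ convolve-⨁ p (λ j → q j xor q′ j) i ⟩
  ⨁ (λ j → p j ∧ (q (i ∸ j) xor q′ (i ∸ j))) (upTo (suc i))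
    ≡⟨ ⨁-cong (λ j → ∧-distribˡ-xor (p j) _ _) (upTo (suc i)) ⟩
  ⨁ (λ j → (p j ∧ q (i ∸ j)) xor (p j ∧ q′ (i ∸ j))) (upTo (suc i))
    ≡⟨ ⨁-xor (λ j → p j ∧ q (i ∸ j)) _ (upTo (suc i)) ⟩
  _ ≡⟨ cong₂ _xor_ (convolve-⨁ p q i) (convolve-⨁ p q′ i) ⟨
  convolve p q i xor convolve p q′ i   ∎
  where open ≡-Reasoning

≡ᵇ-false : ∀ {a b} → a ≢ b → (a ≡ᵇ b) ≡ false
≡ᵇ-false {a} {b} = dec-false (a ≟ b)

-- `t ≡ᵇ_` is the coefficient sequence of x^t. Only the index `i ∸ t` can contribute to the
-- convolution, and there is none when `i < t`.
convolve-monomial : ∀ p t i → convolve p (t ≡ᵇ_) i ≡ delay t p i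
convolve-monomial p t i with <-≤-connex i t
... | inj₁ i<t = begin
  convolve p (t ≡ᵇ_) i                         ≡⟨ convolve-⨁ p (t ≡ᵇ_) i ⟩
  ⨁ (λ j → p j ∧ (t ≡ᵇ i ∸ j)) (upTo (suc i))  ≡⟨ ⨁-upTo-none (suc i) (λ {j} _ → trans
                                                    (cong (p j ∧_) (≡ᵇ-false (>⇒≢ (≤-<-trans (m∸n≤m i j) i<t))))
                                                    (∧-zeroʳ (p j))) ⟩
  false                                        ≡⟨ delay-< p i<t ⟨
  delay t p i                                  ∎
  where open ≡-Reasoning
... | inj₂ t≤i = begin
  convolve p (t ≡ᵇ_) i                         ≡⟨ convolve-⨁ p (t ≡ᵇ_) i ⟩
  ⨁ (λ j → p j ∧ (t ≡ᵇ i ∸ j)) (upTo (suc i))  ≡⟨ ⨁-single _ (s≤s (m∸n≤m i t)) (λ {j} j≤i j≢ → trans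
                                                    (cong (p j ∧_) (≡ᵇ-false {t} {i ∸ j} λ t≡ → j≢
                                                      (sym (trans (cong (i ∸_) t≡) (m∸[m∸n]≡n (s≤s⁻¹ j≤i))))))
                                                    (∧-zeroʳ (p j))) ⟩
  p (i ∸ t) ∧ (t ≡ᵇ i ∸ (i ∸ t))               ≡⟨ cong (λ z → p (i ∸ t) ∧ (t ≡ᵇ z)) (m∸[m∸n]≡n t≤i) ⟩
  p (i ∸ t) ∧ (t ≡ᵇ t)                         ≡⟨ cong (p (i ∸ t) ∧_) (dec-true (t ≟ t) refl) ⟩
  p (i ∸ t) ∧ true                             ≡⟨ ∧-identityʳ _ ⟩
  p (i ∸ t)                                    ≡⟨ delay-≥ p t≤i ⟨
  delay t p i                                  ∎
  where open ≡-Reasoning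

convolve-modulus : ∀ p m T i → convolve p (modulus m T) i ≡ delay m p i xor ⨁ (λ t → delay t p i) T
convolve-modulus p m []      i = trans (convolve-monomial p m i) (sym (xor-identityʳ _))
convolve-modulus p m (t ∷ T) i = begin
  convolve p (modulus m (t ∷ T)) i                        ≡⟨ convolve-xor p (t ≡ᵇ_) (modulus m T) i ⟩
  convolve p (t ≡ᵇ_) i xor convolve p (modulus m T) i     ≡⟨ cong₂ _xor_ (convolve-monomial p t i) (convolve-modulus p m T i) ⟩
  delay t p i xor (delay m p i xor ⨁ (λ t → delay t p i) T) ≡⟨ xor-swapˡ (delay t p i) (delay m p i) _ ⟩
  delay m p i xor (delay t p i xor ⨁ (λ t → delay t p i) T) ∎
  where open ≡-Reasoning

-- The quotient is the final state Y: the high half of Y g is (I + M) Y = H, its low half V(Y).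
frobeniusReduce-remainder : ∀ {m T} → 1 ≤ m → All (_< m) T → (A : Vec Bool (m + m)) →
  IsRemainder m T A (frobeniusReduce m T A)
frobeniusReduce-remainder {m} {T} 1≤m T<m A = m , Y , λ i → trans (division i)
  (cong (_xor coeff R i) (sym (convolve-modulus (coeff Y) m T i)))
  where
  Y = finalState m T A
  R = frobeniusReduce m T A
  division : ∀ i → coeff A i ≡ (delay m (coeff Y) i xor ⨁ (λ t → delay t (coeff Y) i) T) xor coeff R i
  division i with <-≤-connex i m
  ... | inj₁ i<m = begin
    coeff A i                       ≡⟨ xor-identityʳ _ ⟨
    coeff A i xor false             ≡⟨ cong (coeff A i xor_) (xor-same V) ⟨
    coeff A i xor (V xor V)         ≡⟨ xor-swapˡ (coeff A i) V V ⟩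
    V xor (coeff A i xor V)         ≡⟨ cong₂ (λ a b → (a xor V) xor b) (delay-< (coeff Y) i<m) (coeff-frobeniusReduce m T A i<m) ⟨
    (delay m (coeff Y) i xor V) xor coeff R i ∎
    where
    open ≡-Reasoning
    V = ⨁ (λ t → delay t (coeff Y) i) T
  ... | inj₂ m≤i = begin
    coeff A i                       ≡⟨ cong (coeff A) (m+[n∸m]≡n m≤i) ⟨
    coeff A (m + (i ∸ m))           ≡⟨ finalState-solves T A 1≤m T<m (i ∸ m) ⟩
    coeff Y (i ∸ m) xor ⨁ (λ t → coeff Y (i ∸ m + (m ∸ t))) T
      -- At a position `i ≥ m`, multiplication by x^t reads `Y` at `i ∸ t`, which is `i ∸ m`
      -- advanced by the gap `m ∸ t`: a tap of `g` acts there as a feedback shift.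
      ≡⟨ cong₂ _xor_ (delay-≥ (coeff Y) m≤i) (⨁-congᴬ (All.map (λ t<m → trans
           (delay-≥ (coeff Y) (≤-trans (<⇒≤ t<m) m≤i))
           (cong (coeff Y) (∸-split m≤i (<⇒≤ t<m)))) T<m)) ⟨
    delay m (coeff Y) i xor V       ≡⟨ xor-identityʳ _ ⟨
    (delay m (coeff Y) i xor V) xor false ≡⟨ cong ((delay m (coeff Y) i xor V) xor_) (coeff-beyond R m≤i) ⟨
    (delay m (coeff Y) i xor V) xor coeff R i ∎
    where
    open ≡-Reasoning
    V = ⨁ (λ t → delay t (coeff Y) i) T
    ∸-split : ∀ {i m t} → m ≤ i → t ≤ m → i ∸ t ≡ i ∸ m + (m ∸ t)
    ∸-split {i} {m} {t} m≤i t≤m = begin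
      i ∸ t              ≡⟨ cong (_∸ t) (m∸n+n≡m m≤i) ⟨
      i ∸ m + m ∸ t      ≡⟨ +-∸-assoc (i ∸ m) t≤m ⟩
      i ∸ m + (m ∸ t)    ∎

-- Active exponents of a stage

module _ {m : ℕ} (k : ℕ) where

  private
    P : ℕ → Set
    P t = 2 ^ k * (m ∸ t) < m

  active-upward : ∀ {t u} → t ≤ u → P t → P u
  active-upward t≤u = ≤-<-trans (*-monoʳ-≤ (2 ^ k) (∸-monoʳ-≤ m t≤u))

  -- Activity passes to larger exponents, so the filter keeps everything after the first active one.
  -- Splitting `T` explicitly allows a position counted from the end of `T` to be read as a position
  -- in the active list.
  active-suffix : ∀ {T} → Linked _<_ T → ∃[ U ] T ≡ U ++ active m T k × All (λ t → ¬ P t) U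
  active-suffix {[]}    _  = [] , refl , []
  active-suffix {t ∷ T} T↗ with 2 ^ k * (m ∸ t) <? m
  ... | yes p = [] , sym (filter-all (λ t → 2 ^ k * (m ∸ t) <? m) (p ∷ later T↗)) , []
    where
    later : ∀ {T} → Linked _<_ (t ∷ T) → All P T
    later [-]          = []
    later (t<u ∷ T↗) = All.map (λ t<v → active-upward (<⇒≤ t<v) p) (Linked⇒All <-trans t<u T↗)
  ... | no ¬p with active-suffix (Linked.tail T↗)
  ...   | U , T≡ , ¬U = t ∷ U , cong (t ∷_) (trans T≡ (cong (U ++_) (sym (filter-reject (λ t → 2 ^ k * (m ∸ t) <? m) ¬p)))) , ¬p ∷ ¬U

-- Arrays

module _ {A : Set} {z : A} where

  get-beyond : ∀ (xs : List A) {i} → length xs ≤ i → get z xs i ≡ z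
  get-beyond []       _         = refl
  get-beyond (x ∷ xs) (s≤s ≤i) = get-beyond xs ≤i

  get-put-≡ : ∀ (xs : List A) {i y} → i < length xs → get z (put xs i y) i ≡ y
  get-put-≡ (x ∷ xs) {zero}  _         = refl
  get-put-≡ (x ∷ xs) {suc i} (s≤s i<) = get-put-≡ xs i<

  get-put-≢ : ∀ (xs : List A) {i j y} → i ≢ j → get z (put xs i y) j ≡ get z xs j
  get-put-≢ []       {i}                   i≢j = refl
  get-put-≢ (x ∷ xs) {zero}  {zero}  i≢j = contradiction refl i≢j
  get-put-≢ (x ∷ xs) {zero}  {suc j} i≢j = refl
  get-put-≢ (x ∷ xs) {suc i} {zero}  i≢j = refl
  get-put-≢ (x ∷ xs) {suc i} {suc j} i≢j = get-put-≢ xs (i≢j ∘ cong suc)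

  get-++ˡ : ∀ (xs : List A) {ys i} → i < length xs → get z (xs ++ ys) i ≡ get z xs i
  get-++ˡ (x ∷ xs) {i = zero}  _         = refl
  get-++ˡ (x ∷ xs) {i = suc i} (s≤s i<) = get-++ˡ xs i<

  get-++ʳ : ∀ (xs : List A) {ys} i → get z (xs ++ ys) (length xs + i) ≡ get z ys i
  get-++ʳ []       i = refl
  get-++ʳ (x ∷ xs) i = get-++ʳ xs i

  get-map-upTo : ∀ (f : ℕ → A) {n i} → i < n → get z (map f (upTo n)) i ≡ f i
  get-map-upTo f {n} {i} i<n = trans (cong (λ xs → get z xs i) (map-upTo f n)) (get-applyUpTo f i<n)
    where
    get-applyUpTo : ∀ (f : ℕ → A) {n i} → i < n → get z (applyUpTo f n) i ≡ f i
    get-applyUpTo f {suc n} {zero}  _         = refl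
    get-applyUpTo f {suc n} {suc i} (s≤s i<n) = get-applyUpTo (f ∘ suc) i<n

  get-ext : ∀ (xs ys : List A) → length xs ≡ length ys →
    (∀ {i} → i < length xs → get z xs i ≡ get z ys i) → xs ≡ ys
  get-ext []       []       _   _  = refl
  get-ext (x ∷ xs) (y ∷ ys) len eq =
    cong₂ _∷_ (eq z<s) (get-ext xs ys (suc-injective len) (eq ∘ s<s))

  get-replicate : ∀ n i → get z (replicate n z) i ≡ z
  get-replicate zero    i       = refl
  get-replicate (suc n) zero    = refl
  get-replicate (suc n) (suc i) = get-replicate n i

  get-All : ∀ {P : A → Set} {xs i} → All P xs → i < length xs → P (get z xs i)
  get-All {i = zero}  (p ∷ _)  _         = p
  get-All {i = suc i} (_ ∷ ps) (s≤s i<) = get-All ps i<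

  drop-get : ∀ (xs : List A) {i} → i < length xs → List.drop i xs ≡ get z xs i ∷ List.drop (suc i) xs
  drop-get (x ∷ xs) {zero}  _         = refl
  drop-get (x ∷ xs) {suc i} (s≤s i<) = drop-get xs i<

  get-reverse : ∀ (xs : List A) {i} → i < length xs → get z (reverse xs) i ≡ get z xs (length xs ∸ 1 ∸ i)
  get-reverse (x ∷ xs) {i} i< with <-≤-connex i (length xs)
  ... | inj₁ i<n = begin
    get z (reverse (x ∷ xs)) i         ≡⟨ cong (λ ys → get z ys i) (unfold-reverse x xs) ⟩
    get z (reverse xs ++ x ∷ []) i     ≡⟨ get-++ˡ (reverse xs) (subst (i <_) (sym (length-reverse xs)) i<n) ⟩
    get z (reverse xs) i               ≡⟨ get-reverse xs i<n ⟩
    get z (x ∷ xs) (suc (length xs ∸ 1 ∸ i)) ≡⟨ cong (get z (x ∷ xs)) (suc-∸ i<n) ⟩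
    get z (x ∷ xs) (length xs ∸ i)     ∎
    where
    open ≡-Reasoning
    suc-∸ : ∀ {i n} → i < n → suc (n ∸ 1 ∸ i) ≡ n ∸ i
    suc-∸ (s≤s i≤n) = sym (+-∸-assoc 1 i≤n)
  ... | inj₂ n≤i with ≤-antisym (s≤s⁻¹ i<) n≤i
  ...   | refl = begin
    get z (reverse (x ∷ xs)) (length xs)                ≡⟨ cong (λ ys → get z ys (length xs)) (unfold-reverse x xs) ⟩
    get z (reverse xs ++ x ∷ []) (length xs)            ≡⟨ cong (get z (reverse xs ++ x ∷ []))
                                                             (sym (trans (+-identityʳ _) (length-reverse xs))) ⟩
    get z (reverse xs ++ x ∷ []) (length (reverse xs) + 0) ≡⟨ get-++ʳ (reverse xs) 0 ⟩
    x                                                   ≡⟨ cong (get z (x ∷ xs)) (n∸n≡0 (length xs)) ⟨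
    get z (x ∷ xs) (length xs ∸ length xs)              ∎
    where open ≡-Reasoning

drop-length : ∀ {A : Set} (xs : List A) → List.drop (length xs) xs ≡ []
drop-length []       = refl
drop-length (x ∷ xs) = drop-length xs

get-map : ∀ {A B : Set} (f : A → B) {z z′} xs {i} → i < length xs → get z′ (map f xs) i ≡ f (get z xs i)
get-map f (x ∷ xs) {zero}  _         = refl
get-map f (x ∷ xs) {suc i} (s≤s i<) = get-map f xs i<

length-put : ∀ {A : Set} (xs : List A) i y → length (put xs i y) ≡ length xs
length-put []       i       y = refl
length-put (x ∷ xs) zero    y = refl
length-put (x ∷ xs) (suc i) y = cong suc (length-put xs i y)

-- Packed words

⊕-identityʳ : ∀ {k} (u : Vec Bool k) → u ⊕ zeros ≡ u
⊕-identityʳ = zipWith-identityʳ xor-identityʳ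

⊕-assoc : ∀ {k} (u v w : Vec Bool k) → u ⊕ v ⊕ w ≡ u ⊕ (v ⊕ w)
⊕-assoc = zipWith-assoc xor-assoc

up-zeros : ∀ {k} t → up t (zeros {k}) ≡ zeros
up-zeros {k} t = coeff-ext _ _ λ i i<k → trans (coeff-up t zeros i<k) (trans (vanish i) (sym (coeff-zeros k i)))
  where
  vanish : ∀ i → delay t (coeff (zeros {k})) i ≡ false
  vanish i with <-≤-connex i t
  ... | inj₁ i<t = delay-< (coeff (zeros {k})) i<t
  ... | inj₂ t≤i = trans (delay-≥ (coeff (zeros {k})) t≤i) (coeff-zeros k (i ∸ t))

down-zeros : ∀ {k} d → down d (zeros {k}) ≡ zeros
down-zeros {k} d = coeff-ext _ _ λ i _ → trans (coeff-down d (zeros {k}) i) (trans (coeff-zeros k (i + d)) (sym (coeff-zeros k i)))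

-- Packs a whole sequence, not a vector: every index `j` is legal, and the words past the end of a
-- vector are zero instead of absent.
wordAt : ∀ W → (ℕ → Bool) → ℕ → Word W
wordAt W p j = tabulate λ b → p (j * W + toℕ b)

module _ {W : ℕ} where

  coeff-wordAt : ∀ (p : ℕ → Bool) j {i} → i < W → coeff (wordAt W p j) i ≡ p (j * W + i)
  coeff-wordAt p j = coeff-tabulate W (λ b → p (j * W + b))

  wordAt-cong : ∀ {p q : ℕ → Bool} j → (∀ i → p i ≡ q i) → wordAt W p j ≡ wordAt W q j
  wordAt-cong j eq = tabulate-cong λ b → eq (j * W + toℕ b)

  wordAt-ext : ∀ (u : Word W) (p : ℕ → Bool) j → (∀ {i} → i < W → coeff u i ≡ p (j * W + i)) → u ≡ wordAt W p j
  wordAt-ext u p j eq = coeff-ext _ _ λ i i<W → trans (eq i<W) (sym (coeff-wordAt p j i<W))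

  wordAt-zero : ∀ {p} j → (∀ {i} → j * W ≤ i → p i ≡ false) → wordAt W p j ≡ zeros
  wordAt-zero {p} j vanish = sym (wordAt-ext zeros p j λ {i} _ →
    trans (coeff-zeros W i) (sym (vanish (m≤m+n (j * W) i))))

  wordAt-xor : ∀ (p q : ℕ → Bool) j → wordAt W p j ⊕ wordAt W q j ≡ wordAt W (λ i → p i xor q i) j
  wordAt-xor p q j = wordAt-ext _ (λ i → p i xor q i) j λ {i} i<W →
    trans (coeff-⊕ (wordAt W p j) _ i) (cong₂ _xor_ (coeff-wordAt p j i<W) (coeff-wordAt q j i<W))

  -- A left fold, to mirror the loop that adds one shifted word after another to the accumulator.
  wordAt-⨁ : ∀ (p : ℕ → Bool) (h : ℕ → ℕ → Bool) j ds →
    foldl (λ w d → w ⊕ wordAt W (h d) j) (wordAt W p j) ds ≡ wordAt W (λ i → p i xor ⨁ (λ d → h d i) ds) j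
  wordAt-⨁ p h j []       = wordAt-cong j (λ i → sym (xor-identityʳ (p i)))
  wordAt-⨁ p h j (d ∷ ds) = begin
    foldl _ (wordAt W p j ⊕ wordAt W (h d) j) ds                  ≡⟨ cong (λ w → foldl _ w ds) (wordAt-xor p (h d) j) ⟩
    foldl _ (wordAt W (λ i → p i xor h d i) j) ds                 ≡⟨ wordAt-⨁ (λ i → p i xor h d i) h j ds ⟩
    wordAt W (λ i → (p i xor h d i) xor ⨁ (λ d → h d i) ds) j     ≡⟨ wordAt-cong j (λ i → xor-assoc (p i) (h d i) (⨁ (λ d → h d i) ds)) ⟩
    wordAt W (λ i → p i xor ⨁ (λ d → h d i) (d ∷ ds)) j           ∎
    where open ≡-Reasoning

delay-+ : ∀ t y (p : ℕ → Bool) {x} → x ≡ t + y → delay t p x ≡ p y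
delay-+ t y p refl = trans (delay-≥ p (m≤m+n t y)) (cong p (m+n∸m≡n t y))

module _ {w : ℕ} where

  private
    W = suc w

  wordAt-beyond : ∀ {k} (v : Vec Bool k) {j} → ceilDiv k W ≤ j → wordAt W (coeff v) j ≡ zeros
  wordAt-beyond v {j} n≤j = wordAt-zero j λ jW≤i → coeff-beyond v (≤-trans (ceilDiv≤⇒≤* n≤j) jW≤i)

  length-pack : ∀ {k} (v : Vec Bool k) → length (pack W v) ≡ ceilDiv k W
  length-pack {k} v = trans (length-map _ (upTo (ceilDiv k W))) (length-upTo _)

  get-pack : ∀ {k} (v : Vec Bool k) j → get zeros (pack W v) j ≡ wordAt W (coeff v) j
  get-pack {k} v j with <-≤-connex j (ceilDiv k W)
  ... | inj₁ j<n = get-map-upTo (wordAt W (coeff v)) j<n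
  ... | inj₂ n≤j = trans (get-beyond (pack W v) (subst (_≤ j) (sym (length-pack v)) n≤j)) (sym (wordAt-beyond v n≤j))

  private
    split : ∀ d → d ≡ d % W + d / W * W
    split d = m≡m%n+[m/n]*n d W

  -- With `d = q * W + b`, bit `i` of the shifted word sits at offset `i + b` of word `j + q`, or,
  -- when that reaches `W`, at offset `i ∸ (W ∸ b)` of the next word. For `b = 0` the left shift by
  -- `W` yields zero, so an aligned shift obeys the same formula.
  wordAt-advance : ∀ (p : ℕ → Bool) d j → wordAt W (λ i → p (i + d)) j ≡
    down (d % W) (wordAt W p (j + d / W)) ⊕ up (W ∸ d % W) (wordAt W p (j + d / W + 1))
  wordAt-advance p d j = sym (wordAt-ext _ (λ i → p (i + d)) j bit)
    where
    q = d / W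
    b = d % W
    u = wordAt W p (j + q)
    v = wordAt W p (j + q + 1)
    position : ∀ i → (j + q) * W + (i + b) ≡ j * W + i + d
    position i = trans
      (solve 5 (λ j q W i b → (j ⊞ q) ⊠ W ⊞ (i ⊞ b) ⊜ j ⊠ W ⊞ i ⊞ (b ⊞ q ⊠ W)) refl j q W i b)
      (cong (j * W + i +_) (sym (split d)))
    bit : ∀ {i} → i < W → coeff (down b u ⊕ up (W ∸ b) v) i ≡ p (j * W + i + d)
    bit {i} i<W with <-≤-connex (i + b) W
    ... | inj₁ i+b<W = begin
      coeff (down b u ⊕ up (W ∸ b) v) i                ≡⟨ coeff-⊕ (down b u) (up (W ∸ b) v) i ⟩
      coeff (down b u) i xor coeff (up (W ∸ b) v) i    ≡⟨ cong₂ _xor_ (coeff-down b u i)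
                                                            (trans (coeff-up (W ∸ b) v i<W) (delay-< (coeff v) (m+n≤o⇒m≤o∸n (suc i) i+b<W))) ⟩
      coeff u (i + b) xor false                        ≡⟨ xor-identityʳ _ ⟩
      coeff u (i + b)                                  ≡⟨ coeff-wordAt p (j + q) i+b<W ⟩
      p ((j + q) * W + (i + b))                        ≡⟨ cong p (position i) ⟩
      p (j * W + i + d)                                ∎
      where open ≡-Reasoning
    ... | inj₂ W≤i+b = begin
      coeff (down b u ⊕ up (W ∸ b) v) i                ≡⟨ coeff-⊕ (down b u) (up (W ∸ b) v) i ⟩
      coeff (down b u) i xor coeff (up (W ∸ b) v) i    ≡⟨ cong₂ _xor_ (trans (coeff-down b u i) (coeff-beyond u W≤i+b))
                                                            (trans (coeff-up (W ∸ b) v i<W) (delay-≥ (coeff v) W∸b≤i)) ⟩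
      coeff v x                                        ≡⟨ coeff-wordAt p (j + q + 1) (≤-<-trans (m∸n≤m i (W ∸ b)) i<W) ⟩
      p ((j + q + 1) * W + x)                          ≡⟨ cong p (trans carry (position i)) ⟩
      p (j * W + i + d)                                ∎
      where
      open ≡-Reasoning
      W∸b≤i : W ∸ b ≤ i
      W∸b≤i = m≤n+o⇒m∸n≤o W b (subst (W ≤_) (+-comm i b) W≤i+b)
      x = i ∸ (W ∸ b)
      carry : (j + q + 1) * W + x ≡ (j + q) * W + (i + b)
      carry = begin
        (j + q + 1) * W + x               ≡⟨ solve 3 (λ a W x → (a ⊞ con 1) ⊠ W ⊞ x ⊜ a ⊠ W ⊞ (x ⊞ W)) refl (j + q) W x ⟩
        (j + q) * W + (x + W)             ≡⟨ cong (λ z → (j + q) * W + (x + z)) (m∸n+n≡m (m%n≤n d W)) ⟨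
        (j + q) * W + (x + (W ∸ b + b))   ≡⟨ cong ((j + q) * W +_) (+-assoc x (W ∸ b) b) ⟨
        (j + q) * W + (x + (W ∸ b) + b)   ≡⟨ cong (λ z → (j + q) * W + (z + b)) (m∸n+n≡m W∸b≤i) ⟩
        (j + q) * W + (i + b)             ∎

  -- This lemma and the next two follow the outcomes of comparing the word index with `t / W`, as
  -- the assembly program does: below it nothing has arrived, at it a single source word
  -- contributes, above it two adjacent ones do.
  wordAt-delay-< : ∀ (p : ℕ → Bool) t {j} → j < t / W → wordAt W (delay t p) j ≡ zeros
  wordAt-delay-< p t {j} j<q = sym (wordAt-ext zeros (delay t p) j λ {i} i<W →
    trans (coeff-zeros W i) (sym (delay-< p (begin-strict
      j * W + i      <⟨ +-monoʳ-< (j * W) i<W ⟩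
      j * W + W      ≡⟨ +-comm (j * W) W ⟩
      suc j * W      ≤⟨ *-monoˡ-≤ W j<q ⟩
      t / W * W      ≤⟨ m/n*n≤m t W ⟩
      t              ∎))))
    where open ≤-Reasoning

  wordAt-delay-≡ : ∀ (p : ℕ → Bool) t → wordAt W (delay t p) (t / W) ≡ up (t % W) (wordAt W p 0)
  wordAt-delay-≡ p t = sym (wordAt-ext _ (delay t p) q bit)
    where
    q = t / W
    b = t % W
    bit : ∀ {i} → i < W → coeff (up b (wordAt W p 0)) i ≡ delay t p (q * W + i)
    bit {i} i<W with <-≤-connex i b
    ... | inj₁ i<b = trans (coeff-up b (wordAt W p 0) i<W) (trans (delay-< (coeff (wordAt W p 0)) i<b)
      (sym (delay-< p (subst (q * W + i <_) (trans (+-comm (q * W) b) (sym (split t))) (+-monoʳ-< (q * W) i<b)))))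
    ... | inj₂ b≤i = trans (coeff-up b (wordAt W p 0) i<W) (trans (delay-≥ (coeff (wordAt W p 0)) b≤i)
      (trans (coeff-wordAt p 0 (≤-<-trans (m∸n≤m i b) i<W)) (sym (delay-+ t (i ∸ b) p position))))
      where
      open ≡-Reasoning
      position : q * W + i ≡ t + (i ∸ b)
      position = begin
        q * W + i               ≡⟨ cong (q * W +_) (m+[n∸m]≡n b≤i) ⟨
        q * W + (b + (i ∸ b))   ≡⟨ solve 3 (λ a b c → a ⊞ (b ⊞ c) ⊜ b ⊞ a ⊞ c) refl (q * W) b (i ∸ b) ⟩
        b + q * W + (i ∸ b)     ≡⟨ cong (_+ (i ∸ b)) (split t) ⟨
        t + (i ∸ b)             ∎

  wordAt-delay-> : ∀ (p : ℕ → Bool) t j → wordAt W (delay t p) (t / W + suc j) ≡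
    up (t % W) (wordAt W p (suc j)) ⊕ down (W ∸ t % W) (wordAt W p j)
  wordAt-delay-> p t j = sym (wordAt-ext _ (delay t p) (q + suc j) bit)
    where
    q = t / W
    b = t % W
    u = wordAt W p (suc j)
    v = wordAt W p j
    bit : ∀ {i} → i < W → coeff (up b u ⊕ down (W ∸ b) v) i ≡ delay t p ((q + suc j) * W + i)
    bit {i} i<W with <-≤-connex i b
    ... | inj₁ i<b = begin
      coeff (up b u ⊕ down (W ∸ b) v) i              ≡⟨ coeff-⊕ (up b u) (down (W ∸ b) v) i ⟩
      coeff (up b u) i xor coeff (down (W ∸ b) v) i  ≡⟨ cong₂ _xor_ (trans (coeff-up b u i<W) (delay-< (coeff u) i<b)) (coeff-down (W ∸ b) v i) ⟩
      coeff v (i + (W ∸ b))                          ≡⟨ coeff-wordAt p j (subst (i + (W ∸ b) <_) (m+[n∸m]≡n (m%n≤n t W)) (+-monoˡ-< (W ∸ b) i<b)) ⟩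
      p (j * W + (i + (W ∸ b)))                      ≡⟨ delay-+ t (j * W + (i + (W ∸ b))) p position ⟨
      delay t p ((q + suc j) * W + i)                ∎
      where
      open ≡-Reasoning
      position : (q + suc j) * W + i ≡ t + (j * W + (i + (W ∸ b)))
      position = begin
        (q + suc j) * W + i
          ≡⟨ solve 4 (λ q j W i → (q ⊞ (con 1 ⊞ j)) ⊠ W ⊞ i ⊜ q ⊠ W ⊞ j ⊠ W ⊞ i ⊞ W) refl q j W i ⟩
        q * W + j * W + i + W
          ≡⟨ cong (q * W + j * W + i +_) (m+[n∸m]≡n (m%n≤n t W)) ⟨
        q * W + j * W + i + (b + (W ∸ b))
          ≡⟨ solve 5 (λ a c i b d → a ⊞ c ⊞ i ⊞ (b ⊞ d) ⊜ b ⊞ a ⊞ (c ⊞ (i ⊞ d))) refl (q * W) (j * W) i b (W ∸ b) ⟩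
        b + q * W + (j * W + (i + (W ∸ b)))
          ≡⟨ cong (_+ (j * W + (i + (W ∸ b)))) (split t) ⟨
        t + (j * W + (i + (W ∸ b)))   ∎
    ... | inj₂ b≤i = begin
      coeff (up b u ⊕ down (W ∸ b) v) i              ≡⟨ coeff-⊕ (up b u) (down (W ∸ b) v) i ⟩
      coeff (up b u) i xor coeff (down (W ∸ b) v) i  ≡⟨ cong₂ _xor_ (trans (coeff-up b u i<W) (delay-≥ (coeff u) b≤i))
                                                          (trans (coeff-down (W ∸ b) v i) (coeff-beyond v
                                                            (subst (_≤ i + (W ∸ b)) (m+[n∸m]≡n (m%n≤n t W)) (+-monoˡ-≤ (W ∸ b) b≤i)))) ⟩
      coeff u (i ∸ b) xor false                      ≡⟨ xor-identityʳ _ ⟩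
      coeff u (i ∸ b)                                ≡⟨ coeff-wordAt p (suc j) (≤-<-trans (m∸n≤m i b) i<W) ⟩
      p (suc j * W + (i ∸ b))                        ≡⟨ delay-+ t (suc j * W + (i ∸ b)) p position ⟨
      delay t p ((q + suc j) * W + i)                ∎
      where
      open ≡-Reasoning
      position : (q + suc j) * W + i ≡ t + (suc j * W + (i ∸ b))
      position = begin
        (q + suc j) * W + i                     ≡⟨ cong ((q + suc j) * W +_) (m+[n∸m]≡n b≤i) ⟨
        (q + suc j) * W + (b + (i ∸ b))
          ≡⟨ solve 5 (λ q j W b c → (q ⊞ j) ⊠ W ⊞ (b ⊞ c) ⊜ b ⊞ q ⊠ W ⊞ (j ⊠ W ⊞ c)) refl q (suc j) W b (i ∸ b) ⟩
        b + q * W + (suc j * W + (i ∸ b))       ≡⟨ cong (_+ (suc j * W + (i ∸ b))) (split t) ⟨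
        t + (suc j * W + (i ∸ b))               ∎

  -- `suc j * W ∸ m` is how far the end of word `j` lies beyond `m`, and zero if it does not. A left
  -- shift by that amount pushes out exactly the positions from `m` on, and the right shift restores
  -- the others.
  wordAt-truncate : ∀ {m} {p q : ℕ → Bool} → (∀ {i} → i < m → p i ≡ q i) → (∀ {i} → m ≤ i → p i ≡ false) →
    ∀ j → wordAt W p j ≡ down (suc j * W ∸ m) (up (suc j * W ∸ m) (wordAt W q j))
  wordAt-truncate {m} {p} {q} below beyond j = sym (wordAt-ext _ p j bit)
    where
    l = suc j * W ∸ m
    v = wordAt W q j
    shift : ∀ i → i + suc j * W ≡ W + (j * W + i)
    shift i = trans (+-comm i _) (+-assoc W (j * W) i)
    bit : ∀ {i} → i < W → coeff (down l (up l v)) i ≡ p (j * W + i)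
    bit {i} i<W with <-≤-connex (j * W + i) m
    ... | inj₁ x<m = begin
      coeff (down l (up l v)) i     ≡⟨ coeff-down l (up l v) i ⟩
      coeff (up l v) (i + l)        ≡⟨ coeff-up l v i+l<W ⟩
      delay l (coeff v) (i + l)     ≡⟨ delay-+ l i (coeff v) (+-comm i l) ⟩
      coeff v i                     ≡⟨ coeff-wordAt q j i<W ⟩
      q (j * W + i)                 ≡⟨ below x<m ⟨
      p (j * W + i)                 ∎
      where
      open ≡-Reasoning
      i+l<W : i + l < W
      i+l<W with ≤-total (suc j * W) m
      ... | inj₁ ≤m = subst (λ z → i + z < W) (sym (m≤n⇒m∸n≡0 ≤m)) (subst (_< W) (sym (+-identityʳ i)) i<W)
      ... | inj₂ m≤ = +-cancelʳ-< m (i + l) W (subst (_< W + m)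
        (sym (trans (+-assoc i l m) (trans (cong (i +_) (m∸n+n≡m m≤)) (shift i))))
        (+-monoʳ-< W x<m))
    ... | inj₂ m≤x = trans (coeff-down l (up l v) i) (trans (coeff-beyond (up l v) W≤i+l) (sym (beyond m≤x)))
      where
      W≤i+l : W ≤ i + l
      W≤i+l = +-cancelʳ-≤ m W (i + l) (begin
        W + m               ≤⟨ +-monoʳ-≤ W m≤x ⟩
        W + (j * W + i)     ≡⟨ shift i ⟨
        i + suc j * W       ≤⟨ +-monoʳ-≤ i (m≤n+m∸n (suc j * W) m) ⟩
        i + (m + l)         ≡⟨ cong (i +_) (+-comm m l) ⟩
        i + (l + m)         ≡⟨ +-assoc i l m ⟨
        i + l + m           ∎)
        where open ≤-Reasoning

-- Program logic

module _ {W : ℕ} (κ : ℕ) where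

  -- A record rather than a product, which would unfold and defeat the inference of σ and e.
  record Evaluates (σ : Store W) (e : Exp) (v : ℕ) : Set where
    constructor evaluates
    field
      safe  : Safe κ σ e
      value : eval σ e ≡ v

  record Evaluatesʷ (σ : Store W) (p : WExp) (u : Word W) : Set where
    constructor evaluatesʷ
    field
      safeʷ  : Safeʷ κ σ p
      valueʷ : evalʷ σ p ≡ u

module _ {W κ : ℕ} {σ : Store W} where

  litᵉ : ∀ {n} → Evaluates κ σ (lit n) n
  litᵉ = evaluates tt refl

  regᵉ : ∀ {x v} → regs σ x ≡ v → Evaluates κ σ ($ x) v
  regᵉ = evaluates tt

  atᵉ : ∀ {a e i v} → Evaluates κ σ e i → i < length (recs σ a) → get 0 (recs σ a) i ≡ v →
    Evaluates κ σ (a at e) v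
  atᵉ (evaluates s refl) i< eq = evaluates (s , i<) eq

  plusᵉ : ∀ {e f a b} → Evaluates κ σ e a → Evaluates κ σ f b → a + b ≤ κ → Evaluates κ σ (e :+ f) (a + b)
  plusᵉ (evaluates s refl) (evaluates t refl) ≤κ = evaluates (s , t , ≤κ) refl

  minusᵉ : ∀ {e f a b} → Evaluates κ σ e a → Evaluates κ σ f b → Evaluates κ σ (e :- f) (a ∸ b)
  minusᵉ (evaluates s refl) (evaluates t refl) = evaluates (s , t) refl

  timesᵉ : ∀ {e f a b} → Evaluates κ σ e a → Evaluates κ σ f b → a * b ≤ κ → Evaluates κ σ (e :* f) (a * b)
  timesᵉ (evaluates s refl) (evaluates t refl) ≤κ = evaluates (s , t , ≤κ) refl

  divᵉ : ∀ {e f a b} → Evaluates κ σ e a → Evaluates κ σ f b → 0 < b → Evaluates κ σ (e :/ f) (quot a b)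
  divᵉ (evaluates s refl) (evaluates t refl) b>0 = evaluates (s , t , b>0) refl

  modᵉ : ∀ {e f a b} → Evaluates κ σ e a → Evaluates κ σ f b → 0 < b → Evaluates κ σ (e :% f) (rem a b)
  modᵉ (evaluates s refl) (evaluates t refl) b>0 = evaluates (s , t , b>0) refl

  regᵂ : ∀ {x u} → wregs σ x ≡ u → Evaluatesʷ κ σ ($ʷ x) u
  regᵂ = evaluatesʷ tt

  atᵂ : ∀ {a e i u} → Evaluates κ σ e i → i < length (words σ a) → get zeros (words σ a) i ≡ u →
    Evaluatesʷ κ σ (a atʷ e) u
  atᵂ (evaluates s refl) i< eq = evaluatesʷ (s , i<) eq

  xorᵂ : ∀ {p q u v} → Evaluatesʷ κ σ p u → Evaluatesʷ κ σ q v → Evaluatesʷ κ σ (xorʷ p q) (u ⊕ v)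
  xorᵂ (evaluatesʷ s refl) (evaluatesʷ t refl) = evaluatesʷ (s , t) refl

  shlᵂ : ∀ {p e u d} → Evaluatesʷ κ σ p u → Evaluates κ σ e d → Evaluatesʷ κ σ (shl p e) (up d u)
  shlᵂ (evaluatesʷ s refl) (evaluates t refl) = evaluatesʷ (s , t) refl

  shrᵂ : ∀ {p e u d} → Evaluatesʷ κ σ p u → Evaluates κ σ e d → Evaluatesʷ κ σ (shr p e) (down d u)
  shrᵂ (evaluatesʷ s refl) (evaluates t refl) = evaluatesʷ (s , t) refl

  runAssign : ∀ {x e v} → Evaluates κ σ e v → Run κ (x ≔ e) σ (setReg σ x v) (cost (1 + size e))
  runAssign (evaluates s refl) = assign s

  runAssignʷ : ∀ {x p u} → Evaluatesʷ κ σ p u → Run κ (x ≔ʷ p) σ (setWReg σ x u) (cost (1 + sizeʷ p))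
  runAssignʷ (evaluatesʷ s refl) = assignʷ s

  runWrite : ∀ {a i e j v} → Evaluates κ σ i j → Evaluates κ σ e v → j < length (recs σ a) →
    Run κ (a [ i ]≔ e) σ (setRecs σ a (put (recs σ a) j v)) (cost (1 + (size i + size e)))
  runWrite (evaluates s refl) (evaluates t refl) j< = write s t j<

  runWriteʷ : ∀ {a i p j u} → Evaluates κ σ i j → Evaluatesʷ κ σ p u → j < length (words σ a) →
    Run κ (a [ i ]≔ʷ p) σ (setWords σ a (put (words σ a) j u)) (cost (1 + (size i + sizeʷ p)))
  runWriteʷ (evaluates s refl) (evaluatesʷ t refl) j< = writeʷ s t j<

  runAllocRecs : ∀ {a e n} → Evaluates κ σ e n →
    Run κ (allocRecs a e) σ (setRecs σ a (replicate n 0)) (usage (1 + size e + n) 0 n 0)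
  runAllocRecs (evaluates s refl) = allocRecs s

  runAllocWords : ∀ {a e n} → Evaluates κ σ e n →
    Run κ (allocWords a e) σ (setWords σ a (replicate n zeros)) (usage (1 + size e + n) 0 0 n)
  runAllocWords (evaluates s refl) = allocWords s

  runThen : ∀ {e f a b c d σ′ u} → Evaluates κ σ e a → Evaluates κ σ f b → a < b → Run κ c σ σ′ u →
    Run κ (ifLt e f c d) σ σ′ (cost (1 + (size e + size f)) ⊹ u)
  runThen (evaluates s refl) (evaluates t refl) a<b = if-yes s t a<b

  runElse : ∀ {e f a b c d σ′ u} → Evaluates κ σ e a → Evaluates κ σ f b → b ≤ a → Run κ d σ σ′ u →
    Run κ (ifLt e f c d) σ σ′ (cost (1 + (size e + size f)) ⊹ u)
  runElse (evaluates s refl) (evaluates t refl) b≤a = if-no s t b≤a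

  runStop : ∀ {e f a b c} → Evaluates κ σ e a → Evaluates κ σ f b → b ≤ a →
    Run κ (whileLt e f c) σ σ (cost (1 + (size e + size f)))
  runStop (evaluates s refl) (evaluates t refl) b≤a = while-no s t b≤a

runAgain : ∀ {W κ} {σ σ₁ σ₂ : Store W} {e f a b c u v} → Evaluates κ σ e a → Evaluates κ σ f b → a < b →
  Run κ c σ σ₁ u → Run κ (whileLt e f c) σ₁ σ₂ v →
  Run κ (whileLt e f c) σ σ₂ (cost (1 + (size e + size f)) ⊹ u ⊹ v)
runAgain (evaluates s refl) (evaluates t refl) a<b = while-yes s t a<b

-- Frame conditions

data Resource : Set where
  register     : Reg → Resource
  recordArray  : RecArray → Resource
  wordArray    : WordArray → Resource
  allocation   : Resource
  generation   : Resource

-- Purely syntactic, so that on a concrete command it evaluates and its proofs are `refl`. Writing a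
-- cell does not touch `allocation`, since it preserves the length of the array; `generation` stands
-- for operations charged inside `generate`.
touches : Resource → Cmd → Bool
touches t               skip             = false
touches (register y)    (x ≔ e)          = does (x Fin.≟ y)
touches t               (x ≔ e)          = false
touches t               (x ≔ʷ p)         = false
touches (recordArray b) (a [ i ]≔ e)     = sameRec a b
touches t               (a [ i ]≔ e)     = false
touches (wordArray b)   (a [ i ]≔ʷ p)    = sameWord a b
touches t               (a [ i ]≔ʷ p)    = false
touches (recordArray b) (allocRecs a e)  = sameRec a b
touches allocation      (allocRecs a e)  = true
touches t               (allocRecs a e)  = false
touches (wordArray b)   (allocWords a e) = sameWord a b
touches allocation      (allocWords a e) = true
touches t               (allocWords a e) = false
touches t               (c ⨾ d)          = touches t c ∨ touches t d
touches t               (ifLt e f c d)   = touches t c ∨ touches t d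
touches t               (whileLt e f c)  = touches t c
touches generation      (generate c)     = true
touches t               (generate c)     = touches t c

module _ {W : ℕ} where

  Unchanged : Resource → Store W → Store W → Set
  Unchanged (register x)    σ σ′ = regs σ′ x ≡ regs σ x
  Unchanged (recordArray a) σ σ′ = recs σ′ a ≡ recs σ a
  Unchanged (wordArray a)   σ σ′ = words σ′ a ≡ words σ a
  Unchanged allocation      σ σ′ = (∀ a → length (recs σ′ a) ≡ length (recs σ a))
                                 × (∀ a → length (words σ′ a) ≡ length (words σ a))
  Unchanged generation      σ σ′ = ⊤

  unchanged-refl : ∀ t {σ} → Unchanged t σ σ
  unchanged-refl (register x)    = refl
  unchanged-refl (recordArray a) = refl
  unchanged-refl (wordArray a)   = refl
  unchanged-refl allocation      = (λ _ → refl) , (λ _ → refl)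
  unchanged-refl generation      = tt

  unchanged-trans : ∀ t {σ σ₁ σ₂} → Unchanged t σ σ₁ → Unchanged t σ₁ σ₂ → Unchanged t σ σ₂
  unchanged-trans (register x)    p q = trans q p
  unchanged-trans (recordArray a) p q = trans q p
  unchanged-trans (wordArray a)   p q = trans q p
  unchanged-trans allocation      (p , p′) (q , q′) = (λ a → trans (q a) (p a)) , (λ a → trans (q′ a) (p′ a))
  unchanged-trans generation      _ _ = tt

  -- Kept apart from `Run`, because a loop halted between two iterations is not a run of that loop:
  -- `halts-for` hands its body the frame accumulated since the loop began.
  record Frame (c : Cmd) (σ σ′ : Store W) : Set where
    constructor framed
    field
      preserves : ∀ t → touches t c ≡ false → Unchanged t σ σ′

  open Frame public

Unused : Resource → Usage → Set
Unused allocation u = allocdWords u ≡ 0 × allocdRecs u ≡ 0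
Unused generation u = genOps u ≡ 0
Unused _          u = ⊤

unused-cost : ∀ t {k} → Unused t (cost k)
unused-cost (register x)    = tt
unused-cost (recordArray a) = tt
unused-cost (wordArray a)   = tt
unused-cost allocation      = refl , refl
unused-cost generation      = refl

unused-⊹ : ∀ t {u v} → Unused t u → Unused t v → Unused t (u ⊹ v)
unused-⊹ (register x)    _ _ = tt
unused-⊹ (recordArray a) _ _ = tt
unused-⊹ (wordArray a)   _ _ = tt
unused-⊹ allocation      (p , p′) (q , q′) = cong₂ _+_ p q , cong₂ _+_ p′ q′
unused-⊹ generation      p q = cong₂ _+_ p q

∨-falseˡ : ∀ {a b} → a ∨ b ≡ false → a ≡ false
∨-falseˡ {a} {b} = ∨-conicalˡ a b

∨-falseʳ : ∀ {a b} → a ∨ b ≡ false → b ≡ false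
∨-falseʳ {a} {b} = ∨-conicalʳ a b

module _ {W : ℕ} where

  length-setRecs : ∀ (σ : Store W) a xs → length xs ≡ length (recs σ a) →
    ∀ b → length (recs (setRecs σ a xs) b) ≡ length (recs σ b)
  length-setRecs σ support     xs eq support     = eq
  length-setRecs σ support     xs eq stages      = refl
  length-setRecs σ support     xs eq feedback    = refl
  length-setRecs σ support     xs eq assembly    = refl
  length-setRecs σ support     xs eq descriptors = refl
  length-setRecs σ stages      xs eq support     = refl
  length-setRecs σ stages      xs eq stages      = eq
  length-setRecs σ stages      xs eq feedback    = refl
  length-setRecs σ stages      xs eq assembly    = refl
  length-setRecs σ stages      xs eq descriptors = refl
  length-setRecs σ feedback    xs eq support     = refl
  length-setRecs σ feedback    xs eq stages      = refl
  length-setRecs σ feedback    xs eq feedback    = eq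
  length-setRecs σ feedback    xs eq assembly    = refl
  length-setRecs σ feedback    xs eq descriptors = refl
  length-setRecs σ assembly    xs eq support     = refl
  length-setRecs σ assembly    xs eq stages      = refl
  length-setRecs σ assembly    xs eq feedback    = refl
  length-setRecs σ assembly    xs eq assembly    = eq
  length-setRecs σ assembly    xs eq descriptors = refl
  length-setRecs σ descriptors xs eq support     = refl
  length-setRecs σ descriptors xs eq stages      = refl
  length-setRecs σ descriptors xs eq feedback    = refl
  length-setRecs σ descriptors xs eq assembly    = refl
  length-setRecs σ descriptors xs eq descriptors = eq

  length-setWords : ∀ (σ : Store W) a xs → length xs ≡ length (words σ a) →
    ∀ b → length (words (setWords σ a xs) b) ≡ length (words σ b)
  length-setWords σ input   xs eq input   = eq
  length-setWords σ input   xs eq output  = refl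
  length-setWords σ input   xs eq scratch = refl
  length-setWords σ output  xs eq input   = refl
  length-setWords σ output  xs eq output  = eq
  length-setWords σ output  xs eq scratch = refl
  length-setWords σ scratch xs eq input   = refl
  length-setWords σ scratch xs eq output  = refl
  length-setWords σ scratch xs eq scratch = eq

  unchanged-assign : ∀ t {σ : Store W} {x e v} → touches t (x ≔ e) ≡ false → Unchanged t σ (setReg σ x v)
  unchanged-assign (register y)    h rewrite h = refl
  unchanged-assign (recordArray a) _ = refl
  unchanged-assign (wordArray a)   _ = refl
  unchanged-assign allocation      _ = (λ _ → refl) , (λ _ → refl)
  unchanged-assign generation      _ = tt

  unchanged-assignʷ : ∀ t {σ : Store W} {x u} → Unchanged t σ (setWReg σ x u)
  unchanged-assignʷ (register y)    = refl
  unchanged-assignʷ (recordArray a) = refl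
  unchanged-assignʷ (wordArray a)   = refl
  unchanged-assignʷ allocation      = (λ _ → refl) , (λ _ → refl)
  unchanged-assignʷ generation      = tt

  unchanged-write : ∀ t {σ : Store W} {a i e j v} → touches t (a [ i ]≔ e) ≡ false →
    Unchanged t σ (setRecs σ a (put (recs σ a) j v))
  unchanged-write (register y)    _ = refl
  unchanged-write (recordArray b) h rewrite h = refl
  unchanged-write (wordArray b)   _ = refl
  unchanged-write allocation {σ} {a} {j = j} {v} _ = length-setRecs σ a _ (length-put (recs σ a) j v) , (λ _ → refl)
  unchanged-write generation      _ = tt

  unchanged-writeʷ : ∀ t {σ : Store W} {a i p j u} → touches t (a [ i ]≔ʷ p) ≡ false →
    Unchanged t σ (setWords σ a (put (words σ a) j u))
  unchanged-writeʷ (register y)    _ = refl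
  unchanged-writeʷ (recordArray b) _ = refl
  unchanged-writeʷ (wordArray b)   h rewrite h = refl
  unchanged-writeʷ allocation {σ} {a} {j = j} {u} _ = (λ _ → refl) , length-setWords σ a _ (length-put (words σ a) j u)
  unchanged-writeʷ generation      _ = tt

  unchanged-allocRecs : ∀ t {σ : Store W} {a e xs} → touches t (allocRecs a e) ≡ false →
    Unchanged t σ (setRecs σ a xs)
  unchanged-allocRecs (register y)    _ = refl
  unchanged-allocRecs (recordArray b) h rewrite h = refl
  unchanged-allocRecs (wordArray b)   _ = refl
  unchanged-allocRecs generation      _ = tt

  unchanged-allocWords : ∀ t {σ : Store W} {a e xs} → touches t (allocWords a e) ≡ false →
    Unchanged t σ (setWords σ a xs)
  unchanged-allocWords (register y)    _ = refl
  unchanged-allocWords (recordArray b) _ = refl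
  unchanged-allocWords (wordArray b)   h rewrite h = refl
  unchanged-allocWords generation      _ = tt

  touches-generate : ∀ t {c} → touches t (generate c) ≡ false → touches t c ≡ false
  touches-generate (register y)    h = h
  touches-generate (recordArray b) h = h
  touches-generate (wordArray b)   h = h
  touches-generate allocation      h = h

  unchanged : ∀ {κ c} {σ σ′ : Store W} {u} → Run κ c σ σ′ u → ∀ t → touches t c ≡ false → Unchanged t σ σ′
  unchanged skip                t _ = unchanged-refl t
  unchanged (assign {e = e} _)  t h = unchanged-assign t {e = e} h
  unchanged (assignʷ {x = x} {p = p} _) t _ = unchanged-assignʷ t {x = x}
  unchanged (write {i = i} {e = e} _ _ _)  t h = unchanged-write t {i = i} {e = e} h
  unchanged (writeʷ {i = i} {p = p} _ _ _) t h = unchanged-writeʷ t {i = i} {p = p} h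
  unchanged (allocRecs {e = e} _)  t h = unchanged-allocRecs t {e = e} h
  unchanged (allocWords {e = e} _) t h = unchanged-allocWords t {e = e} h
  unchanged (seq r s)           t h = unchanged-trans t (unchanged r t (∨-falseˡ h)) (unchanged s t (∨-falseʳ h))
  unchanged (if-yes _ _ _ r)    t h = unchanged r t (∨-falseˡ h)
  unchanged (if-no _ _ _ r)     t h = unchanged r t (∨-falseʳ h)
  unchanged (while-yes _ _ _ r s) t h = unchanged-trans t (unchanged r t h) (unchanged s t h)
  unchanged (while-no _ _ _)    t _ = unchanged-refl t
  unchanged (generate {c = c} r)        t h = unchanged r t (touches-generate t {c} h)

  frameOf : ∀ {κ c} {σ σ′ : Store W} {u} → Run κ c σ σ′ u → Frame c σ σ′
  frameOf run = framed (unchanged run)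

  unused : ∀ {κ c} {σ σ′ : Store W} {u} → Run κ c σ σ′ u → ∀ t → touches t c ≡ false → Unused t u
  unused skip                t _ = unused-cost t
  unused (assign _)          t _ = unused-cost t
  unused (assignʷ _)         t _ = unused-cost t
  unused (write _ _ _)       t _ = unused-cost t
  unused (writeʷ _ _ _)      t _ = unused-cost t
  unused (allocRecs _)       (register x)    _ = tt
  unused (allocRecs _)       (recordArray a) _ = tt
  unused (allocRecs _)       (wordArray a)   _ = tt
  unused (allocRecs _)       generation      _ = refl
  unused (allocWords _)      (register x)    _ = tt
  unused (allocWords _)      (recordArray a) _ = tt
  unused (allocWords _)      (wordArray a)   _ = tt
  unused (allocWords _)      generation      _ = refl
  unused (seq r s)           t h = unused-⊹ t (unused r t (∨-falseˡ h)) (unused s t (∨-falseʳ h))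
  unused (if-yes _ _ _ r)    t h = unused-⊹ t (unused-cost t) (unused r t (∨-falseˡ h))
  unused (if-no _ _ _ r)     t h = unused-⊹ t (unused-cost t) (unused r t (∨-falseʳ h))
  unused (while-yes _ _ _ r s) t h = unused-⊹ t (unused-⊹ t (unused-cost t) (unused r t h)) (unused s t h)
  unused (while-no _ _ _)    t _ = unused-cost t
  unused (generate r)        (register x)    _ = tt
  unused (generate r)        (recordArray a) _ = tt
  unused (generate r)        (wordArray a)   _ = tt
  unused (generate r)        allocation      h = unused r allocation h

-- Cost measures and rules for loops

record Measure : Set where
  field
    measure   : Usage → ℕ
    measure-⊹ : ∀ u v → measure (u ⊹ v) ≤ measure u + measure v
    measure-≤ : ∀ u → measure u ≤ ops u + genOps u

  measure-cost : ∀ k → measure (cost k) ≤ k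
  measure-cost k = ≤-trans (measure-≤ (cost k)) (≤-reflexive (+-identityʳ k))

open Measure public

-- Under `nothing` the loop rules speak of correctness alone.
nothing generated total : Measure
nothing = record { measure = λ _ → 0 ; measure-⊹ = λ _ _ → z≤n ; measure-≤ = λ _ → z≤n }
generated = record { measure = genOps ; measure-⊹ = λ _ _ → ≤-refl ; measure-≤ = λ u → m≤n+m (genOps u) (ops u) }
total = record
  { measure   = λ u → ops u + genOps u
  ; measure-⊹ = λ u v → ≤-reflexive (+-interchange (ops u) (ops v) (genOps u) (genOps v))
  ; measure-≤ = λ _ → ≤-refl
  }

Halts : ∀ {W} → ℕ → Cmd → Store W → (Store W → Usage → Set) → Set
Halts κ c σ Q = ∃₂ λ σ′ u → Run κ c σ σ′ u × Q σ′ u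

-- Elimination in continuation form: the intermediate store and usage become variables instead of
-- projections of an existential.
after : ∀ {W κ c} {σ : Store W} {P} {R : Set} → Halts κ c σ P →
  (∀ {σ′ u} → Run κ c σ σ′ u → P σ′ u → R) → R
after (_ , _ , run , post) k = k run post

sum-upTo-suc : ∀ (f : ℕ → ℕ) N → sum (map f (upTo (suc N))) ≡ f 0 + sum (map (f ∘ suc) (upTo N))
sum-upTo-suc f N = cong (λ xs → f 0 + sum xs) (trans (cong (map f) (sym (map-upTo suc N))) (sym (map-∘ (upTo N))))

sum-const : ∀ c N → sum (map (λ _ → c) (upTo N)) ≡ N * c
sum-const c zero    = refl
sum-const c (suc N) = trans (sum-upTo-suc (λ _ → c) N) (cong (c +_) (sum-const c N))

module _ {W κ : ℕ} (M : Measure) where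

  private
    μ = measure M

  -- The exit premise is itself a run of the loop, not merely a failing guard: the descriptor scan
  -- may need one more iteration there, the one that meets an inactive exponent. The weights `w i`
  -- depend on the iteration, so that the costs of stages of different sizes can be summed.
  halts-while : ∀ {e f c} {Q : Store W → Set} {d} N (I : ℕ → Store W → Set) (w : ℕ → ℕ) →
    (∀ {i σ} → i < N → I i σ → ∃₂ λ a b → Evaluates κ σ e a × Evaluates κ σ f b × a < b
       × Halts κ c σ (λ σ′ u → I (suc i) σ′ × 1 + (size e + size f) + μ u ≤ w i)) →
    (∀ {σ} → I N σ → Halts κ (whileLt e f c) σ (λ σ′ u → Q σ′ × μ u ≤ d)) →
    ∀ {σ} → I 0 σ → Halts κ (whileLt e f c) σ (λ σ′ u → Q σ′ × μ u ≤ sum (map w (upTo N)) + d)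
  halts-while zero    I w step exit I₀ = exit I₀
  halts-while {e} {f} {c} {Q} {d} (suc N) I w step exit I₀ with step z<s I₀
  ... | _ , _ , evaluates s refl , evaluates t refl , a<b , σ₁ , u , r , I₁ , u≤
    with halts-while {Q = Q} N (I ∘ suc) (w ∘ suc) (step ∘ s<s) exit I₁
  ...   | σ₂ , v , rs , q , v≤ = σ₂ , _ , while-yes s t a<b r rs , q , (begin
    μ (cost g ⊹ u ⊹ v)                       ≤⟨ measure-⊹ M (cost g ⊹ u) v ⟩
    μ (cost g ⊹ u) + μ v                     ≤⟨ +-mono-≤ (measure-⊹ M (cost g) u) v≤ ⟩
    μ (cost g) + μ u + (rest + d)            ≤⟨ +-monoˡ-≤ (rest + d) (≤-trans (+-monoˡ-≤ (μ u) (measure-cost M g)) u≤) ⟩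
    w 0 + (rest + d)                         ≡⟨ +-assoc (w 0) rest d ⟨
    w 0 + rest + d                           ≡⟨ cong (_+ d) (sum-upTo-suc w N) ⟨
    sum (map w (upTo (suc N))) + d           ∎)
    where
    open ≤-Reasoning
    g = 1 + (size e + size f)
    rest = sum (map (w ∘ suc) (upTo N))

  -- Each iteration adds 3 for the guard and 4 for the increment to the cost of the body; the
  -- initial assignment costs 2 and the last guard 3.
  halts-for : ∀ {x y c} N → N ≤ κ → (I : ℕ → Store W → Set) (w : ℕ) {σ₀ : Store W} →
    touches (register x) c ≡ false → touches (register y) (for x ($ y) c) ≡ false →
    regs σ₀ y ≡ N →
    (∀ {i σ} → i < N → regs σ x ≡ i → Frame (for x ($ y) c) σ₀ σ → I i σ →
       Halts κ c σ (λ σ′ u → I (suc i) (setReg σ′ x (suc i)) × μ u ≤ w)) →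
    I 0 (setReg σ₀ x 0) →
    Halts κ (for x ($ y) c) σ₀ (λ σ′ u → I N σ′ × μ u ≤ 5 + N * (w + 7))
  halts-for {x} {y} {c} N N≤κ I w {σ₀} x∉ y∉ y≡N step I₀ =
    let σ′ , u , r , IN , u≤ = loop
    in σ′ , _ , seq (assign tt) r , IN , (begin
      μ (cost 2 ⊹ u)            ≤⟨ measure-⊹ M (cost 2) u ⟩
      μ (cost 2) + μ u          ≤⟨ +-mono-≤ (measure-cost M 2) u≤ ⟩
      2 + (sum (map (λ _ → w + 7) (upTo N)) + 3) ≡⟨ cong (2 +_) (+-comm _ 3) ⟩
      5 + sum (map (λ _ → w + 7) (upTo N)) ≡⟨ cong (5 +_) (sum-const (w + 7) N) ⟩
      5 + N * (w + 7)           ∎)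
    where
    open ≤-Reasoning
    body = c ⨾ x ≔ $ x :+ lit 1
    Inv : ℕ → Store W → Set
    Inv i σ = regs σ x ≡ i × Frame (for x ($ y) c) σ₀ σ × I i σ
    reg-set : ∀ (σ : Store W) v → regs (setReg σ x v) x ≡ v
    reg-set σ v with x Fin.≟ x
    ... | yes _  = refl
    ... | no x≢x = contradiction refl x≢x
    initial : Frame (for x ($ y) c) σ₀ (setReg σ₀ x 0)
    initial = framed λ t h → unchanged-assign t {e = lit 0} (∨-falseˡ {touches t (x ≔ lit 0)} h)
    loop : Halts κ (whileLt ($ x) ($ y) body) (setReg σ₀ x 0)
             (λ σ′ u → I N σ′ × μ u ≤ sum (map (λ _ → w + 7) (upTo N)) + 3)
    loop = halts-while {Q = I N} N Inv (λ _ → w + 7)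
      (λ {i} {σ} i<N (x≡i , fr , Ii) → i , N , regᵉ x≡i , regᵉ (trans (preserves fr (register y) y∉) y≡N) , i<N ,
        (let σ′ , u , r , Is , u≤ = step i<N x≡i fr Ii
             x′≡i = trans (unchanged r (register x) x∉) x≡i
             r′ = seq r (runAssign (plusᵉ (regᵉ x′≡i) litᵉ (subst (_≤ κ) (sym (+-comm i 1)) (≤-trans i<N N≤κ))))
         in setReg σ′ x (i + 1) , _ , r′ ,
            ( trans (reg-set σ′ (i + 1)) (+-comm i 1)
            , framed (λ t h → unchanged-trans t (preserves fr t h) (unchanged r′ t (∨-falseʳ {touches t (x ≔ lit 0)} h)))
            , subst (λ k → I (suc i) (setReg σ′ x k)) (+-comm 1 i) Is) ,
            (begin
              3 + μ (u ⊹ cost 4)        ≤⟨ +-monoʳ-≤ 3 (≤-trans (measure-⊹ M u (cost 4)) (+-mono-≤ u≤ (measure-cost M 4))) ⟩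
              3 + (w + 4)               ≡⟨ +-comm 3 (w + 4) ⟩
              w + 4 + 3                 ≡⟨ +-assoc w 4 3 ⟩
              w + 7                     ∎)))
      (λ (x≡N , fr , IN) → _ , _ , runStop (regᵉ x≡N) (regᵉ (trans (preserves fr (register y) y∉) y≡N)) ≤-refl ,
         IN , measure-cost M 3)
      (reg-set σ₀ 0 , initial , I₀)

module _ {A : Set} (z : A) where

  Filled : ℕ → (ℕ → A) → List A → Set
  Filled j new xs = ∀ {i} → i < j → get z xs i ≡ new i

  filled-put : ∀ {j new xs} → j < length xs → Filled j new xs → Filled (suc j) new (put xs j (new j))
  filled-put {j} {new} {xs} j< below {i} i<sj =
    [ (λ i<j → trans (get-put-≢ xs (>⇒≢ i<j)) (below i<j))
    , (λ { refl → get-put-≡ xs j< }) ]′ (m≤n⇒m<n∨m≡n (s≤s⁻¹ i<sj))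

  resize : ∀ {j k new xs} → j ≡ k → Filled j new xs → Filled k new xs
  resize refl filled = filled

  -- An array being overwritten in place up to `j`: the old content that survives is exactly what
  -- the remaining iterations of a stage read.
  Partial : ℕ → (ℕ → A) → (ℕ → A) → List A → Set
  Partial j new old xs = Filled j new xs × (∀ {i} → j ≤ i → get z xs i ≡ old i)

  partial-start : ∀ {new old xs} → (∀ i → get z xs i ≡ old i) → Partial 0 new old xs
  partial-start eq = (λ ()) , λ {i} _ → eq i

  partial-put : ∀ {j new old xs} → j < length xs → Partial j new old xs → Partial (suc j) new old (put xs j (new j))
  partial-put {j} {new} {xs = xs} j< (below , above) =
    filled-put {new = new} {xs} j< below ,
    λ j<i → trans (get-put-≢ xs (<⇒≢ j<i)) (above (<⇒≤ j<i))

-- Only a lower bound on the length of `xs`, because the descriptor array always has `s` cells, and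
-- those beyond the current stage hold whatever earlier stages left there.
Segment : List ℕ → ℕ → List ℕ → Set
Segment xs b ds = b + length ds ≤ length xs × (∀ {i} → i < length ds → get 0 xs (b + i) ≡ get 0 ds i)

extent : Variant → ℕ → ℕ
extent guarded  n = n
extent sentinel n = n + 1

≤-extent : ∀ v {n} → n ≤ extent v n
≤-extent guarded  = ≤-refl
≤-extent sentinel = m≤m+n _ 1

-- A stage in place

module Reduction {m : ℕ} (1≤m : 1 ≤ m) (w : ℕ) where

  W n κ : ℕ
  W = suc w
  n = ceilDiv m W
  κ = capacity m W

  private
    B = m + W

  within : ∀ {x} → x ≤ 4 * B → x ≤ κ
  within x≤ = ≤-trans x≤ (*-monoʳ-≤ 4 (m≤m*n B B ⦃ m+n≢0 ⦄))
    where
    m+n≢0 : NonZero B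
    m+n≢0 = >-nonZero (≤-trans (s≤s z≤n) (m≤n+m W m))

  m≤B : m ≤ B
  m≤B = m≤m+n m W

  1≤B : 1 ≤ B
  1≤B = ≤-trans 1≤m m≤B

  n≤m : n ≤ m
  n≤m = ceilDiv-≤

  within₁ : ∀ {a} → a ≤ B → a ≤ κ
  within₁ a≤ = within (≤-trans a≤ (m≤n*m B 4))

  within₃ : ∀ {a b c} → a ≤ B → b ≤ B → c ≤ B → a + b + c ≤ κ
  within₃ {a} {b} {c} a≤ b≤ c≤ = within (begin
    a + b + c             ≤⟨ +-mono-≤ (+-mono-≤ a≤ b≤) c≤ ⟩
    B + B + B             ≤⟨ m≤m+n (B + B + B) B ⟩
    B + B + B + B         ≡⟨ solve 1 (λ b → b ⊞ b ⊞ b ⊞ b ⊜ con 4 ⊠ b) refl B ⟩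
    4 * B                 ∎)
    where
    open ≤-Reasoning

  within₂ : ∀ {a b} → a ≤ B → b ≤ B → a + b ≤ κ
  within₂ {a} {b} a≤ b≤ = ≤-trans (m≤m+n (a + b) 0) (within₃ a≤ b≤ z≤n)

  n≤κ : n ≤ κ
  n≤κ = within₁ (≤-trans n≤m m≤B)

  -- Fits the products computed by the scan, where the power of two is at most `2 * m` and the gap
  -- at most `m`.
  within* : ∀ {a b} → a ≤ 2 * m → b ≤ m → a * b ≤ κ
  within* {a} {b} a≤ b≤ = begin
    a * b           ≤⟨ *-mono-≤ a≤ b≤ ⟩
    2 * m * m       ≤⟨ *-mono-≤ (*-monoʳ-≤ 2 m≤B) m≤B ⟩
    2 * B * B       ≡⟨ *-assoc 2 B B ⟩
    2 * (B * B)     ≤⟨ *-monoˡ-≤ (B * B) (s≤s (s≤s (z≤n {2}))) ⟩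
    4 * (B * B)     ∎
    where open ≤-Reasoning

  cell : Store W → ℕ → Word W
  cell σ = get zeros (words σ scratch)

  -- The words of index ≥ n included, where both sides are zero.
  Holds : Variant → Vec Bool m → Store W → Set
  Holds v Y σ = length (words σ scratch) ≡ extent v n × (∀ i → cell σ i ≡ wordAt W (coeff Y) i)

  readShiftCmd readShiftsCmd stageWordCmd : RecArray → Exp → Variant → Cmd
  readShiftCmd a base v =
    splitShift (a at (base :+ $ rI)) ⨾
    ifLt ($ rJ :+ $ rQ) ($ rN)
      (accumulate (shr (scratch atʷ ($ rJ :+ $ rQ)) ($ rB)) ⨾ adjacent v)
      skip
  readShiftsCmd a base v = for rI ($ rCount) (readShiftCmd a base v)
  stageWordCmd a base v =
    acc ≔ʷ scratch atʷ $ rJ ⨾ readShiftsCmd a base v ⨾ scratch [ $ rJ ]≔ʷ $ʷ acc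

  stageCmd : RecArray → Exp → Variant → Cmd
  stageCmd a base v = stageInPlace v a base ($ rCount)

  Untouched : Cmd → List Resource → Set
  Untouched c = All (λ t → touches t c ≡ false)

  -- With `v` a variable, `touches` is stuck on `adjacent v`; for each of the two variants it
  -- computes.
  untouched : ∀ (c : Variant → Cmd) ts → Untouched (c guarded) ts → Untouched (c sentinel) ts → ∀ v → Untouched (c v) ts
  untouched c ts p q guarded  = p
  untouched c ts p q sentinel = q

  -- `base` evaluates to `b` as long as `rBase` holds `β`. The plan takes `base` to be that
  -- register; the online program takes `lit 0`, and then `β` is whatever the register happens to
  -- hold.
  module Stage (v : Variant) (a : RecArray) (base : Exp) {b β : ℕ} {ds : List ℕ} (Y : Vec Bool m)
    (ds<m : All (_< m) ds) (ds≤κ : b + length ds ≤ κ)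
    (baseᵉ : ∀ {σ : Store W} → regs σ rBase ≡ β → Evaluates κ σ base b)
    where

    record Context (σ : Store W) : Set where
      field
        N≡     : regs σ rN ≡ n
        W≡     : regs σ rW ≡ W
        base≡  : regs σ rBase ≡ β
        count≡ : regs σ rCount ≡ length ds
        table  : Segment (recs σ a) b ds
        space  : length (words σ scratch) ≡ extent v n

    open Context

    -- Only the cells from `j` on are assumed to hold `Y`, the earlier ones being overwritten
    -- already. This suffices, as the words read are `j + q` and its successor.
    readShift : ∀ {i j σ x} → i < length ds → j < n → regs σ rI ≡ i → regs σ rJ ≡ j → Context σ →
      (∀ {k} → j ≤ k → cell σ k ≡ wordAt W (coeff Y) k) → wregs σ acc ≡ x →
      Halts κ (readShiftCmd a base v) σ (λ σ′ _ → wregs σ′ acc ≡ x ⊕ wordAt W (λ k → coeff Y (k + get 0 ds i)) j)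
    readShift {i} {j} {σ} {x} i< j<n I≡ J≡ ctx cell≡ acc≡ = shifted v refl
      where
      d = get 0 ds i
      q = d / W
      r = d % W
      d<m : d < m
      d<m = get-All ds<m i<
      j≤B : j ≤ B
      j≤B = ≤-trans (<⇒≤ j<n) (≤-trans n≤m m≤B)
      q≤B : q ≤ B
      q≤B = ≤-trans (m/n≤m d W) (≤-trans (<⇒≤ d<m) m≤B)
      shiftᵉ : ∀ {τ} → regs τ rBase ≡ β → regs τ rI ≡ i → recs τ a ≡ recs σ a →
        Evaluates κ τ (a at (base :+ $ rI)) d
      shiftᵉ base≡ i≡ a≡ = atᵉ (plusᵉ (baseᵉ base≡) (regᵉ i≡) (≤-trans (+-monoʳ-≤ b (<⇒≤ i<)) ds≤κ))
        (subst (λ xs → b + i < length xs) (sym a≡) (≤-trans (+-monoʳ-< b i<) (proj₁ (table ctx))))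
        (trans (cong (λ xs → get 0 xs (b + i)) a≡) (proj₂ (table ctx) i<))
      τ : Store W
      τ = setReg (setReg σ rQ q) rB r
      split : Run κ (splitShift (a at (base :+ $ rI))) σ τ _
      split = seq (runAssign (divᵉ (shiftᵉ (base≡ ctx) I≡ refl) (regᵉ (W≡ ctx)) z<s))
                  (runAssign (modᵉ (shiftᵉ (base≡ ctx) I≡ refl) (regᵉ (W≡ ctx)) z<s))
      nextᵉ : ∀ {u} → Evaluates κ (setWReg τ acc u) ($ rJ :+ $ rQ :+ lit 1) (j + q + 1)
      nextᵉ = plusᵉ (plusᵉ (regᵉ J≡) (regᵉ refl) (within₂ j≤B q≤B)) litᵉ (within₃ j≤B q≤B 1≤B)
      posᵉ : Evaluates κ τ ($ rJ :+ $ rQ) (j + q)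
      posᵉ = plusᵉ (regᵉ J≡) (regᵉ refl) (within₂ j≤B q≤B)
      result = wordAt W (λ k → coeff Y (k + d)) j
      low high : Word W
      low  = down r (wordAt W (coeff Y) (j + q))
      high = up (W ∸ r) (wordAt W (coeff Y) (j + q + 1))
      high-beyond : n ≤ j + q + 1 → high ≡ zeros
      high-beyond n≤ = trans (cong (up (W ∸ r)) (wordAt-beyond Y n≤)) (up-zeros (W ∸ r))
      low-beyond : n ≤ j + q → low ≡ zeros
      low-beyond n≤ = trans (cong (down r) (wordAt-beyond Y n≤)) (down-zeros r)
      sum≡ : x ⊕ low ⊕ high ≡ x ⊕ result
      sum≡ = trans (⊕-assoc x low high) (cong (x ⊕_) (sym (wordAt-advance (coeff Y) d j)))
      lowR : j + q < n → Run κ (accumulate (shr (scratch atʷ ($ rJ :+ $ rQ)) ($ rB))) τ (setWReg τ acc (x ⊕ low)) _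
      lowR q<n = runAssignʷ (xorᵂ (regᵂ acc≡) (shrᵂ (atᵂ posᵉ (≤-trans q<n (subst (n ≤_) (sym (space ctx)) (≤-extent v)))
                    (cell≡ (m≤m+n j q))) (regᵉ refl)))
      highR : j + q + 1 < extent v n → Run κ readNext (setWReg τ acc (x ⊕ low)) (setWReg (setWReg τ acc (x ⊕ low)) acc (x ⊕ low ⊕ high)) _
      highR < = runAssignʷ (xorᵂ (regᵂ refl) (shlᵂ (atᵂ nextᵉ (subst (j + q + 1 <_) (sym (space ctx)) <)
                   (cell≡ (≤-trans (m≤m+n j q) (m≤m+n (j + q) 1)))) (minusᵉ (regᵉ (W≡ ctx)) (regᵉ refl))))
      shifted : ∀ v′ → v ≡ v′ → Halts κ (readShiftCmd a base v) σ (λ σ′ _ → wregs σ′ acc ≡ x ⊕ result)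
      shifted v′ v≡ with <-≤-connex (j + q) n
      -- Both source words lie past the end and are zero, so skipping them loses nothing.
      ... | inj₂ n≤q = _ , _ , seq split (runElse posᵉ (regᵉ (N≡ ctx)) n≤q skip) ,
        (begin
          wregs σ acc        ≡⟨ acc≡ ⟩
          x                  ≡⟨ trans (⊕-identityʳ (x ⊕ zeros)) (⊕-identityʳ x) ⟨
          x ⊕ zeros ⊕ zeros  ≡⟨ cong₂ (λ y z → x ⊕ y ⊕ z) (low-beyond n≤q) (high-beyond (≤-trans n≤q (m≤m+n (j + q) 1))) ⟨
          x ⊕ low ⊕ high   ≡⟨ sum≡ ⟩
          x ⊕ result         ∎)
        where open ≡-Reasoning
      -- From `j + q < n` the successor word has index at most `n`, the index of the sentinel: the
      -- read stays in bounds without a test.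
      shifted sentinel refl | inj₁ q<n = _ , _ ,
        seq split (runThen posᵉ (regᵉ (N≡ ctx)) q<n (seq (lowR q<n) (highR (+-monoˡ-< 1 q<n)))) , sum≡
      shifted guarded refl | inj₁ q<n with <-≤-connex (j + q + 1) n
      ... | inj₁ q+1<n = _ , _ ,
        seq split (runThen posᵉ (regᵉ (N≡ ctx)) q<n (seq (lowR q<n)
          (runThen nextᵉ (regᵉ (N≡ ctx)) q+1<n (highR q+1<n)))) , sum≡
      -- The guarded variant skips the word that the sentinel would have supplied as zero.
      ... | inj₂ n≤q+1 = _ , _ ,
        seq split (runThen posᵉ (regᵉ (N≡ ctx)) q<n (seq (lowR q<n)
          (runElse nextᵉ (regᵉ (N≡ ctx)) n≤q+1 skip))) ,
        trans (sym (⊕-identityʳ (x ⊕ low))) (trans (cong (x ⊕ low ⊕_) (sym (high-beyond n≤q+1))) sum≡)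

    private
      step : ℕ → Word W → ℕ → Word W
      step j x d = x ⊕ wordAt W (λ k → coeff Y (k + d)) j

      new old : ℕ → Word W
      new = wordAt W (coeff (applyStage ds Y))
      old = wordAt W (coeff Y)

      contextual : List Resource
      contextual = register rN ∷ register rW ∷ register rBase ∷ register rCount ∷ recordArray a ∷ allocation ∷ []

    context-frame : ∀ {c σ σ′} → Frame c σ σ′ → Untouched c contextual → Context σ → Context σ′
    context-frame fr (n∉ ∷ w∉ ∷ base∉ ∷ count∉ ∷ a∉ ∷ alloc∉ ∷ []) ctx = record
      { N≡     = trans (preserves fr (register rN) n∉) (N≡ ctx)
      ; W≡     = trans (preserves fr (register rW) w∉) (W≡ ctx)
      ; base≡  = trans (preserves fr (register rBase) base∉) (base≡ ctx)
      ; count≡ = trans (preserves fr (register rCount) count∉) (count≡ ctx)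
      ; table  = subst (λ xs → Segment xs b ds) (sym (preserves fr (recordArray a) a∉)) (table ctx)
      ; space  = trans (proj₂ (preserves fr allocation alloc∉) scratch) (space ctx)
      }

    private
      readShift-untouched : Untouched (readShiftCmd a base v) (register rI ∷ [])
      readShift-untouched = untouched (readShiftCmd a base) _ (refl ∷ []) (refl ∷ []) v

      readShifts-untouched : Untouched (readShiftsCmd a base v) (register rJ ∷ wordArray scratch ∷ contextual)
      readShifts-untouched = untouched (readShiftsCmd a base) _
        (refl ∷ refl ∷ refl ∷ refl ∷ refl ∷ refl ∷ refl ∷ refl ∷ [])
        (refl ∷ refl ∷ refl ∷ refl ∷ refl ∷ refl ∷ refl ∷ refl ∷ []) v

      stageWord-untouched : Untouched (stageWordCmd a base v) (register rJ ∷ [])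
      stageWord-untouched = untouched (stageWordCmd a base) _ (refl ∷ []) (refl ∷ []) v

    stage-untouched : Untouched (stageCmd a base v) contextual
    stage-untouched = untouched (stageCmd a base) _
      (refl ∷ refl ∷ refl ∷ refl ∷ refl ∷ refl ∷ [])
      (refl ∷ refl ∷ refl ∷ refl ∷ refl ∷ refl ∷ []) v

    readShifts : ∀ {j σ} → j < n → regs σ rJ ≡ j → Context σ →
      (∀ {k} → j ≤ k → cell σ k ≡ old k) → wregs σ acc ≡ old j →
      Halts κ (readShiftsCmd a base v) σ (λ σ′ _ → wregs σ′ acc ≡ new j)
    readShifts {j} {σ} j<n J≡ ctx cell≡ acc≡ =
      let σ′ , u , r , acc′ , _ = loop in σ′ , u , r , trans (cong (foldl (step j) (wregs σ′ acc)) (sym (drop-length ds))) acc′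
      where
      -- Phrased by the shifts still to come: each iteration consumes the head of the remaining
      -- fold, and with none left the accumulator is the new word.
      Inv : ℕ → Store W → Set
      Inv i σ = foldl (step j) (wregs σ acc) (List.drop i ds) ≡ new j
      loop = halts-for nothing {y = rCount} (length ds) (≤-trans (m≤n+m (length ds) b) ds≤κ) Inv 0 {σ}
        (All.head readShift-untouched) (All.lookup readShifts-untouched (there (there (there (there (there (here refl))))))) (count≡ ctx)
        (λ {i} {τ} i< i≡ fr inv →
          let σ′ , u , r , acc′ = readShift i< j<n i≡ (trans (preserves fr (register rJ) (All.head readShifts-untouched)) J≡)
                 (context-frame fr (All.tail (All.tail readShifts-untouched)) ctx)
                 (λ {k} j≤k → trans (cong (λ xs → get zeros xs k) (preserves fr (wordArray scratch) (All.head (All.tail readShifts-untouched)))) (cell≡ j≤k)) refl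
          in σ′ , u , r ,
             trans (cong (λ x → foldl (step j) x (List.drop (suc i) ds)) acc′)
               (trans (cong (foldl (step j) (wregs τ acc)) (sym (drop-get {z = 0} ds i<))) inv) ,
             z≤n)
        (trans (cong (λ x → foldl (step j) x ds) acc≡)
          (trans (wordAt-⨁ (coeff Y) (λ d k → coeff Y (k + d)) j ds)
                 (wordAt-cong j (λ i → sym (coeff-applyStage ds Y i)))))

    stage : ∀ {σ} → Context σ → Holds v Y σ →
      Halts κ (stageInPlace v a base ($ rCount)) σ (λ σ′ _ → Holds v (applyStage ds Y) σ′)
    stage {σ} ctx (space≡ , cell≡) =
      let σ′ , u , r , (below , above) , _ = loop
      in σ′ , u , r , trans (proj₂ (unchanged r allocation (All.lookup stage-untouched (there (there (there (there (there (here refl)))))))) scratch) space≡ ,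
         -- Indices from `n` on are not written by the loop. They were zero for `Y` and have to be
         -- zero for the new state, so the sentinel survives the stage.
         λ i → [ below , (λ n≤i → trans (above n≤i) (trans (wordAt-beyond Y n≤i) (sym (wordAt-beyond (applyStage ds Y) n≤i)))) ]′ (<-≤-connex i n)
      where
      loop = halts-for nothing {y = rN} n n≤κ (λ j σ → Partial zeros j new old (words σ scratch)) 0 {σ}
        (All.head stageWord-untouched) (All.head stage-untouched) (N≡ ctx)
        (λ {j} {τ} j<n J≡ fr partial →
          let ctx′ = context-frame fr stage-untouched ctx
              j< : j < length (words τ scratch)
              j< = ≤-trans j<n (subst (n ≤_) (sym (space ctx′)) (≤-extent v))
              τ₁ = setWReg τ acc (old j)
              ctx₁ : Context τ₁
              ctx₁ = record { N≡ = N≡ ctx′ ; W≡ = W≡ ctx′ ; base≡ = base≡ ctx′ ; count≡ = count≡ ctx′ ; table = table ctx′ ; space = space ctx′ }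
              τ₂ , _ , r₂ , acc₂ = readShifts {σ = τ₁} j<n J≡ ctx₁ (proj₂ partial) refl
              words≡ : words τ₂ scratch ≡ words τ scratch
              words≡ = unchanged r₂ (wordArray scratch) (All.head (All.tail readShifts-untouched))
              J₂ : regs τ₂ rJ ≡ j
              J₂ = trans (unchanged r₂ (register rJ) (All.head readShifts-untouched)) J≡
          in _ , _ ,
             seq (runAssignʷ (atᵂ (regᵉ J≡) j< (proj₂ partial ≤-refl)))
               (seq r₂ (runWriteʷ (regᵉ J₂) (regᵂ acc₂) (subst (λ xs → j < length xs) (sym words≡) j<))) ,
             subst (λ xs → Partial zeros (suc j) new old (put xs j (new j))) (sym words≡) (partial-put zeros {xs = words τ scratch} j< partial) ,
             z≤n)
        (partial-start zeros {xs = words σ scratch} cell≡)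

-- Loading the high half and assembling the output

module Ends {m : ℕ} (1≤m : 1 ≤ m) (w : ℕ) (A : Vec Bool (m + m)) where

  open Reduction 1≤m w

  record Geometry (σ : Store W) : Set where
    field
      M≡     : regs σ rM ≡ m
      W≡     : regs σ rW ≡ W
      N≡     : regs σ rN ≡ n
      input≡ : words σ input ≡ pack W A

  open Geometry

  geometric : List Resource
  geometric = register rM ∷ register rW ∷ register rN ∷ wordArray input ∷ []

  geometry-frame : ∀ {c σ σ′} → Frame c σ σ′ → Untouched c geometric → Geometry σ → Geometry σ′
  geometry-frame fr (m∉ ∷ w∉ ∷ n∉ ∷ input∉ ∷ []) g = record
    { M≡     = trans (preserves fr (register rM) m∉) (M≡ g)
    ; W≡     = trans (preserves fr (register rW) w∉) (W≡ g)
    ; N≡     = trans (preserves fr (register rN) n∉) (N≡ g)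
    ; input≡ = trans (preserves fr (wordArray input) input∉) (input≡ g)
    }

  private
    j*W≤B : ∀ {j} → j < n → (j + 1) * W ≤ m + W
    j*W≤B {j} j<n = begin
      (j + 1) * W  ≡⟨ cong (_* W) (+-comm j 1) ⟩
      W + j * W    ≤⟨ +-monoʳ-≤ W (<⇒≤ (<ceilDiv⇒*< j<n)) ⟩
      W + m        ≡⟨ +-comm W m ⟩
      m + W        ∎
      where open ≤-Reasoning

    j≤B : ∀ {j} → j < n → j ≤ m + W
    j≤B j<n = ≤-trans (<⇒≤ j<n) (≤-trans n≤m m≤B)

    input< : ∀ {i} → i * W < m + m → i < length (pack W A)
    input< iW< = subst (_ <_) (sym (length-pack A)) (*<⇒<ceilDiv iW<)

  highWordCmd : Cmd
  highWordCmd =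
    acc ≔ʷ shr (input atʷ ($ rQ :+ $ rJ)) ($ rB) ⨾
    ifLt ($ rQ :+ $ rJ :+ lit 1) ($ rLen)
      (accumulate (shl (input atʷ ($ rQ :+ $ rJ :+ lit 1)) ($ rW :- $ rB)))
      skip ⨾
    scratch [ $ rJ ]≔ʷ $ʷ acc

  private
    q r len : ℕ
    q   = m / W
    r   = m % W
    len = ceilDiv (m + m) W

    high : ℕ → Word W
    high = wordAt W (coeff (drop m A))

    q≤B : q ≤ m + W
    q≤B = ≤-trans (m/n≤m m W) m≤B

    high≡ : ∀ j → down r (wordAt W (coeff A) (q + j)) ⊕ up (W ∸ r) (wordAt W (coeff A) (q + j + 1)) ≡ high j
    high≡ j = begin
      _ ≡⟨ cong (λ i → down r (wordAt W (coeff A) i) ⊕ up (W ∸ r) (wordAt W (coeff A) (i + 1))) (+-comm q j) ⟩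
      _ ≡⟨ wordAt-advance (coeff A) m j ⟨
      wordAt W (λ i → coeff A (i + m)) j
        ≡⟨ wordAt-cong j (λ i → trans (cong (coeff A) (+-comm i m)) (sym (coeff-drop m A i))) ⟩
      high j ∎
      where open ≡-Reasoning

  -- The input belongs to the caller and carries no sentinel; the test against `rLen` skips a
  -- successor word past its end, which would contribute zero.
  readHigh : ∀ {j σ} → j < n → Geometry σ → regs σ rQ ≡ q → regs σ rB ≡ r → regs σ rLen ≡ len → regs σ rJ ≡ j →
    j < length (words σ scratch) →
    Halts κ highWordCmd σ (λ σ′ _ → words σ′ scratch ≡ put (words σ scratch) j (high j))
  readHigh {j} {σ} j<n g Q≡ B≡ len≡ J≡ j< = rest
    where
    position : ∀ {τ} → regs τ rQ ≡ q → regs τ rJ ≡ j → Evaluates κ τ ($ rQ :+ $ rJ) (q + j)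
    position Q≡ J≡ = plusᵉ (regᵉ Q≡) (regᵉ J≡) (within₂ q≤B (j≤B j<n))
    next : ∀ {τ} → regs τ rQ ≡ q → regs τ rJ ≡ j → Evaluates κ τ ($ rQ :+ $ rJ :+ lit 1) (q + j + 1)
    next Q≡ J≡ = plusᵉ (position Q≡ J≡) litᵉ (within₃ q≤B (j≤B j<n) 1≤B)
    lowBits : Word W
    lowBits  = down r (wordAt W (coeff A) (q + j))
    read : ∀ {τ i} {e : Exp} → words τ input ≡ words σ input → i < len → Evaluates κ τ e i →
      Evaluatesʷ κ τ (input atʷ e) (wordAt W (coeff A) i)
    read {i = i} input′ i< eᵉ = atᵂ eᵉ
      (subst (λ xs → i < length xs) (sym (trans input′ (input≡ g))) (subst (i <_) (sym (length-pack A)) i<))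
      (trans (cong (λ xs → get zeros xs i) (trans input′ (input≡ g))) (get-pack A i))
    first : Run κ (acc ≔ʷ shr (input atʷ ($ rQ :+ $ rJ)) ($ rB)) σ (setWReg σ acc lowBits) _
    first = runAssignʷ (shrᵂ (read refl q+j<len (position Q≡ J≡)) (regᵉ B≡))
      where
      q+j<len : q + j < len
      q+j<len = *<⇒<ceilDiv (subst (_< m + m) (sym (*-distribʳ-+ W q j)) (+-mono-≤-< (m/n*n≤m m W) (<ceilDiv⇒*< j<n)))
    rest : Halts κ highWordCmd σ (λ σ′ _ → words σ′ scratch ≡ put (words σ scratch) j (high j))
    rest with <-≤-connex (q + j + 1) len
    ... | inj₁ q+j+1< = _ , _ ,
      seq first (seq (runThen (next Q≡ J≡) (regᵉ len≡) q+j+1<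
        (runAssignʷ (xorᵂ (regᵂ refl) (shlᵂ (read refl q+j+1< (next Q≡ J≡)) (minusᵉ (regᵉ (W≡ g)) (regᵉ B≡))))))
        (runWriteʷ (regᵉ J≡) (regᵂ (high≡ j)) j<)) , refl
    ... | inj₂ ≤q+j+1 = _ , _ ,
      seq first (seq (runElse (next Q≡ J≡) (regᵉ len≡) ≤q+j+1 skip)
        (runWriteʷ (regᵉ J≡) (regᵂ (trans (sym (trans
          (cong (lowBits ⊕_) (trans (cong (up (W ∸ r)) (wordAt-beyond A ≤q+j+1)) (up-zeros (W ∸ r)))) (⊕-identityʳ lowBits)))
          (high≡ j))) j<)) , refl

  -- The loop writes the first `n` words only, and `pad` supplies the zeros that `Holds` demands
  -- beyond them.
  halts-loadHigh : ∀ v {σ} → Geometry σ → length (words σ scratch) ≡ extent v n → (∀ {i} → n ≤ i → cell σ i ≡ zeros) →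
    Halts κ loadHigh σ (λ σ′ _ → Holds v (drop m A) σ′)
  halts-loadHigh v {σ} g space pad =
    let σ′ , _ , rs , (below , above) , _ = loop
        run = seq (seq (runAssign (divᵉ (regᵉ (M≡ g)) (regᵉ (W≡ g)) z<s))
                       (runAssign (modᵉ (regᵉ (M≡ g)) (regᵉ (W≡ g)) z<s)))
              (seq (runAssign (divᵉ (plusᵉ (plusᵉ (regᵉ (M≡ g)) (regᵉ (M≡ g)) (within₂ m≤B m≤B))
                                          (minusᵉ (regᵉ (W≡ g)) litᵉ)
                                          (within₃ m≤B m≤B (≤-trans (n≤1+n w) (m≤n+m W m))))
                                   (regᵉ (W≡ g)) z<s))
                   rs)
    in σ′ , _ , run , trans (proj₂ (unchanged rs allocation refl) scratch) space ,
       λ i → [ below , (λ n≤i → trans (above n≤i) (trans (pad n≤i) (sym (wordAt-beyond (drop m A) n≤i)))) ]′ (<-≤-connex i n)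
    where
    σ₁ : Store W
    σ₁ = setReg (setReg (setReg σ rQ q) rB r) rLen len
    g₁ : Geometry σ₁
    g₁ = record { M≡ = M≡ g ; W≡ = W≡ g ; N≡ = N≡ g ; input≡ = input≡ g }
    loop = halts-for nothing {y = rN} n n≤κ (λ j σ → Partial zeros j high (cell σ₁) (words σ scratch)) 0 {σ₁}
      refl refl (N≡ g)
      (λ {j} {τ} j<n J≡ fr partial →
        let j< = ≤-trans j<n (≤-trans (≤-extent v)
                   (≤-reflexive (sym (trans (proj₂ (preserves fr allocation refl) scratch) space))))
            τ′ , u , rs , eq = readHigh j<n (geometry-frame fr (refl ∷ refl ∷ refl ∷ refl ∷ []) g₁)
              (preserves fr (register rQ) refl) (preserves fr (register rB) refl) (preserves fr (register rLen) refl) J≡ j<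
        in τ′ , u , rs , subst (Partial zeros (suc j) high (cell σ₁)) (sym eq) (partial-put zeros {xs = words τ scratch} j< partial) , z≤n)
      (partial-start zeros {xs = words σ scratch} (λ _ → refl))

  module Assembly (a : RecArray) (T : List ℕ) (T≤m : length T ≤ m) (v : Variant) where

    private
      Y : Vec Bool m
      Y = finalState m T A

      out : ℕ → Word W
      out = wordAt W (coeff (frobeniusReduce m T A))

      assembled : ℕ → Bool
      assembled i = coeff A i xor ⨁ (λ t → delay t (coeff Y) i) T

      step : ℕ → Word W → ℕ → Word W
      step j x t = x ⊕ wordAt W (delay t (coeff Y)) j

    record Taps (σ : Store W) : Set where
      field
        S≡   : regs σ rS ≡ length T
        taps : recs σ a ≡ T
        held : Holds v Y σ

    open Taps

    taps-frame : ∀ {c σ σ′} → Frame c σ σ′ →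
      Untouched c (register rS ∷ recordArray a ∷ wordArray scratch ∷ []) → Taps σ → Taps σ′
    taps-frame fr (s∉ ∷ a∉ ∷ scratch∉ ∷ []) t = record
      { S≡   = trans (preserves fr (register rS) s∉) (S≡ t)
      ; taps = trans (preserves fr (recordArray a) a∉) (taps t)
      ; held = subst (λ xs → length xs ≡ extent v n × (∀ i → get zeros xs i ≡ wordAt W (coeff Y) i))
                 (sym (preserves fr (wordArray scratch) scratch∉)) (held t)
      }

    addTapCmd addTapsCmd : Cmd
    addTapCmd =
      splitShift (a at $ rI) ⨾
      ifLt ($ rJ) ($ rQ) skip
        (accumulate (shl (scratch atʷ ($ rJ :- $ rQ)) ($ rB)) ⨾
         ifLt ($ rQ) ($ rJ)
           (accumulate (shr (scratch atʷ ($ rJ :- $ rQ :- lit 1)) ($ rW :- $ rB)))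
           skip)
    addTapsCmd = for rI ($ rS) addTapCmd

    -- The branches of the program are the three cases of a word of a delayed sequence. Here a shift
    -- moves bits upwards, so the words read have index at most `j` and no sentinel is involved.
    addTap : ∀ {i j σ x} → i < length T → j < n → regs σ rI ≡ i → regs σ rJ ≡ j → Geometry σ → Taps σ → wregs σ acc ≡ x →
      Halts κ addTapCmd σ (λ σ′ _ → wregs σ′ acc ≡ step j x (get 0 T i))
    addTap {i} {j} {σ} {x} i< j<n I≡ J≡ g t acc≡ = rest
      where
      d = get 0 T i
      qₜ = d / W
      rₜ = d % W
      p = coeff Y
      τ : Store W
      τ = setReg (setReg σ rQ qₜ) rB rₜ
      tapᵉ : ∀ {τ} → regs τ rI ≡ i → recs τ a ≡ recs σ a → Evaluates κ τ (a at $ rI) d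
      tapᵉ i≡ a≡ = atᵉ (regᵉ i≡) (subst (λ xs → i < length xs) (sym (trans a≡ (taps t))) i<)
        (cong (λ xs → get 0 xs i) (trans a≡ (taps t)))
      split : Run κ (splitShift (a at $ rI)) σ τ _
      split = seq (runAssign (divᵉ (tapᵉ I≡ refl) (regᵉ (W≡ g)) z<s))
                  (runAssign (modᵉ (tapᵉ I≡ refl) (regᵉ (W≡ g)) z<s))
      read : ∀ {τ k} {e : Exp} → words τ scratch ≡ words σ scratch → k ≤ j → Evaluates κ τ e k →
        Evaluatesʷ κ τ (scratch atʷ e) (wordAt W p k)
      read {k = k} s≡ k≤j eᵉ = atᵂ eᵉ
        (subst (λ xs → k < length xs) (sym s≡)
          (≤-trans (≤-<-trans k≤j j<n) (≤-trans (≤-extent v) (≤-reflexive (sym (proj₁ (held t)))))))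
        (trans (cong (λ xs → get zeros xs k) s≡) (proj₂ (held t) k))
      low : Word W
      low = up rₜ (wordAt W p (j ∸ qₜ))
      lowR : Run κ (accumulate (shl (scratch atʷ ($ rJ :- $ rQ)) ($ rB))) τ (setWReg τ acc (x ⊕ low)) _
      lowR = runAssignʷ (xorᵂ (regᵂ acc≡) (shlᵂ (read refl (m∸n≤m j qₜ) (minusᵉ (regᵉ J≡) (regᵉ refl))) (regᵉ refl)))
      rest : Halts κ addTapCmd σ (λ σ′ _ → wregs σ′ acc ≡ step j x d)
      rest with <-cmp j qₜ
      ... | tri< j<q _ _ = _ , _ , seq split (runThen (regᵉ J≡) (regᵉ refl) j<q skip) ,
        trans acc≡ (trans (sym (⊕-identityʳ x)) (cong (x ⊕_) (sym (wordAt-delay-< p d j<q))))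
      ... | tri≈ _ j≡q _ = _ , _ ,
        seq split (runElse (regᵉ J≡) (regᵉ refl) (≤-reflexive (sym j≡q))
          (seq lowR (runElse (regᵉ refl) (regᵉ J≡) (≤-reflexive j≡q) skip))) ,
        cong (x ⊕_) (begin
          up rₜ (wordAt W p (j ∸ qₜ))       ≡⟨ cong (λ k → up rₜ (wordAt W p (k ∸ qₜ))) j≡q ⟩
          up rₜ (wordAt W p (qₜ ∸ qₜ))      ≡⟨ cong (λ k → up rₜ (wordAt W p k)) (n∸n≡0 qₜ) ⟩
          up rₜ (wordAt W p 0)              ≡⟨ wordAt-delay-≡ p d ⟨
          wordAt W (delay d p) qₜ           ≡⟨ cong (wordAt W (delay d p)) j≡q ⟨
          wordAt W (delay d p) j            ∎)
        where open ≡-Reasoning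
      ... | tri> _ _ q<j = _ , _ ,
        seq split (runElse (regᵉ J≡) (regᵉ refl) (<⇒≤ q<j)
          (seq lowR (runThen (regᵉ refl) (regᵉ J≡) q<j
            (runAssignʷ (xorᵂ (regᵂ refl) (shrᵂ
              (read refl (≤-trans (m∸n≤m (j ∸ qₜ) 1) (m∸n≤m j qₜ)) (minusᵉ (minusᵉ (regᵉ J≡) (regᵉ refl)) litᵉ))
              (minusᵉ (regᵉ (W≡ g)) (regᵉ refl)))))))) ,
        trans (⊕-assoc x low _) (cong (x ⊕_) (begin
          up rₜ (wordAt W p (j ∸ qₜ)) ⊕ down (W ∸ rₜ) (wordAt W p k)
            ≡⟨ cong (λ i → up rₜ (wordAt W p i) ⊕ down (W ∸ rₜ) (wordAt W p k)) suc-k ⟨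
          up rₜ (wordAt W p (suc k)) ⊕ down (W ∸ rₜ) (wordAt W p k)
            ≡⟨ wordAt-delay-> p d k ⟨
          wordAt W (delay d p) (qₜ + suc k)
            ≡⟨ cong (wordAt W (delay d p)) (trans (cong (qₜ +_) suc-k) (m+[n∸m]≡n (<⇒≤ q<j))) ⟩
          wordAt W (delay d p) j ∎))
        where
        open ≡-Reasoning
        k = j ∸ qₜ ∸ 1
        suc-k : suc k ≡ j ∸ qₜ
        suc-k = m+[n∸m]≡n (m<n⇒0<n∸m q<j)

    addTaps : ∀ {j σ} → j < n → regs σ rJ ≡ j → Geometry σ → Taps σ → wregs σ acc ≡ wordAt W (coeff A) j →
      Halts κ addTapsCmd σ (λ σ′ _ → wregs σ′ acc ≡ wordAt W assembled j)
    addTaps {j} {σ} j<n J≡ g t acc≡ =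
      let σ′ , u , rs , acc′ , _ = loop in σ′ , u , rs , trans (cong (foldl (step j) (wregs σ′ acc)) (sym (drop-length T))) acc′
      where
      Inv : ℕ → Store W → Set
      Inv i σ = foldl (step j) (wregs σ acc) (List.drop i T) ≡ wordAt W assembled j
      loop = halts-for nothing {y = rS} (length T) (within₁ (≤-trans T≤m m≤B)) Inv 0 {σ}
        refl refl (S≡ t)
        (λ {i} {τ} i< i≡ fr inv →
          let σ′ , u , rs , acc′ = addTap i< j<n i≡ (trans (preserves fr (register rJ) refl) J≡)
                 (geometry-frame fr (refl ∷ refl ∷ refl ∷ refl ∷ []) g)
                 (taps-frame fr (refl ∷ refl ∷ refl ∷ []) t) refl
          in σ′ , u , rs ,
             trans (cong (λ x → foldl (step j) x (List.drop (suc i) T)) acc′)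
               (trans (cong (foldl (step j) (wregs τ acc)) (sym (drop-get {z = 0} T i<))) inv) ,
             z≤n)
        (trans (cong (λ x → foldl (step j) x T) acc≡) (wordAt-⨁ (coeff A) (λ t → delay t (coeff Y)) j T))

    halts-assembleOutput : ∀ {σ} → Geometry σ → Taps σ → length (words σ output) ≡ n →
      Halts κ (assembleOutput a) σ (λ σ′ _ → words σ′ output ≡ pack W (frobeniusReduce m T A))
    halts-assembleOutput {σ} g t out≡ =
      let σ′ , u , rs , below , _ = loop
          len = trans (proj₂ (unchanged rs allocation refl) output) out≡
      in σ′ , u , rs , get-ext {z = zeros} _ _ (trans len (sym (length-pack (frobeniusReduce m T A))))
           (λ {i} i< → trans (below (subst (i <_) len i<)) (sym (get-pack (frobeniusReduce m T A) i)))
      where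
      -- From position `m` on, the last word of `assembled` may contain low bits of the high half of
      -- `A` as well as overflow from the taps; the two shifts clear both.
      out-word : ∀ j → down ((j + 1) * W ∸ m) (up ((j + 1) * W ∸ m) (wordAt W assembled j)) ≡ out j
      out-word j = trans
        (cong (λ k → down (k * W ∸ m) (up (k * W ∸ m) (wordAt W assembled j))) (+-comm j 1))
        (sym (wordAt-truncate (coeff-frobeniusReduce m T A) (coeff-beyond (frobeniusReduce m T A)) j))
      loop = halts-for nothing {y = rN} n n≤κ (λ j τ → Filled zeros j out (words τ output)) 0 {σ}
        refl refl (N≡ g)
        (λ {j} {τ} j<n J≡ fr filled →
          let g′ = geometry-frame fr (refl ∷ refl ∷ refl ∷ refl ∷ []) g
              t′ = taps-frame fr (refl ∷ refl ∷ refl ∷ []) t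
              j< : j < length (words τ output)
              j< = subst (j <_) (sym (trans (proj₂ (preserves fr allocation refl) output) out≡)) j<n
              τ₁ = setWReg τ acc (wordAt W (coeff A) j)
              τ₂ , _ , r₂ , acc₂ = addTaps {σ = τ₁} j<n J≡
                (record { M≡ = M≡ g′ ; W≡ = W≡ g′ ; N≡ = N≡ g′ ; input≡ = input≡ g′ })
                (record { S≡ = S≡ t′ ; taps = taps t′ ; held = held t′ }) refl
              J₂ : regs τ₂ rJ ≡ j
              J₂ = trans (unchanged r₂ (register rJ) refl) J≡
              out₂ : words τ₂ output ≡ words τ output
              out₂ = unchanged r₂ (wordArray output) refl
          in _ , _ ,
             seq (runAssignʷ (atᵂ (regᵉ J≡)
                    (subst (λ xs → j < length xs) (sym (input≡ g′)) (input< (≤-trans (<ceilDiv⇒*< j<n) (m≤m+n m m))))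
                    (trans (cong (λ xs → get zeros xs j) (input≡ g′)) (get-pack A j))))
               (seq r₂
                 (seq (runAssign (minusᵉ (timesᵉ (plusᵉ (regᵉ J₂) litᵉ (within₂ (j≤B j<n) 1≤B))
                                                (regᵉ (trans (unchanged r₂ (register rW) refl) (W≡ g′)))
                                                (within₁ (j*W≤B j<n)))
                                        (regᵉ (trans (unchanged r₂ (register rM) refl) (M≡ g′)))))
                   (runWriteʷ (regᵉ J₂) (shrᵂ (shlᵂ (regᵂ acc₂) (regᵉ refl)) (regᵉ refl))
                     (subst (λ xs → j < length xs) (sym out₂) j<)))) ,
             subst (Filled zeros (suc j) out)
               (cong₂ (λ xs x → put xs j x) (sym out₂) (sym (out-word j)))
               (filled-put zeros {new = out} {xs = words τ output} j< filled) ,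
             z≤n)
        (λ ())

-- Concatenated schedules and their sums

module _ (f : ℕ → List ℕ) where

  -- Where stage `k` begins in the concatenated schedule. The plan does not record it: `rBase`
  -- recovers it as the running sum of the stage counts.
  offset : ℕ → ℕ
  offset k = length (concatMap f (upTo k))

  private
    concatMap-upTo-suc : ∀ k → concatMap f (upTo (suc k)) ≡ concatMap f (upTo k) ++ f k
    concatMap-upTo-suc k = begin
      concatMap f (upTo (suc k))             ≡⟨ cong (concatMap f) (upTo-∷ʳ k) ⟨
      concatMap f (upTo k ++ k ∷ [])         ≡⟨ concatMap-++ f (upTo k) (k ∷ []) ⟩
      concatMap f (upTo k) ++ (f k ++ [])    ≡⟨ cong (concatMap f (upTo k) ++_) (++-identityʳ (f k)) ⟩
      concatMap f (upTo k) ++ f k            ∎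
      where open ≡-Reasoning

  offset-suc : ∀ k → offset (suc k) ≡ offset k + length (f k)
  offset-suc k = trans (cong length (concatMap-upTo-suc k)) (length-++ (concatMap f (upTo k)))

  offset-sum : ∀ k → offset k ≡ sum (map (length ∘ f) (upTo k))
  offset-sum zero    = refl
  offset-sum (suc k) = begin
    offset (suc k)                                    ≡⟨ offset-suc k ⟩
    offset k + length (f k)                           ≡⟨ cong₂ _+_ (offset-sum k) (sym (+-identityʳ _)) ⟩
    sum (map (length ∘ f) (upTo k)) + sum (length (f k) ∷ []) ≡⟨ sum-++ (map (length ∘ f) (upTo k)) _ ⟨
    sum (map (length ∘ f) (upTo k) ++ length (f k) ∷ [])      ≡⟨ cong sum (map-++ (length ∘ f) (upTo k) (k ∷ [])) ⟨
    sum (map (length ∘ f) (upTo k ++ k ∷ []))         ≡⟨ cong (λ xs → sum (map (length ∘ f) xs)) (upTo-∷ʳ k) ⟩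
    sum (map (length ∘ f) (upTo (suc k)))             ∎
    where open ≡-Reasoning

  concatMap-split : ∀ {k r} → k < r → ∃[ rest ] concatMap f (upTo r) ≡ concatMap f (upTo k) ++ (f k ++ rest)
  concatMap-split {k} {suc r} k<r with m≤n⇒m<n∨m≡n (s≤s⁻¹ k<r)
  ... | inj₂ refl = [] , trans (concatMap-upTo-suc k) (cong (concatMap f (upTo k) ++_) (sym (++-identityʳ (f k))))
  ... | inj₁ k<r′ with concatMap-split k<r′
  ...   | rest , eq = rest ++ f r , (begin
    concatMap f (upTo (suc r))                           ≡⟨ concatMap-upTo-suc r ⟩
    concatMap f (upTo r) ++ f r                          ≡⟨ cong (_++ f r) eq ⟩
    (concatMap f (upTo k) ++ (f k ++ rest)) ++ f r       ≡⟨ ++-assoc (concatMap f (upTo k)) _ _ ⟩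
    concatMap f (upTo k) ++ ((f k ++ rest) ++ f r)       ≡⟨ cong (concatMap f (upTo k) ++_) (++-assoc (f k) rest (f r)) ⟩
    concatMap f (upTo k) ++ (f k ++ (rest ++ f r))       ∎)
    where open ≡-Reasoning

  segment-concatMap : ∀ {k r} → k < r → Segment (concatMap f (upTo r)) (offset k) (f k)
  segment-concatMap {k} {r} k<r with concatMap-split k<r
  ... | rest , eq rewrite eq =
    ≤-trans (+-monoʳ-≤ (offset k) (m≤m+n (length (f k)) (length rest)))
      (≤-reflexive (sym (trans (length-++ (concatMap f (upTo k))) (cong (offset k +_) (length-++ (f k)))))) ,
    λ {i} i< → trans (get-++ʳ (concatMap f (upTo k)) i) (get-++ˡ (f k) i<)

-- The scan lists the shifts from the largest exponent down; since xor is commutative, applying them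
-- in that order gives the same stage.
applyStage-reverse : ∀ {m} ds (Y : Vec Bool m) → applyStage (reverse ds) Y ≡ applyStage ds Y
applyStage-reverse ds Y = coeff-ext _ _ λ i _ → begin
  coeff (applyStage (reverse ds) Y) i                     ≡⟨ coeff-applyStage (reverse ds) Y i ⟩
  coeff Y i xor ⨁ (λ d → coeff Y (i + d)) (reverse ds)    ≡⟨ cong (coeff Y i xor_) (⨁-↭ (λ d → coeff Y (i + d)) (↭-reverse ds)) ⟩
  coeff Y i xor ⨁ (λ d → coeff Y (i + d)) ds              ≡⟨ coeff-applyStage ds Y i ⟨
  coeff (applyStage ds Y) i                               ∎
  where open ≡-Reasoning

All-reverse : ∀ {P : ℕ → Set} xs → All P xs → All P (reverse xs)
All-reverse xs p = All-resp-↭ (↭-sym (↭-reverse xs)) p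

recs-setRecs : ∀ {W} (σ : Store W) a xs → recs (setRecs σ a xs) a ≡ xs
recs-setRecs σ support     xs = refl
recs-setRecs σ stages      xs = refl
recs-setRecs σ feedback    xs = refl
recs-setRecs σ assembly    xs = refl
recs-setRecs σ descriptors xs = refl

sum-affine : ∀ α β (f : ℕ → ℕ) N → sum (map (λ k → α + β * f k) (upTo N)) ≡ N * α + β * sum (map f (upTo N))
sum-affine α β f zero    = sym (*-zeroʳ β)
sum-affine α β f (suc N) = begin
  sum (map (λ k → α + β * f k) (upTo (suc N)))                      ≡⟨ sum-upTo-suc (λ k → α + β * f k) N ⟩
  α + β * f 0 + sum (map (λ k → α + β * f (suc k)) (upTo N))        ≡⟨ cong (α + β * f 0 +_) (sum-affine α β (f ∘ suc) N) ⟩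
  α + β * f 0 + (N * α + β * sum (map (f ∘ suc) (upTo N)))          ≡⟨ solve 5 (λ α β x y z → α ⊞ β ⊠ x ⊞ (y ⊞ β ⊠ z) ⊜ α ⊞ y ⊞ β ⊠ (x ⊞ z)) refl α β (f 0) (N * α) (sum (map (f ∘ suc) (upTo N))) ⟩
  suc N * α + β * (f 0 + sum (map (f ∘ suc) (upTo N)))              ≡⟨ cong (λ z → suc N * α + β * z) (sum-upTo-suc f N) ⟨
  suc N * α + β * sum (map f (upTo (suc N)))                        ∎
  where
  open ≡-Reasoning

sum-+ : ∀ (f g : ℕ → ℕ) N → sum (map (λ k → f k + g k) (upTo N)) ≡ sum (map f (upTo N)) + sum (map g (upTo N))
sum-+ f g zero    = refl
sum-+ f g (suc N) = begin
  sum (map (λ k → f k + g k) (upTo (suc N)))                        ≡⟨ sum-upTo-suc (λ k → f k + g k) N ⟩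
  f 0 + g 0 + sum (map (λ k → f (suc k) + g (suc k)) (upTo N))      ≡⟨ cong (f 0 + g 0 +_) (sum-+ (f ∘ suc) (g ∘ suc) N) ⟩
  f 0 + g 0 + (F + G)                                               ≡⟨ +-interchange (f 0) (g 0) F G ⟩
  f 0 + F + (g 0 + G)                                               ≡⟨ cong₂ _+_ (sum-upTo-suc f N) (sum-upTo-suc g N) ⟨
  sum (map f (upTo (suc N))) + sum (map g (upTo (suc N)))           ∎
  where
  open ≡-Reasoning
  F = sum (map (f ∘ suc) (upTo N))
  G = sum (map (g ∘ suc) (upTo N))

sum-upTo-snoc : ∀ (f : ℕ → ℕ) N → sum (map f (upTo (suc N))) ≡ sum (map f (upTo N)) + f N
sum-upTo-snoc f N = begin
  sum (map f (upTo (suc N)))                 ≡⟨ cong (λ xs → sum (map f xs)) (upTo-∷ʳ N) ⟨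
  sum (map f (upTo N ++ N ∷ []))             ≡⟨ cong sum (map-++ f (upTo N) (N ∷ [])) ⟩
  sum (map f (upTo N) ++ f N ∷ [])           ≡⟨ sum-++ (map f (upTo N)) _ ⟩
  sum (map f (upTo N)) + (f N + 0)           ≡⟨ cong (sum (map f (upTo N)) +_) (+-identityʳ (f N)) ⟩
  sum (map f (upTo N)) + f N                 ∎
  where open ≡-Reasoning

pred-∸< : ∀ {i c} → i < c → c ∸ 1 ∸ i < c
pred-∸< {i} {suc c} _ = s≤s (m∸n≤m c i)

-- Generating the descriptors of one stage

module Schedule {m : ℕ} (1≤m : 1 ≤ m) (w : ℕ) {T : List ℕ} (T↗ : Linked _<_ T) (T<m : All (_< m) T) where

  open Reduction 1≤m w

  s r : ℕ
  s = length T
  r = stageCount m T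

  count : ℕ → ℕ
  count k = length (active m T k)

  s≤m : s ≤ m
  s≤m = length-support T↗ T<m

  count≤s : ∀ k → count k ≤ s
  count≤s k = length-filter _ T

  length-shifts : ∀ k → length (shifts m T k) ≡ count k
  length-shifts k = length-map _ (active m T k)

  length-reverse-shifts : ∀ k → length (reverse (shifts m T k)) ≡ count k
  length-reverse-shifts k = trans (length-reverse (shifts m T k)) (length-shifts k)

  shifts<m : ∀ k → All (_< m) (shifts m T k)
  shifts<m k = map⁺ (all-filter (λ t → 2 ^ k * (m ∸ t) <? m) T)

  s≤κ : s ≤ κ
  s≤κ = within₁ (≤-trans s≤m m≤B)

  record Support (σ : Store W) : Set where
    field
      M≡       : regs σ rM ≡ m
      S≡       : regs σ rS ≡ s
      support≡ : recs σ support ≡ T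
      room     : length (recs σ descriptors) ≡ s

  open Support public

  -- The situation once the descriptors of stage `k` are in place. The table is reversed because the
  -- scan runs from the end of `T`; `k = r` is included and has an empty table.
  record Scan (k : ℕ) (σ : Store W) : Set where
    field
      supported : Support σ
      pow≡      : regs σ rPow ≡ 2 ^ k
      count≡    : regs σ rCount ≡ count k
      table     : Segment (recs σ descriptors) 0 (reverse (shifts m T k))

  open Scan public

  scanBody : Cmd
  scanBody =
    rShift ≔ $ rPow :* ($ rM :- support at ($ rS :- lit 1 :- $ rCount)) ⨾
    ifLt ($ rShift) ($ rM)
      (descriptors [ $ rCount ]≔ $ rShift ⨾ rCount ≔ $ rCount :+ lit 1)
      (rLim ≔ $ rCount)

  module _ {k : ℕ} (k≤r : k ≤ r) where

    private
      c : ℕ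
      c = count k
      U : List ℕ
      U = proj₁ (active-suffix {m} k T↗)
      T≡ : T ≡ U ++ active m T k
      T≡ = proj₁ (proj₂ (active-suffix {m} k T↗))
      s≡ : s ≡ length U + c
      s≡ = trans (cong length T≡) (length-++ U)

      new : ℕ → ℕ
      new = get 0 (reverse (shifts m T k))

      -- Counted from the end, `T` and its active suffix have the same entries, and reversing turns
      -- counting from the end into counting from the start.
      scan-active : ∀ {i} → i < c → 2 ^ k * (m ∸ get 0 T (s ∸ 1 ∸ i)) ≡ new i
      scan-active {i} i<c = sym (begin
        get 0 (reverse (shifts m T k)) i           ≡⟨ get-reverse (shifts m T k) (subst (i <_) (sym (length-shifts k)) i<c) ⟩
        get 0 (shifts m T k) (length (shifts m T k) ∸ 1 ∸ i) ≡⟨ cong (λ l → get 0 (shifts m T k) (l ∸ 1 ∸ i)) (length-shifts k) ⟩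
        get 0 (shifts m T k) (c ∸ 1 ∸ i)           ≡⟨ get-map (λ t → 2 ^ k * (m ∸ t)) (active m T k) (pred-∸< i<c) ⟩
        2 ^ k * (m ∸ get 0 (active m T k) (c ∸ 1 ∸ i)) ≡⟨ cong (λ t → 2 ^ k * (m ∸ t)) (get-++ʳ U (c ∸ 1 ∸ i)) ⟨
        2 ^ k * (m ∸ get 0 (U ++ active m T k) (length U + (c ∸ 1 ∸ i)))
          ≡⟨ cong₂ (λ xs l → 2 ^ k * (m ∸ get 0 xs l)) T≡ (trans (cong (λ l → l ∸ 1 ∸ i) s≡) (+-pred-∸ (length U) i<c)) ⟨
        2 ^ k * (m ∸ get 0 T (s ∸ 1 ∸ i))          ∎)
        where
        open ≡-Reasoning
        +-pred-∸ : ∀ l {i c} → i < c → l + c ∸ 1 ∸ i ≡ l + (c ∸ 1 ∸ i)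
        +-pred-∸ l {i} {suc c} (s≤s i≤c) = trans (cong (λ x → x ∸ 1 ∸ i) (+-suc l c)) (+-∸-assoc l i≤c)

      new<m : ∀ {i} → i < c → new i < m
      new<m i<c = get-All (All-reverse _ (shifts<m k)) (subst (_ <_) (sym (length-reverse-shifts k)) i<c)

      -- The entry just before the active suffix is the last one of the inactive prefix, which is
      -- nonempty because `c < s`.
      scan-inactive : c < s → m ≤ 2 ^ k * (m ∸ get 0 T (s ∸ 1 ∸ c))
      scan-inactive c<s = subst (λ t → m ≤ 2 ^ k * (m ∸ t))
        (sym (trans (cong₂ (get 0) T≡ (trans (cong (λ l → l ∸ 1 ∸ c) s≡) (last (length U)))) (get-++ˡ U (pred< 0<U))))
        (≮⇒≥ (get-All (proj₂ (proj₂ (active-suffix {m} k T↗))) (pred< 0<U)))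
        where
        0<U : 0 < length U
        0<U = +-cancelʳ-< c 0 (length U) (subst (c <_) s≡ c<s)
        pred< : ∀ {l} → 0 < l → l ∸ 1 < l
        pred< {suc l} _ = n<1+n l
        last : ∀ l → l + c ∸ 1 ∸ c ≡ l ∸ 1
        last zero    = trans (∸-+-assoc c 1 c) (m≤n⇒m∸n≡0 (m≤n+m c 1))
        last (suc l) = m+n∸n≡m l c

      record Progress (i : ℕ) (σ : Store W) : Set where
        field
          sup   : Support σ
          pow   : regs σ rPow ≡ 2 ^ k
          index : regs σ rCount ≡ i
          lim   : regs σ rLim ≡ s
          done  : Filled 0 i new (recs σ descriptors)

      open Progress

      shiftᵉ : ∀ {i σ} → i < s → Progress i σ →
        Evaluates κ σ ($ rPow :* ($ rM :- support at ($ rS :- lit 1 :- $ rCount))) (2 ^ k * (m ∸ get 0 T (s ∸ 1 ∸ i)))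
      shiftᵉ {i} {σ} i<s p = timesᵉ (regᵉ (pow p)) (minusᵉ (regᵉ (M≡ (sup p)))
        (atᵉ (minusᵉ (minusᵉ (regᵉ (S≡ (sup p))) litᵉ) (regᵉ (index p)))
             (subst (λ xs → s ∸ 1 ∸ i < length xs) (sym (support≡ (sup p))) (pred-∸< i<s))
             (cong (λ xs → get 0 xs (s ∸ 1 ∸ i)) (support≡ (sup p)))))
        (within* (2^≤2*m 1≤m T<m k≤r) (m∸n≤m m (get 0 T (s ∸ 1 ∸ i))))

      scanned : ∀ {σ} → Support σ → regs σ rPow ≡ 2 ^ k → regs σ rCount ≡ c →
        Filled 0 c new (recs σ descriptors) → Scan k σ
      scanned {σ} sp pow≡ count≡ done = record
        { supported = sp ; pow≡ = pow≡ ; count≡ = count≡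
        ; table = subst₂ _≤_ (sym (length-reverse-shifts k)) (sym (room sp)) (count≤s k) ,
                  λ {i} i< → done (subst (i <_) (length-reverse-shifts k) i<)
        }

      loop : ∀ {σ} → Progress 0 σ → Halts κ (whileLt ($ rCount) ($ rLim) scanBody) σ
        (λ σ′ u → Scan k σ′ × measure total u ≤ sum (map (λ _ → 24) (upTo c)) + 22)
      -- A recorded shift costs 24: the guard 3, the computation of the shift 11, the test 3,
      -- storing and counting 7. The other constant, 22, covers the iteration that meets an inactive
      -- exponent together with the final guard.
      loop = halts-while total {Q = Scan k} c Progress (λ _ → 24)
        (λ {i} {σ} i<c p →
          let i<s = ≤-trans i<c (count≤s k)
              i< = subst (i <_) (sym (room (sup p))) i<s
          in i , s , regᵉ (index p) , regᵉ (lim p) , i<s , _ , _ ,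
             seq (runAssign (shiftᵉ i<s p))
               (runThen (regᵉ (scan-active i<c)) (regᵉ (M≡ (sup p))) (new<m i<c)
                 (seq (runWrite (regᵉ (index p)) (regᵉ (scan-active i<c)) i<)
                      (runAssign (plusᵉ (regᵉ (index p)) litᵉ (subst (_≤ κ) (+-comm 1 i) (≤-trans i<s s≤κ)))))) ,
             record
               { sup = record { M≡ = M≡ (sup p) ; S≡ = S≡ (sup p) ; support≡ = support≡ (sup p)
                              ; room = trans (length-put (recs σ descriptors) i _) (room (sup p)) }
               ; pow = pow p ; index = +-comm i 1 ; lim = lim p
               ; done = filled-put 0 {i} {new} {recs σ descriptors} i< (done p)
               } ,
             ≤-refl)
        (λ {σ} p → finish p)
        where
        -- If all of `T` is active, the guard fails at once. Otherwise one further iteration finds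
        -- an inactive exponent and lowers `rLim` to the count.
        finish : ∀ {σ} → Progress c σ → Halts κ (whileLt ($ rCount) ($ rLim) scanBody) σ (λ σ′ u → Scan k σ′ × measure total u ≤ 22)
        finish {σ} p with <-≤-connex c s
        ... | inj₂ s≤c = _ , _ , runStop (regᵉ (index p)) (regᵉ (lim p)) s≤c ,
          scanned (sup p) (pow p) (index p) (done p) , s≤s (s≤s (s≤s z≤n))
        ... | inj₁ c<s = _ , _ ,
          runAgain (regᵉ (index p)) (regᵉ (lim p)) c<s
            (seq (runAssign (shiftᵉ c<s p)) (runElse (regᵉ refl) (regᵉ (M≡ (sup p))) (scan-inactive c<s)
              (runAssign (regᵉ (index p)))))
            (runStop (regᵉ (index p)) (regᵉ refl) ≤-refl) ,
          scanned (record { M≡ = M≡ (sup p) ; S≡ = S≡ (sup p) ; support≡ = support≡ (sup p) ; room = room (sup p) })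
            (pow p) (index p) (done p) , ≤-refl

    halts-stageDescriptors : ∀ {σ} → Support σ → regs σ rPow ≡ 2 ^ k →
      Halts κ stageDescriptors σ (λ σ′ u → Scan k σ′ × measure total u ≤ 26 + 24 * count k)
    halts-stageDescriptors {σ} sp pow≡ =
      let σ′ , u , rs , scan , u≤ = loop {setReg (setReg σ rCount 0) rLim s} (record
            { sup = record { M≡ = M≡ sp ; S≡ = S≡ sp ; support≡ = support≡ sp ; room = room sp }
            ; pow = pow≡ ; index = refl ; lim = refl ; done = λ () })
      in σ′ , _ , seq (runAssign litᵉ) (seq (runAssign (regᵉ (S≡ sp))) rs) , scan , (begin
        2 + (2 + ops u) + genOps u                  ≡⟨⟩
        4 + (ops u + genOps u)                      ≤⟨ +-monoʳ-≤ 4 u≤ ⟩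
        4 + (sum (map (λ _ → 24) (upTo c)) + 22)    ≡⟨ cong (λ x → 4 + (x + 22)) (trans (sum-const 24 c) (*-comm c 24)) ⟩
        4 + (24 * c + 22)                           ≡⟨ cong (4 +_) (+-comm (24 * c) 22) ⟩
        26 + 24 * c                                 ∎)
      where open ≤-Reasoning

-- Pieces of `reduceOnline`, named so that the plan builder can drive the same scan with other loop
-- bodies.
startScan nextScan : Cmd
startScan = generate (allocRecs descriptors ($ rS) ⨾ rPow ≔ lit 1 ⨾ stageDescriptors)
nextScan  = generate (rPow ≔ $ rPow :* lit 2 ⨾ stageDescriptors)

scanLoop : Cmd → Cmd
scanLoop c = whileLt (lit 0) ($ rCount) (c ⨾ nextScan)

copySupport : RecArray → Cmd
copySupport a = for rI ($ rS) (a [ $ rI ]≔ support at $ rI)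

-- A record, so that the usage can be recovered from the type when bounds are chained; the bare
-- inequality would unfold into its components.
record Costs (M : Measure) (u : Usage) (a : ℕ) : Set where
  constructor costs
  field
    cost≤ : measure M u ≤ a

open Costs public

costing : ∀ M u {a} → measure M u ≤ a → Costs M u a
costing M u = costs

infixr 6 _⊹≤_

_⊹≤_ : ∀ {M u v a b} → Costs M u a → Costs M v b → Costs M (u ⊹ v) (a + b)
_⊹≤_ {M} {u} {v} (costs u≤) (costs v≤) = costs (≤-trans (measure-⊹ M u v) (+-mono-≤ u≤ v≤))

sum-bounded : ∀ {f : ℕ → ℕ} {b} → (∀ k → f k ≤ b) → ∀ N → sum (map f (upTo N)) ≤ N * b
sum-bounded     f≤ zero    = z≤n
sum-bounded {f} f≤ (suc N) = ≤-trans (≤-reflexive (sum-upTo-suc f N)) (+-mono-≤ (f≤ 0) (sum-bounded (f≤ ∘ suc) N))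

-- The loop over all stages

module Scanning {m : ℕ} (1≤m : 1 ≤ m) (w : ℕ) {T : List ℕ} (T↗ : Linked _<_ T) (T<m : All (_< m) T) where

  open Reduction 1≤m w public
  open Schedule 1≤m w T↗ T<m public

  S : ℕ
  S = feedbackCount m T

  count-r : count r ≡ 0
  count-r = cong length (active-last 1≤m T<m)

  -- Iteration `k` of the stage loop generates the descriptors of stage `k + 1`. The shifted sum
  -- loses stage 0 and gains only stage `r`, which is empty.
  count-shifted : sum (map (count ∘ suc) (upTo r)) ≤ S
  count-shifted = begin
    sum (map (count ∘ suc) (upTo r))              ≤⟨ m≤n+m _ (count 0) ⟩
    count 0 + sum (map (count ∘ suc) (upTo r))    ≡⟨ sum-upTo-suc count r ⟨
    sum (map count (upTo (suc r)))                ≡⟨ sum-upTo-snoc count r ⟩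
    S + count r                                   ≡⟨ cong (S +_) count-r ⟩
    S + 0                                         ≡⟨ +-identityʳ S ⟩
    S                                             ∎
    where open ≤-Reasoning

  r≤m : r ≤ m
  r≤m = stageCount≤ 1≤m T<m

  r≤κ : r ≤ κ
  r≤κ = within₁ (≤-trans r≤m m≤B)

  -- There are at most `s` shifts in each of `r` stages, and both numbers are at most `m`.
  S≤κ : S ≤ κ
  S≤κ = ≤-trans (sum-bounded count≤s r) (within* (≤-trans r≤m (m≤n*m m 2)) s≤m)

  -- Stage 0 is scanned before the loop, and its descriptors are charged to `s`: 24 for each,
  -- besides one operation per allocated cell.
  halts-startScan : ∀ {σ} → regs σ rM ≡ m → regs σ rS ≡ s → recs σ support ≡ T →
    Halts κ startScan σ (λ σ′ u → Scan 0 σ′ × measure total u ≤ 30 + 25 * s × allocdRecs u ≡ s × allocdWords u ≡ 0)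
  halts-startScan {σ} M≡ S≡ support≡ =
    let σ′ , u , rs , scan , u≤ = halts-stageDescriptors z≤n {σ₁} (record { M≡ = M≡ ; S≡ = S≡ ; support≡ = support≡ ; room = length-replicate s }) refl
        words0 , recs0 = unused rs allocation refl
    in σ′ , _ , generate (seq (runAllocRecs (regᵉ S≡)) (seq (runAssign litᵉ) rs)) , scan ,
       (begin
         2 + s + (2 + ops u) + genOps u    ≡⟨ solve 3 (λ s a b → con 2 ⊞ s ⊞ (con 2 ⊞ a) ⊞ b ⊜ con 4 ⊞ s ⊞ (a ⊞ b)) refl s (ops u) (genOps u) ⟩
         4 + s + (ops u + genOps u)        ≤⟨ +-monoʳ-≤ (4 + s) (≤-trans u≤ (+-monoʳ-≤ 26 (*-monoʳ-≤ 24 (count≤s 0)))) ⟩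
         4 + s + (26 + 24 * s)             ≡⟨ solve 1 (λ s → con 4 ⊞ s ⊞ (con 26 ⊞ con 24 ⊠ s) ⊜ con 30 ⊞ con 25 ⊠ s) refl s ⟩
         30 + 25 * s                       ∎) ,
       trans (cong (s +_) recs0) (+-identityʳ s) , words0
    where
    open ≤-Reasoning
    σ₁ : Store W
    σ₁ = setReg (setRecs σ descriptors (replicate s 0)) rPow 1

  halts-nextScan : ∀ {k σ} → k < r → Support σ → regs σ rPow ≡ 2 ^ k →
    Halts κ nextScan σ (λ σ′ u → Scan (suc k) σ′ × measure total u ≤ 30 + 24 * count (suc k))
  halts-nextScan {k} {σ} k<r sp pow≡ =
    let σ′ , u , rs , scan , u≤ = halts-stageDescriptors k<r {setReg σ rPow (2 ^ k * 2)}
          (record { M≡ = M≡ sp ; S≡ = S≡ sp ; support≡ = support≡ sp ; room = room sp }) (*-comm (2 ^ k) 2)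
    in σ′ , _ , generate (seq (runAssign (timesᵉ (regᵉ pow≡) litᵉ doubled≤κ)) rs) , scan , +-monoʳ-≤ 4 u≤
    where
    open ≤-Reasoning
    doubled≤κ : 2 ^ k * 2 ≤ κ
    doubled≤κ = within (begin
      2 ^ k * 2    ≡⟨ *-comm (2 ^ k) 2 ⟩
      2 ^ suc k    ≤⟨ 2^≤2*m 1≤m T<m k<r ⟩
      2 * m        ≤⟨ *-mono-≤ {2} {4} (s≤s (s≤s z≤n)) m≤B ⟩
      4 * (m + W)  ∎)

  scanning : List Resource
  scanning = register rM ∷ register rS ∷ register rPow ∷ recordArray support ∷ allocation ∷ []

  -- One rule for three bodies: counting a stage, recording it, applying it. The body pays
  -- `α + β * count k` under `M`. The scan pays at most 30 and 24 per shift under every measure, and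
  -- the guard 3, whence 33 and `β + 24`.
  halts-scanLoop : (M : Measure) {c : Cmd} → Untouched c scanning → (P : ℕ → Store W → Set) (α β : ℕ) →
    (∀ {k σ} → k < r → Scan k σ → P k σ → Halts κ c σ (λ σ′ u → P (suc k) σ′ × measure M u ≤ α + β * count k)) →
    (∀ {k σ σ′} → Frame nextScan σ σ′ → P k σ → P k σ′) →
    ∀ {σ} → Scan 0 σ → P 0 σ →
    Halts κ (scanLoop c) σ (λ σ′ u → (Scan r σ′ × P r σ′) × measure M u ≤ 3 + r * (33 + α) + (β + 24) * S)
  halts-scanLoop M {c} (m∉ ∷ s∉ ∷ pow∉ ∷ support∉ ∷ alloc∉ ∷ []) P α β step stable scan₀ P₀ =
    let σ′ , u , rs , post , u≤ = loop in σ′ , u , rs , post , ≤-trans u≤ totals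
    where
    open ≤-Reasoning
    cost′ : ℕ → ℕ
    cost′ k = (33 + α + β * count k) + (0 + 24 * count (suc k))
    loop = halts-while M {Q = λ σ → Scan r σ × P r σ} {d = 3} r (λ k σ → Scan k σ × P k σ) cost′
      (λ {k} {σ} k<r (scan , Pk) →
        let σ₁ , u₁ , r₁ , P₁ , u₁≤ = step k<r scan Pk
            sp = supported scan
            σ₂ , u₂ , r₂ , scan₂ , u₂≤ = halts-nextScan k<r (record
                 { M≡ = trans (unchanged r₁ (register rM) m∉) (M≡ sp)
                 ; S≡ = trans (unchanged r₁ (register rS) s∉) (S≡ sp)
                 ; support≡ = trans (unchanged r₁ (recordArray support) support∉) (support≡ sp)
                 ; room = trans (proj₁ (unchanged r₁ allocation alloc∉) descriptors) (room sp) })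
                 (trans (unchanged r₁ (register rPow) pow∉) (pow≡ scan))
        in 0 , count k , litᵉ , regᵉ (count≡ scan) , active-some 1≤m T<m k<r ,
           σ₂ , _ , seq r₁ r₂ , (scan₂ , stable (frameOf r₂) P₁) ,
           (begin
             3 + measure M (u₁ ⊹ u₂)                              ≤⟨ +-monoʳ-≤ 3 (cost≤ (costing M u₁ u₁≤ ⊹≤ costing M u₂ (≤-trans (measure-≤ M u₂) u₂≤))) ⟩
             3 + (α + β * count k + (30 + 24 * count (suc k)))
               ≡⟨ solve 3 (λ a b c → con 3 ⊞ (a ⊞ b ⊞ (con 30 ⊞ c)) ⊜ (con 33 ⊞ a ⊞ b) ⊞ (con 0 ⊞ c)) refl α (β * count k) (24 * count (suc k)) ⟩
             cost′ k                                              ∎))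
      (λ (scan , Pr) → _ , _ , runStop litᵉ (regᵉ (count≡ scan)) (≤-reflexive count-r) , (scan , Pr) , measure-cost M 3)
      (scan₀ , P₀)
    totals : sum (map cost′ (upTo r)) + 3 ≤ 3 + r * (33 + α) + (β + 24) * S
    totals = begin
      sum (map cost′ (upTo r)) + 3
        ≡⟨ cong (_+ 3) (trans (sum-+ (λ k → 33 + α + β * count k) (λ k → 0 + 24 * count (suc k)) r)
             (cong₂ _+_ (sum-affine (33 + α) β count r) (sum-affine 0 24 (count ∘ suc) r))) ⟩
      r * (33 + α) + β * S + (r * 0 + 24 * sum (map (count ∘ suc) (upTo r))) + 3
        ≤⟨ +-monoˡ-≤ 3 (+-monoʳ-≤ (r * (33 + α) + β * S) (+-mono-≤ (≤-reflexive (*-zeroʳ r)) (*-monoʳ-≤ 24 count-shifted))) ⟩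
      r * (33 + α) + β * S + 24 * S + 3
        ≡⟨ solve 3 (λ x b s → x ⊞ b ⊠ s ⊞ con 24 ⊠ s ⊞ con 3 ⊜ con 3 ⊞ x ⊞ (b ⊞ con 24) ⊠ s) refl (r * (33 + α)) β S ⟩
      3 + r * (33 + α) + (β + 24) * S ∎

  halts-copySupport : ∀ a {σ} → sameRec a support ≡ false → regs σ rS ≡ s → recs σ support ≡ T → length (recs σ a) ≡ s →
    Halts κ (copySupport a) σ (λ σ′ u → recs σ′ a ≡ T × measure total u ≤ 5 + s * 11)
  halts-copySupport a {σ} a≢ S≡ support≡ len≡ =
    let σ′ , u , rs , (len′ , below) , u≤ = loop
    in σ′ , u , rs , get-ext {z = 0} _ _ len′ (λ {i} i< → below (subst (i <_) len′ i<)) , u≤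
    where
    Inv : ℕ → Store W → Set
    Inv i τ = length (recs τ a) ≡ s × Filled 0 i (get 0 T) (recs τ a)
    support∉ : touches (recordArray support) (copySupport a) ≡ false
    support∉ rewrite a≢ = refl
    loop = halts-for total {y = rS} s s≤κ Inv 4 {σ} refl refl S≡
      (λ {i} {τ} i<s I≡ fr (len , filled) →
        let sup′ = trans (preserves fr (recordArray support) support∉) support≡
            i< = subst (i <_) (sym len) i<s
        in _ , _ ,
           runWrite (regᵉ I≡) (atᵉ (regᵉ I≡) (subst (λ xs → i < length xs) (sym sup′) i<s) (cong (λ xs → get 0 xs i) sup′)) i< ,
           (subst (λ xs → length xs ≡ s × Filled 0 (suc i) (get 0 T) xs)
             (sym (recs-setRecs τ a (put (recs τ a) i (get 0 T i))))
             (trans (length-put (recs τ a) i _) len , filled-put 0 {new = get 0 T} {recs τ a} i< filled)) ,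
           ≤-refl)
      (len≡ , λ ())

vecOf : ∀ {A : Set} {n} (xs : List A) → length xs ≡ n → Σ[ v ∈ Vec A n ] toList v ≡ xs
vecOf xs refl = Vec.fromList xs , toList∘fromList xs

-- Reduction with a stored plan

module Plans {m : ℕ} (1≤m : 1 ≤ m) (w : ℕ) {T : List ℕ} (T↗ : Linked _<_ T) (T<m : All (_< m) T) where

  open Scanning 1≤m w T↗ T<m public

  private
    length-tail : ∀ v → n + length (scratchTail {W} v) ≡ extent v n
    length-tail guarded  = +-identityʳ n
    length-tail sentinel = refl

    get-tail : ∀ v k → get zeros (scratchTail {W} v) k ≡ zeros
    get-tail guarded  _       = refl
    get-tail sentinel zero    = refl
    get-tail sentinel (suc k) = refl

    scratch-beyond : ∀ v (xs : List (Word W)) → length xs ≡ n → ∀ {i} → n ≤ i → get zeros (xs ++ scratchTail v) i ≡ zeros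
    scratch-beyond v xs len {i} n≤i = begin
      get zeros (xs ++ scratchTail v) i                       ≡⟨ cong (get zeros (xs ++ scratchTail v)) (m+[n∸m]≡n n≤i) ⟨
      get zeros (xs ++ scratchTail v) (n + (i ∸ n))           ≡⟨ cong (λ l → get zeros (xs ++ scratchTail v) (l + (i ∸ n))) len ⟨
      get zeros (xs ++ scratchTail v) (length xs + (i ∸ n))   ≡⟨ get-++ʳ xs (i ∸ n) ⟩
      get zeros (scratchTail v) (i ∸ n)                       ≡⟨ get-tail v (i ∸ n) ⟩
      zeros                                                   ∎
      where open ≡-Reasoning

    length-scratch : ∀ v (xs : List (Word W)) → length xs ≡ n → length (xs ++ scratchTail v) ≡ extent v n
    length-scratch v xs len = trans (length-++ xs) (trans (cong (_+ length (scratchTail {W} v)) len) (length-tail v))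

  holds-scratch : ∀ v (Y : Vec Bool m) {σ} → Holds v Y σ → words σ scratch ≡ pack W Y ++ scratchTail v
  holds-scratch v Y {σ} (len , cells) = get-ext {z = zeros} _ _
    (trans len (sym (length-scratch v (pack W Y) (length-pack Y))))
    (λ {i} _ → trans (cells i) (sym (packed i)))
    where
    packed : ∀ i → get zeros (pack W Y ++ scratchTail v) i ≡ wordAt W (coeff Y) i
    packed i with <-≤-connex i n
    ... | inj₁ i<n = trans (get-++ˡ (pack W Y) (subst (i <_) (sym (length-pack Y)) i<n)) (get-pack Y i)
    ... | inj₂ n≤i = trans (scratch-beyond v (pack W Y) (length-pack Y) n≤i) (sym (wordAt-beyond Y n≤i))

  record PlanRegs (σ : Store W) : Set where
    field
      m≡ : regs σ rM ≡ m
      w≡ : regs σ rW ≡ W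
      s≡ : regs σ rS ≡ s
      r≡ : regs σ rR ≡ r

  planRegs : ∀ {σ} → HoldsPlan (planFor W m T) σ → PlanRegs σ
  planRegs (eq , _) = record
    { m≡ = cong Vec.head eq
    ; w≡ = cong (Vec.head ∘ Vec.tail) eq
    ; s≡ = cong (Vec.head ∘ Vec.tail ∘ Vec.tail) eq
    ; r≡ = cong (Vec.head ∘ Vec.tail ∘ Vec.tail ∘ Vec.tail) eq
    }

  planMetadata : ∀ {σ} → PlanRegs σ → Vec.map (regs σ) (rM ∷ rW ∷ rS ∷ rR ∷ []) ≡ metadata (planFor W m T)
  planMetadata p = cong₂ _∷_ m≡ (cong₂ _∷_ w≡ (cong₂ _∷_ s≡ (cong₂ _∷_ r≡ refl)))
    where open PlanRegs p

  private
    extentᵉ : ∀ v {σ : Store W} → regs σ rN ≡ n → Evaluates κ σ (scratchExtent v) (extent v n)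
    extentᵉ guarded  N≡ = regᵉ N≡
    extentᵉ sentinel N≡ = plusᵉ (regᵉ N≡) litᵉ (within₂ (≤-trans n≤m m≤B) 1≤B)

    replicate-extent : ∀ v → replicate (extent v n) (zeros {W}) ≡ toList (Vec.replicate n (zeros {W})) ++ scratchTail v
    replicate-extent v = get-ext {z = zeros} _ _
      (trans (length-replicate (extent v n)) (sym (length-scratch v (toList (Vec.replicate n zeros)) (length-toList (Vec.replicate n zeros)))))
      (λ {i} _ → trans (get-replicate (extent v n) i) (sym (vanish i)))
      where
      toList-replicate : ∀ k i → get (zeros {W}) (toList (Vec.replicate k zeros)) i ≡ zeros
      toList-replicate zero    i       = refl
      toList-replicate (suc k) zero    = refl
      toList-replicate (suc k) (suc i) = toList-replicate k i
      vanish : ∀ i → get zeros (toList (Vec.replicate n zeros) ++ scratchTail v) i ≡ zeros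
      vanish i with <-≤-connex i n
      ... | inj₁ i<n = trans (get-++ˡ (toList (Vec.replicate n zeros)) (subst (i <_) (sym (length-toList (Vec.replicate n (zeros {W})))) i<n)) (toList-replicate n i)
      ... | inj₂ n≤i = scratch-beyond v (toList (Vec.replicate n zeros)) (length-toList (Vec.replicate n zeros)) n≤i

  runSetup : ∀ v {σ : Store W} → regs σ rM ≡ m → regs σ rW ≡ W →
    Run κ (setup v) σ (setWords (setReg σ rN n) scratch (replicate (extent v n) zeros))
      (cost 8 ⊹ usage (1 + size (scratchExtent v) + extent v n) 0 0 (extent v n))
  runSetup v M≡ W≡ = seq
    (runAssign (divᵉ (plusᵉ (regᵉ M≡) (minusᵉ (regᵉ W≡) litᵉ) (within₂ m≤B (≤-trans (n≤1+n w) (m≤n+m W m)))) (regᵉ W≡) z<s))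
    (runAllocWords (extentᵉ v refl))

  setupAllocates : ∀ v → SetupAllocates W v m T (extent v n)
  setupAllocates v σ holds =
    _ , _ , runSetup v {σ} (PlanRegs.m≡ p) (PlanRegs.w≡ p) ,
    (holds , refl , Vec.replicate n zeros , replicate-extent v) , length-replicate (extent v n) , refl , refl
    where p = planRegs {σ} holds

  F : List ℕ
  F = feedbackRecords (planFor W m T)

  off : ℕ → ℕ
  off = offset (shifts m T)

  off-suc : ∀ k → off (suc k) ≡ off k + count k
  off-suc k = trans (offset-suc (shifts m T) k) (cong (off k +_) (length-shifts k))

  length-F : length F ≡ S
  length-F = trans (offset-sum (shifts m T) r) (cong sum (map-cong length-shifts (upTo r)))

  off+count≤S : ∀ {k} → k < r → off k + count k ≤ S
  off+count≤S {k} k<r = subst₂ _≤_ (cong (off k +_) (length-shifts k)) length-F (proj₁ (segment-concatMap (shifts m T) k<r))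

  get-stages : ∀ {k} → k < r → get 0 (stageRecords (planFor W m T)) k ≡ count k
  get-stages = get-map-upTo count

  length-stages : length (stageRecords (planFor W m T)) ≡ r
  length-stages = trans (length-map count (upTo r)) (length-upTo r)

  planStage planLoop : Variant → Cmd
  planStage v = rCount ≔ stages at $ rK ⨾ stageInPlace v feedback ($ rBase) ($ rCount) ⨾ rBase ≔ $ rBase :+ $ rCount
  planLoop v  = for rK ($ rR) (planStage v)

  -- The variants differ only in a test, which writes nothing.
  private
    planStage-variant : ∀ v t → touches t (planStage v) ≡ touches t (planStage sentinel)
    planStage-variant sentinel t               = refl
    planStage-variant guarded  (register x)    = refl
    planStage-variant guarded  (recordArray a) = refl
    planStage-variant guarded  (wordArray a)   = refl
    planStage-variant guarded  allocation      = refl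
    planStage-variant guarded  generation      = refl

    planLoop-variant : ∀ v t → touches t (planLoop v) ≡ touches t (planLoop sentinel)
    planLoop-variant sentinel t               = refl
    planLoop-variant guarded  (register x)    = refl
    planLoop-variant guarded  (recordArray a) = refl
    planLoop-variant guarded  (wordArray a)   = refl
    planLoop-variant guarded  allocation      = refl
    planLoop-variant guarded  generation      = refl

    reduce-variant : ∀ v t → touches t (reduceWithPlan v) ≡ touches t (reduceWithPlan sentinel)
    reduce-variant sentinel t               = refl
    reduce-variant guarded  (register x)    = refl
    reduce-variant guarded  (recordArray a) = refl
    reduce-variant guarded  (wordArray a)   = refl
    reduce-variant guarded  allocation      = refl
    reduce-variant guarded  generation      = refl

  record StageTables (σ : Store W) : Set where
    field
      N≡        : regs σ rN ≡ n
      W≡        : regs σ rW ≡ W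
      R≡        : regs σ rR ≡ r
      stages≡   : recs σ stages ≡ stageRecords (planFor W m T)
      feedback≡ : recs σ feedback ≡ F

  halts-planStage : ∀ v {Y k σ} → k < r → regs σ rK ≡ k → StageTables σ → regs σ rBase ≡ off k → Holds v Y σ →
    Halts κ (planStage v) σ (λ σ′ _ → regs σ′ rBase ≡ off (suc k) × Holds v (applyStage (shifts m T k) Y) σ′)
  halts-planStage v {Y} {k} {σ} k<r K≡ tables base≡ held =
    after (stage ctx held) λ {σ₂} rs held₂ →
    setReg σ₂ rBase (off k + count k) , _ ,
    seq (runAssign (atᵉ (regᵉ K≡) (subst (k <_) (sym (trans (cong length stages≡) length-stages)) k<r)
                      (trans (cong (λ xs → get 0 xs k) stages≡) (get-stages k<r))))
      (seq rs (runAssign (plusᵉ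
        (regᵉ (trans (unchanged rs (register rBase) (All.lookup stage-untouched (there (there (here refl))))) base≡))
        (regᵉ (unchanged rs (register rCount) (All.lookup stage-untouched (there (there (there (here refl)))))))
        (≤-trans (off+count≤S k<r) S≤κ)))) ,
    sym (off-suc k) , held₂
    where
    open StageTables tables
    open Stage v feedback ($ rBase) {off k} {off k} {shifts m T k} Y (shifts<m k)
      (≤-trans (≤-trans (≤-reflexive (cong (off k +_) (length-shifts k))) (off+count≤S k<r)) S≤κ) regᵉ
    ctx : Context (setReg σ rCount (count k))
    ctx = record
      { N≡ = N≡ ; W≡ = W≡ ; base≡ = base≡ ; count≡ = sym (length-shifts k)
      ; table = subst (λ xs → Segment xs (off k) (shifts m T k)) (sym feedback≡) (segment-concatMap (shifts m T) k<r)
      ; space = proj₁ held }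

  halts-planLoop : ∀ v H {σ} → StageTables σ → regs σ rBase ≡ 0 → Holds v H σ →
    Halts κ (planLoop v) σ (λ σ′ _ → Holds v (stateAfter T r H) σ′)
  halts-planLoop v H {σ} tables base≡ held =
    after (halts-for nothing {y = rR} r r≤κ Inv 0 {σ} (planStage-variant v (register rK)) (planLoop-variant v (register rR)) R≡
            step (base≡ , held))
      λ {σ′} rs post → σ′ , _ , rs , proj₂ (proj₁ post)
    where
    open StageTables tables
    Inv : ℕ → Store W → Set
    Inv k σ = regs σ rBase ≡ off k × Holds v (stateAfter T k H) σ
    step : ∀ {k τ} → k < r → regs τ rK ≡ k → Frame (planLoop v) σ τ → Inv k τ →
      Halts κ (planStage v) τ (λ σ′ _ → Inv (suc k) (setReg σ′ rK (suc k)) × 0 ≤ 0)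
    step {k} k<r K≡ fr (base≡ , held) = after
      (halts-planStage v {stateAfter T k H} k<r K≡ (record
        { N≡        = trans (preserves fr (register rN) (planLoop-variant v (register rN))) N≡
        ; W≡        = trans (preserves fr (register rW) (planLoop-variant v (register rW))) W≡
        ; R≡        = trans (preserves fr (register rR) (planLoop-variant v (register rR))) R≡
        ; stages≡   = trans (preserves fr (recordArray stages) (planLoop-variant v (recordArray stages))) stages≡
        ; feedback≡ = trans (preserves fr (recordArray feedback) (planLoop-variant v (recordArray feedback))) feedback≡
        }) base≡ held)
      λ {σ′} rs (base′ , held′) → σ′ , _ , rs , (base′ , held′) , z≤n

  reducesInPlace : ∀ v → ReducesInPlace W v m T
  reducesInPlace v A σ (holds@(_ , stages≡ , feedback≡ , assembly≡) , N≡ , Y , scratch≡) (input≡ , output≡) =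
    after (halts-loadHigh v {σ} (record { M≡ = m≡ ; W≡ = w≡ ; N≡ = N≡ ; input≡ = input≡ })
          (trans (cong length scratch≡) (length-scratch v (toList Y) (length-toList Y)))
          (λ n≤i → trans (cong (λ xs → get zeros xs _) scratch≡) (scratch-beyond v (toList Y) (length-toList Y) n≤i)))
      λ {σ₁} r₁ held₁ →
    after (halts-planLoop v (drop m A) {setReg σ₁ rBase 0}
          (record
            { N≡        = trans (unchanged r₁ (register rN) refl) N≡
            ; W≡        = trans (unchanged r₁ (register rW) refl) w≡
            ; R≡        = trans (unchanged r₁ (register rR) refl) r≡
            ; stages≡   = trans (unchanged r₁ (recordArray stages) refl) stages≡
            ; feedback≡ = trans (unchanged r₁ (recordArray feedback) refl) feedback≡
            }) refl held₁)
      λ {σ₂} r₂ held₂ →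
    after (halts-assembleOutput {σ₂}
          (record { M≡ = trans (unchanged r₂ (register rM) (planLoop-variant v (register rM))) (trans (unchanged r₁ (register rM) refl) m≡)
                  ; W≡ = trans (unchanged r₂ (register rW) (planLoop-variant v (register rW))) (trans (unchanged r₁ (register rW) refl) w≡)
                  ; N≡ = trans (unchanged r₂ (register rN) (planLoop-variant v (register rN))) (trans (unchanged r₁ (register rN) refl) N≡)
                  ; input≡ = trans (unchanged r₂ (wordArray input) (planLoop-variant v (wordArray input))) (trans (unchanged r₁ (wordArray input) refl) input≡) })
          (record { S≡ = trans (unchanged r₂ (register rS) (planLoop-variant v (register rS))) (trans (unchanged r₁ (register rS) refl) s≡)
                  ; taps = trans (unchanged r₂ (recordArray assembly) (planLoop-variant v (recordArray assembly))) (trans (unchanged r₁ (recordArray assembly) refl) assembly≡)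
                  ; held = held₂ })
          (trans (cong length (unchanged r₂ (wordArray output) (planLoop-variant v (wordArray output)))) (trans (cong length (unchanged r₁ (wordArray output) refl)) output≡)))
      λ {σ₃} r₃ out →
    finish (seq r₁ (seq (runAssign litᵉ) (seq r₂ r₃))) out
      (trans (unchanged r₃ (wordArray scratch) refl) (holds-scratch v (finalState m T A) {σ₂} held₂))
    where
    open PlanRegs (planRegs {σ} holds)
    open Ends 1≤m w A using (halts-loadHigh; module Assembly)
    open Assembly assembly T s≤m v using (halts-assembleOutput)
    finish : ∀ {σ′ u} → Run κ (reduceWithPlan v) σ σ′ u → words σ′ output ≡ pack W (frobeniusReduce m T A) →
      words σ′ scratch ≡ pack W (finalState m T A) ++ scratchTail v →
      ∃₂ λ σ′ u → Run κ (reduceWithPlan v) σ σ′ u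
        × words σ′ output ≡ pack W (frobeniusReduce m T A)
        × words σ′ scratch ≡ pack W (finalState m T A) ++ scratchTail v
        × words σ′ input ≡ words σ input
        × Ready v m T σ′
        × allocdWords u ≡ 0
        × allocdRecs u ≡ 0
    finish {σ′} run out scratch′ =
       σ′ , _ , run , out , scratch′ , unchanged run (wordArray input) (reduce-variant v (wordArray input)) ,
       ((planMetadata {σ′} (record
          { m≡ = trans (unchanged run (register rM) (reduce-variant v (register rM))) m≡
          ; w≡ = trans (unchanged run (register rW) (reduce-variant v (register rW))) w≡
          ; s≡ = trans (unchanged run (register rS) (reduce-variant v (register rS))) s≡
          ; r≡ = trans (unchanged run (register rR) (reduce-variant v (register rR))) r≡ }) ,
         trans (unchanged run (recordArray stages) (reduce-variant v (recordArray stages))) stages≡ ,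
         trans (unchanged run (recordArray feedback) (reduce-variant v (recordArray feedback))) feedback≡ ,
         trans (unchanged run (recordArray assembly) (reduce-variant v (recordArray assembly))) assembly≡) ,
        trans (unchanged run (register rN) (reduce-variant v (register rN))) N≡ ,
        -- `Ready` allows any `n` state words, so the packed final state serves as the content from
        -- which the next reduction starts.
        proj₁ state , trans scratch′ (cong (_++ scratchTail v) (sym (proj₂ state)))) ,
       unused run allocation (reduce-variant v allocation)
      where state = vecOf (pack W (finalState m T A)) (length-pack (finalState m T A))

-- The reusable plan

-- The first pass over the stages only counts, since arrays are allocated at their final size.  The
-- descriptors of a stage come from the largest exponent down, so the second pass copies them reversed.
countStage copyStage recordStage buildPlan : Cmd
countStage  = rR ≔ $ rR :+ lit 1 ⨾ rBase ≔ $ rBase :+ $ rCount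
copyStage   = for rI ($ rCount) (feedback [ $ rBase :+ $ rI ]≔ descriptors at ($ rCount :- lit 1 :- $ rI))
recordStage = stages [ $ rK ]≔ $ rCount ⨾ copyStage ⨾ rK ≔ $ rK :+ lit 1 ⨾ rBase ≔ $ rBase :+ $ rCount
buildPlan =
  startScan ⨾ rR ≔ lit 0 ⨾ rBase ≔ lit 0 ⨾ scanLoop countStage ⨾
  allocRecs stages ($ rR) ⨾ allocRecs feedback ($ rBase) ⨾ allocRecs assembly ($ rS) ⨾
  copySupport assembly ⨾
  startScan ⨾ rK ≔ lit 0 ⨾ rBase ≔ lit 0 ⨾ scanLoop recordStage

-- Allocation costs one operation per cell, so time bounds space: the record bound of the builder
-- follows from its time bound.
allocdRecs≤ : ∀ {W κ c} {σ σ′ : Store W} {u} → Run κ c σ σ′ u → allocdRecs u ≤ ops u + genOps u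
allocdRecs≤ skip                = z≤n
allocdRecs≤ (assign _)          = z≤n
allocdRecs≤ (assignʷ _)         = z≤n
allocdRecs≤ (write _ _ _)       = z≤n
allocdRecs≤ (writeʷ _ _ _)      = z≤n
allocdRecs≤ (allocRecs {σ = σ} {e = e} _) = ≤-trans (m≤n+m (eval σ e) (1 + size e)) (m≤m+n _ 0)
allocdRecs≤ (allocWords _)      = z≤n
allocdRecs≤ (seq {u = u} {v} r s) = ≤-trans (+-mono-≤ (allocdRecs≤ r) (allocdRecs≤ s)) (≤-reflexive (+-interchange (ops u) (genOps u) (ops v) (genOps v)))
allocdRecs≤ (if-yes {u = u} _ _ _ r)    = ≤-trans (allocdRecs≤ r) (+-monoˡ-≤ (genOps u) (m≤n+m (ops u) _))
allocdRecs≤ (if-no {u = u} _ _ _ r)     = ≤-trans (allocdRecs≤ r) (+-monoˡ-≤ (genOps u) (m≤n+m (ops u) _))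
allocdRecs≤ (while-yes {e = e} {f} {u = u} {v} _ _ _ r s) = ≤-trans (+-mono-≤ (allocdRecs≤ r) (allocdRecs≤ s))
  (≤-trans (≤-reflexive (+-interchange (ops u) (genOps u) (ops v) (genOps v)))
    (+-monoˡ-≤ (genOps u + genOps v) (+-monoˡ-≤ (ops v) (m≤n+m (ops u) (1 + (size e + size f))))))
allocdRecs≤ (while-no _ _ _)    = z≤n
allocdRecs≤ (generate r)        = allocdRecs≤ r

module Building {m : ℕ} (1≤m : 1 ≤ m) (w : ℕ) {T : List ℕ} (T↗ : Linked _<_ T) (T<m : All (_< m) T) where

  open Plans 1≤m w T↗ T<m public

  size≤ : ∀ {a b c d} → a ≤ 100 → b ≤ 100 → c ≤ 100 → d ≤ 100 →
    a + b * s + c * r + d * S ≤ 100 * scheduleSize m T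
  size≤ {a} {b} {c} {d} a≤ b≤ c≤ d≤ = begin
    a + b * s + c * r + d * S
      ≤⟨ +-mono-≤ (+-mono-≤ (+-mono-≤ a≤ (*-monoˡ-≤ s b≤)) (*-monoˡ-≤ r c≤)) (*-monoˡ-≤ S d≤) ⟩
    100 + 100 * s + 100 * r + 100 * S
      ≡⟨ solve 3 (λ s r S → con 100 ⊞ con 100 ⊠ s ⊞ con 100 ⊠ r ⊞ con 100 ⊠ S ⊜ con 100 ⊠ (con 1 ⊞ (s ⊞ r ⊞ S))) refl s r S ⟩
    100 * scheduleSize m T ∎
    where open ≤-Reasoning

  halts-countStages : ∀ {σ} → Scan 0 σ → regs σ rR ≡ 0 → regs σ rBase ≡ 0 →
    Halts κ (scanLoop countStage) σ (λ σ′ u → (Scan r σ′ × regs σ′ rR ≡ r × regs σ′ rBase ≡ off r)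
      × measure total u ≤ 3 + r * (33 + 8) + (0 + 24) * S)
  halts-countStages scan R≡ base≡ =
    halts-scanLoop total (refl ∷ refl ∷ refl ∷ refl ∷ refl ∷ []) (λ k σ → regs σ rR ≡ k × regs σ rBase ≡ off k) 8 0
      (λ {k} k<r scan (R≡ , base≡) → _ , _ ,
        seq (runAssign (plusᵉ (regᵉ R≡) litᵉ (subst (_≤ κ) (+-comm 1 k) (≤-trans k<r r≤κ))))
            (runAssign (plusᵉ (regᵉ base≡) (regᵉ (count≡ scan)) (≤-trans (off+count≤S k<r) S≤κ))) ,
        (+-comm k 1 , sym (off-suc k)) , ≤-refl)
      (λ fr (R≡ , base≡) → trans (preserves fr (register rR) refl) R≡ , trans (preserves fr (register rBase) refl) base≡)
      scan (R≡ , base≡)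

  halts-copyStage : ∀ {k σ} → k < r → Scan k σ → regs σ rBase ≡ off k → length (recs σ feedback) ≡ S →
    Filled 0 (off k) (get 0 F) (recs σ feedback) →
    Halts κ copyStage σ (λ σ′ u → (length (recs σ′ feedback) ≡ S × Filled 0 (off (suc k)) (get 0 F) (recs σ′ feedback))
      × measure total u ≤ 5 + count k * 17)
  halts-copyStage {k} {σ} k<r scan base≡ len filled =
    after (halts-for total {y = rCount} (count k) (≤-trans (count≤s k) s≤κ) Inv 10 {σ} refl refl (count≡ scan) step
            (len , resize 0 {new = get 0 F} {recs σ feedback} (sym (+-identityʳ (off k))) filled))
      λ {σ′} rs ((len′ , filled′) , u≤) →
        σ′ , _ , rs , (len′ , λ {i} → resize 0 {new = get 0 F} {recs σ′ feedback} (sym (off-suc k)) filled′ {i}) , u≤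
    where
    Inv : ℕ → Store W → Set
    Inv i τ = length (recs τ feedback) ≡ S × Filled 0 (off k + i) (get 0 F) (recs τ feedback)
    reversed : ∀ {i} → i < count k → get 0 (reverse (shifts m T k)) (count k ∸ 1 ∸ i) ≡ get 0 F (off k + i)
    reversed {i} i<c = begin
      get 0 (reverse (shifts m T k)) (count k ∸ 1 ∸ i)
        ≡⟨ get-reverse (shifts m T k) (subst (count k ∸ 1 ∸ i <_) (sym (length-shifts k)) (pred-∸< i<c)) ⟩
      get 0 (shifts m T k) (length (shifts m T k) ∸ 1 ∸ (count k ∸ 1 ∸ i))
        ≡⟨ cong (λ l → get 0 (shifts m T k) (l ∸ 1 ∸ (count k ∸ 1 ∸ i))) (length-shifts k) ⟩
      get 0 (shifts m T k) (count k ∸ 1 ∸ (count k ∸ 1 ∸ i))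
        ≡⟨ cong (get 0 (shifts m T k)) (mirror i<c) ⟩
      get 0 (shifts m T k) i
        ≡⟨ proj₂ (segment-concatMap (shifts m T) k<r) (subst (i <_) (sym (length-shifts k)) i<c) ⟨
      get 0 F (off k + i) ∎
      where
      open ≡-Reasoning
      mirror : ∀ {i c} → i < c → c ∸ 1 ∸ (c ∸ 1 ∸ i) ≡ i
      mirror {c = suc c} (s≤s i≤c) = m∸[m∸n]≡n i≤c
    step : ∀ {i τ} → i < count k → regs τ rI ≡ i → Frame copyStage σ τ → Inv i τ →
      Halts κ (feedback [ $ rBase :+ $ rI ]≔ descriptors at ($ rCount :- lit 1 :- $ rI)) τ
        (λ σ′ u → Inv (suc i) (setReg σ′ rI (suc i)) × measure total u ≤ 10)
    step {i} {τ} i<c I≡ fr (len , filled) = _ , _ ,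
      runWrite (plusᵉ (regᵉ (trans (preserves fr (register rBase) refl) base≡)) (regᵉ I≡) (≤-trans (<⇒≤ pos<) S≤κ))
        (atᵉ (minusᵉ (minusᵉ (regᵉ (trans (preserves fr (register rCount) refl) (count≡ scan))) litᵉ) (regᵉ I≡))
             (subst (count k ∸ 1 ∸ i <_) (sym (trans (cong length desc≡) (room (supported scan)))) (≤-trans (pred-∸< i<c) (count≤s k)))
             (trans (cong (λ xs → get 0 xs (count k ∸ 1 ∸ i)) desc≡)
               (trans (proj₂ (table scan) (subst (count k ∸ 1 ∸ i <_) (sym (length-reverse-shifts k)) (pred-∸< i<c))) (reversed i<c))))
        (subst (off k + i <_) (sym len) pos<) ,
      (trans (length-put (recs τ feedback) (off k + i) _) len ,
       resize 0 {new = get 0 F} {put (recs τ feedback) (off k + i) (get 0 F (off k + i))} (sym (+-suc (off k) i))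
         (filled-put 0 {off k + i} {get 0 F} {recs τ feedback} (subst (off k + i <_) (sym len) pos<) filled)) ,
      ≤-refl
      where
      desc≡ = preserves fr (recordArray descriptors) refl
      pos< : off k + i < S
      pos< = ≤-trans (+-monoʳ-< (off k) i<c) (off+count≤S k<r)

  record Recorded (k : ℕ) (σ : Store W) : Set where
    field
      K≡         : regs σ rK ≡ k
      base≡      : regs σ rBase ≡ off k
      stagesLen  : length (recs σ stages) ≡ r
      stagesTo   : Filled 0 k count (recs σ stages)
      feedLen    : length (recs σ feedback) ≡ S
      feedTo     : Filled 0 (off k) (get 0 F) (recs σ feedback)

  halts-recordStage : ∀ {k σ} → k < r → Scan k σ → Recorded k σ →
    Halts κ recordStage σ (λ σ′ u → Recorded (suc k) σ′ × measure total u ≤ 16 + 17 * count k)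
  halts-recordStage {k} {σ} k<r scan rec =
    after (halts-copyStage {k} {σ₁} k<r scan₁ base≡ feedLen feedTo) λ {σ₂} {u} rs ((len , filled) , u≤) →
      setReg (setReg σ₂ rK (k + 1)) rBase (off k + count k) , _ ,
      seq (runWrite (regᵉ K≡) (regᵉ (count≡ scan)) k<)
        (seq rs (seq (runAssign (plusᵉ (regᵉ (trans (unchanged rs (register rK) refl) K≡)) litᵉ (subst (_≤ κ) (+-comm 1 k) (≤-trans k<r r≤κ))))
          (runAssign (plusᵉ (regᵉ (trans (unchanged rs (register rBase) refl) base≡))
                            (regᵉ (trans (unchanged rs (register rCount) refl) (count≡ scan))) (≤-trans (off+count≤S k<r) S≤κ))))) ,
      record
        { K≡ = +-comm k 1 ; base≡ = sym (off-suc k)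
        ; stagesLen = trans (cong length (unchanged rs (recordArray stages) refl)) (trans (length-put (recs σ stages) k _) stagesLen)
        ; stagesTo = subst (Filled 0 (suc k) count) (sym (unchanged rs (recordArray stages) refl))
                       (filled-put 0 {k} {count} {recs σ stages} k< stagesTo)
        ; feedLen = len ; feedTo = filled } ,
      (begin
        3 + (ops u + 8) + (genOps u + 0)
          ≡⟨ solve 2 (λ a b → con 3 ⊞ (a ⊞ con 8) ⊞ (b ⊞ con 0) ⊜ con 11 ⊞ (a ⊞ b)) refl (ops u) (genOps u) ⟩
        11 + (ops u + genOps u)      ≤⟨ +-monoʳ-≤ 11 u≤ ⟩
        16 + count k * 17            ≡⟨ cong (16 +_) (*-comm (count k) 17) ⟩
        16 + 17 * count k            ∎)
    where
    open ≤-Reasoning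
    open Recorded rec
    k< : k < length (recs σ stages)
    k< = subst (k <_) (sym stagesLen) k<r
    σ₁ : Store W
    σ₁ = setRecs σ stages (put (recs σ stages) k (count k))
    scan₁ : Scan k σ₁
    scan₁ = record
      { supported = record { M≡ = M≡ (supported scan) ; S≡ = S≡ (supported scan) ; support≡ = support≡ (supported scan) ; room = room (supported scan) }
      ; pow≡ = pow≡ scan ; count≡ = count≡ scan ; table = table scan }

  halts-recordStages : ∀ {σ} → Scan 0 σ → Recorded 0 σ →
    Halts κ (scanLoop recordStage) σ (λ σ′ u → (Scan r σ′ × Recorded r σ′) × measure total u ≤ 3 + r * (33 + 16) + (17 + 24) * S)
  halts-recordStages = halts-scanLoop total (refl ∷ refl ∷ refl ∷ refl ∷ refl ∷ []) Recorded 16 17 halts-recordStage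
    (λ {k} fr rec → let open Recorded rec in record
      { K≡ = trans (preserves fr (register rK) refl) K≡
      ; base≡ = trans (preserves fr (register rBase) refl) base≡
      ; stagesLen = trans (cong length (preserves fr (recordArray stages) refl)) stagesLen
      ; stagesTo = subst (Filled 0 k count) (sym (preserves fr (recordArray stages) refl)) stagesTo
      ; feedLen = trans (cong length (preserves fr (recordArray feedback) refl)) feedLen
      ; feedTo = subst (Filled 0 (off k) (get 0 F)) (sym (preserves fr (recordArray feedback) refl)) feedTo })

  off-r : off r ≡ S
  off-r = length-F

  -- After the counting pass `rR` and `rBase` hold `r` and S_fb, the exact sizes of the arrays to
  -- allocate. The descriptor array is allocated once per pass, and both allocations are counted.
  buildsPlan : BuildsPlan buildPlan 100 W m T
  buildsPlan σ (M₀ , W₀ , S₀ , T₀) =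
    after (halts-startScan {σ} M₀ S₀ T₀) λ {σ₁} {u₁} r₁ (scan₁ , u₁≤ , _ , w₁) →
    after (halts-countStages {setReg (setReg σ₁ rR 0) rBase 0} (rescan scan₁ refl refl refl refl refl refl) refl refl)
      λ {σ₂} {u₂} r₂ ((scan₂ , R₂ , base₂) , u₂≤) →
    after (halts-copySupport assembly {allocated σ₂} refl (S≡ (supported scan₂)) (support≡ (supported scan₂)) (length-replicate s))
      λ {σ₄} {u₄} r₄ (assembly₄ , u₄≤) →
    after (halts-startScan {σ₄} (trans (unchanged r₄ (register rM) refl) (M≡ (supported scan₂)))
            (trans (unchanged r₄ (register rS) refl) (S≡ (supported scan₂)))
            (trans (unchanged r₄ (recordArray support) refl) (support≡ (supported scan₂))))
      λ {σ₅} {u₅} r₅ (scan₅ , u₅≤ , _ , w₅) →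
    after (halts-recordStages {setReg (setReg σ₅ rK 0) rBase 0} (rescan scan₅ refl refl refl refl refl refl)
            (record { K≡ = refl ; base≡ = refl
                    ; stagesLen = trans (cong length (trans (unchanged r₅ (recordArray stages) refl) (unchanged r₄ (recordArray stages) refl)))
                                        (length-replicate r)
                    ; stagesTo = λ ()
                    ; feedLen = trans (cong length (trans (unchanged r₅ (recordArray feedback) refl) (unchanged r₄ (recordArray feedback) refl)))
                                      (length-replicate S)
                    ; feedTo = λ () }))
      λ {_} {u₆} r₆ ((scan₆ , rec₆) , u₆≤) →
    finish {u₁ = u₁} {u₂} {u₄} {u₅} {u₆}
      (seq r₁ (seq (runAssign litᵉ) (seq (runAssign litᵉ) (seq r₂
        (seq (runAllocRecs (regᵉ R₂)) (seq (runAllocRecs (regᵉ (trans base₂ off-r)))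
          (seq (runAllocRecs (regᵉ (S≡ (supported scan₂))))
            (seq r₄ (seq r₅ (seq (runAssign litᵉ) (seq (runAssign litᵉ) r₆)))))))))))
      u₁≤ u₂≤ u₄≤ u₅≤ u₆≤ scan₆ rec₆
      (trans (unchanged r₆ (register rR) refl) (trans (unchanged r₅ (register rR) refl) (trans (unchanged r₄ (register rR) refl) R₂)))
      (trans (unchanged r₆ (recordArray assembly) refl) (trans (unchanged r₅ (recordArray assembly) refl) assembly₄))
      w₁ (proj₁ (unused r₂ allocation refl)) (proj₁ (unused r₄ allocation refl)) w₅ (proj₁ (unused r₆ allocation refl))
    where
    allocation≤ : ∀ k → Costs total (usage (2 + k) 0 k 0) (2 + k)
    allocation≤ k = costs (≤-reflexive (+-identityʳ (2 + k)))
    allocated : Store W → Store W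
    allocated σ = setRecs (setRecs (setRecs σ stages (replicate r 0)) feedback (replicate S 0)) assembly (replicate s 0)
    budget : (30 + 25 * s) + (2 + (2 + ((3 + r * (33 + 8) + (0 + 24) * S) + ((2 + r) + ((2 + S) + ((2 + s) + ((5 + s * 11)
               + ((30 + 25 * s) + (2 + (2 + (3 + r * (33 + 16) + (17 + 24) * S))))))))))) ≤ 100 * scheduleSize m T
    budget = begin
      _ ≡⟨ solve 3 (λ s r S →
             (con 30 ⊞ con 25 ⊠ s) ⊞ (con 2 ⊞ (con 2 ⊞ ((con 3 ⊞ r ⊠ con 41 ⊞ con 24 ⊠ S) ⊞ ((con 2 ⊞ r) ⊞ ((con 2 ⊞ S) ⊞ ((con 2 ⊞ s) ⊞
               ((con 5 ⊞ s ⊠ con 11) ⊞ ((con 30 ⊞ con 25 ⊠ s) ⊞ (con 2 ⊞ (con 2 ⊞ (con 3 ⊞ r ⊠ con 49 ⊞ con 41 ⊠ S))))))))))) ⊜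
             con 85 ⊞ con 62 ⊠ s ⊞ con 91 ⊠ r ⊞ con 66 ⊠ S) refl s r S ⟩
      -- The origin of the constant 100: it exceeds every coefficient here, the largest being 91,
      -- and also those of the online reduction.
      85 + 62 * s + 91 * r + 66 * S  ≤⟨ size≤ {85} {62} {91} {66} (m≤m+n 85 15) (m≤m+n 62 38) (m≤m+n 91 9) (m≤m+n 66 34) ⟩
      100 * scheduleSize m T         ∎
      where open ≤-Reasoning
    rescan : ∀ {k} {σ σ′ : Store W} → Scan k σ → regs σ′ rM ≡ regs σ rM → regs σ′ rS ≡ regs σ rS → regs σ′ rPow ≡ regs σ rPow →
      regs σ′ rCount ≡ regs σ rCount → recs σ′ support ≡ recs σ support → recs σ′ descriptors ≡ recs σ descriptors → Scan k σ′
    rescan {k} scan m≡ s≡ p≡ c≡ sup≡ desc≡ = record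
      { supported = record
          { M≡ = trans m≡ (M≡ (supported scan)) ; S≡ = trans s≡ (S≡ (supported scan))
          ; support≡ = trans sup≡ (support≡ (supported scan)) ; room = trans (cong length desc≡) (room (supported scan)) }
      ; pow≡ = trans p≡ (pow≡ scan) ; count≡ = trans c≡ (count≡ scan)
      ; table = subst (λ xs → Segment xs 0 (reverse (shifts m T k))) (sym desc≡) (table scan) }
    spent : Usage → Usage → Usage → Usage → Usage → Usage
    spent u₁ u₂ u₄ u₅ u₆ =
      u₁ ⊹ (cost 2 ⊹ (cost 2 ⊹ (u₂ ⊹ (usage (2 + r) 0 r 0 ⊹ (usage (2 + S) 0 S 0 ⊹ (usage (2 + s) 0 s 0 ⊹
        (u₄ ⊹ (u₅ ⊹ (cost 2 ⊹ (cost 2 ⊹ u₆))))))))))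
    finish : ∀ {σ₆ u₁ u₂ u₄ u₅ u₆} → Run κ buildPlan σ σ₆ (spent u₁ u₂ u₄ u₅ u₆) →
      measure total u₁ ≤ 30 + 25 * s → measure total u₂ ≤ 3 + r * (33 + 8) + (0 + 24) * S → measure total u₄ ≤ 5 + s * 11 →
      measure total u₅ ≤ 30 + 25 * s → measure total u₆ ≤ 3 + r * (33 + 16) + (17 + 24) * S →
      Scan r σ₆ → Recorded r σ₆ → regs σ₆ rR ≡ r → recs σ₆ assembly ≡ T →
      allocdWords u₁ ≡ 0 → allocdWords u₂ ≡ 0 → allocdWords u₄ ≡ 0 → allocdWords u₅ ≡ 0 → allocdWords u₆ ≡ 0 →
      ∃₂ λ σ′ u → Run κ buildPlan σ σ′ u × HoldsPlan (planFor W m T) σ′ × recs σ′ support ≡ T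
        × ops u + genOps u ≤ 100 * scheduleSize m T × allocdRecs u ≤ 100 * scheduleSize m T × allocdWords u ≡ 0
    finish {σ₆} {u₁} {u₂} {u₄} {u₅} {u₆} run u₁≤ u₂≤ u₄≤ u₅≤ u₆≤ scan₆ rec₆ R₆ assembly₆ w₁ w₂ w₄ w₅ w₆ =
       σ₆ , spent u₁ u₂ u₄ u₅ u₆ , run ,
       (planMetadata {σ₆} (record
          { m≡ = M≡ (supported scan₆)
          ; w≡ = trans (unchanged run (register rW) refl) W₀
          ; s≡ = S≡ (supported scan₆)
          ; r≡ = R₆ }) ,
        get-ext {z = 0} _ _ (trans (Recorded.stagesLen rec₆) (sym length-stages))
          (λ {i} i< → let i<r = subst (i <_) (Recorded.stagesLen rec₆) i<
                      in trans (Recorded.stagesTo rec₆ i<r) (sym (get-stages i<r))) ,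
        get-ext {z = 0} _ _ (trans (Recorded.feedLen rec₆) (sym length-F))
          (λ {i} i< → Recorded.feedTo rec₆ (subst (i <_) (trans (Recorded.feedLen rec₆) (sym off-r)) i<)) ,
        assembly₆) ,
       support≡ (supported scan₆) ,
       time≤ , ≤-trans (allocdRecs≤ run) time≤ ,
       cong₂ _+_ w₁ (cong₂ _+_ w₂ (cong₂ _+_ w₄ (cong₂ _+_ w₅ w₆)))
      where
      time≤ : measure total (spent u₁ u₂ u₄ u₅ u₆) ≤ 100 * scheduleSize m T
      time≤ = ≤-trans (cost≤ (costing total u₁ u₁≤ ⊹≤ costing total (cost 2) ≤-refl ⊹≤ costing total (cost 2) ≤-refl ⊹≤
                costing total u₂ u₂≤ ⊹≤ allocation≤ r ⊹≤ allocation≤ S ⊹≤ allocation≤ s ⊹≤ costing total u₄ u₄≤ ⊹≤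
                costing total u₅ u₅≤ ⊹≤ costing total (cost 2) ≤-refl ⊹≤ costing total (cost 2) ≤-refl ⊹≤ costing total u₆ u₆≤)) budget

-- Online reduction

module Online {m : ℕ} (1≤m : 1 ≤ m) (w : ℕ) {T : List ℕ} (T↗ : Linked _<_ T) (T<m : All (_< m) T)
  (A : Vec Bool (m + m)) where

  open Building 1≤m w T↗ T<m
  open Ends 1≤m w A

  private
    H : Vec Bool m
    H = drop m A

    onlineStage : Cmd
    onlineStage = stageInPlace sentinel descriptors (lit 0) ($ rCount)

  Staged : ℕ → Store W → Set
  Staged k σ = Geometry σ × Holds sentinel (stateAfter T k H) σ

  -- The stage proper lies outside `generate`, so it costs nothing under `generated`, and only the
  -- scans between the stages are charged.
  halts-onlineStage : ∀ {k σ} → k < r → Scan k σ → Staged k σ →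
    Halts κ onlineStage σ (λ σ′ u → Staged (suc k) σ′ × measure generated u ≤ 0 + 0 * count k)
  halts-onlineStage {k} {σ} k<r scan (g , held) =
    after (stage ctx held) λ {σ′} rs held′ → σ′ , _ , rs ,
      (geometry-frame (frameOf rs) (refl ∷ refl ∷ refl ∷ refl ∷ []) g ,
       subst (λ Z → Holds sentinel Z σ′) (applyStage-reverse (shifts m T k) (stateAfter T k H)) held′) ,
      ≤-reflexive (unused rs generation refl)
    where
    open Stage sentinel descriptors (lit 0) {0} {regs σ rBase} {reverse (shifts m T k)} (stateAfter T k H)
      (All-reverse (shifts m T k) (shifts<m k))
      (≤-trans (≤-reflexive (length-reverse-shifts k)) (≤-trans (count≤s k) s≤κ)) (λ _ → litᵉ)
    ctx : Context σ
    ctx = record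
      { N≡ = Geometry.N≡ g ; W≡ = Geometry.W≡ g ; base≡ = refl
      ; count≡ = trans (count≡ scan) (sym (length-reverse-shifts k))
      ; table = table scan ; space = proj₁ held }

  halts-onlineStages : ∀ {σ} → Scan 0 σ → Staged 0 σ →
    Halts κ (scanLoop onlineStage) σ (λ σ′ u → (Scan r σ′ × Staged r σ′) × measure generated u ≤ 3 + r * (33 + 0) + (0 + 24) * S)
  halts-onlineStages = halts-scanLoop generated (refl ∷ refl ∷ refl ∷ refl ∷ refl ∷ []) Staged 0 0 halts-onlineStage
    (λ fr (g , (len , cells)) → geometry-frame fr (refl ∷ refl ∷ refl ∷ refl ∷ []) g ,
      trans (cong length (preserves fr (wordArray scratch) refl)) len ,
      (λ i → trans (cong (λ xs → get zeros xs i) (preserves fr (wordArray scratch) refl)) (cells i)))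

  reducesOnline : (σ : Store W) → GivenSupport m T σ → CallerArrays m A σ →
    ∃₂ λ σ′ u → Run κ reduceOnline σ σ′ u
      × words σ′ output ≡ pack W (frobeniusReduce m T A)
      × words σ′ scratch ≡ pack W (finalState m T A) ++ scratchTail sentinel
      × words σ′ input ≡ words σ input
      × (∀ a → a ≢ descriptors → recs σ′ a ≡ recs σ a)
      × length (recs σ′ descriptors) ≡ s
      × allocdWords u ≡ n + 1
      × allocdRecs u ≡ s
      × allocdWords u + allocdRecs u ≤ 100 * (n + s)
      × genOps u ≤ 100 * scheduleSize m T
  reducesOnline σ (M₀ , W₀ , S₀ , T₀) (input₀ , output₀) =
    after (halts-loadHigh sentinel {σ₁} (record { M≡ = M₀ ; W≡ = W₀ ; N≡ = refl ; input≡ = input₀ })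
            (length-replicate (n + 1)) (λ {i} _ → get-replicate (n + 1) i))
      λ {σ₂} {u₂} r₂ held₂ →
    after (halts-startScan {σ₂} (trans (unchanged r₂ (register rM) refl) M₀) (trans (unchanged r₂ (register rS) refl) S₀)
            (trans (unchanged r₂ (recordArray support) refl) T₀))
      λ {σ₃} {u₃} r₃ (scan₃ , u₃≤ , recs₃ , words₃) →
    after (halts-onlineStages scan₃
            (geometry-frame (frameOf r₃) (refl ∷ refl ∷ refl ∷ refl ∷ [])
              (geometry-frame (frameOf r₂) (refl ∷ refl ∷ refl ∷ refl ∷ [])
                (record { M≡ = M₀ ; W≡ = W₀ ; N≡ = refl ; input≡ = input₀ })) ,
             held-cong {H} {σ₂} {σ₃} (unchanged r₃ (wordArray scratch) refl) held₂))
      λ {σ₄} {u₄} r₄ ((scan₄ , (g₄ , held₄)) , u₄≤) →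
    -- The taps overwrite the descriptors of the last scan, so the assembly allocates no record of
    -- its own.
    after (halts-copySupport descriptors {σ₄} refl (S≡ (supported scan₄)) (support≡ (supported scan₄)) (room (supported scan₄)))
      λ {σ₅} {u₅} r₅ (desc₅ , u₅≤) →
    after (halts-assembleOutput {σ₅} (geometry-frame (frameOf r₅) (refl ∷ refl ∷ refl ∷ refl ∷ []) g₄)
            (record { S≡ = trans (unchanged r₅ (register rS) refl) (S≡ (supported scan₄))
                    ; taps = desc₅ ; held = held-cong {finalState m T A} {σ₄} {σ₅} (unchanged r₅ (wordArray scratch) refl) held₄ })
            (trans (cong length (trans (unchanged r₅ (wordArray output) refl) (trans (unchanged r₄ (wordArray output) refl)
              (trans (unchanged r₃ (wordArray output) refl) (unchanged r₂ (wordArray output) refl))))) output₀))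
      λ {σ₆} {u₆} r₆ out →
    finish {u₂ = u₂} {u₃} {u₄} {u₅} {u₆}
      (seq (runSetup sentinel {σ} M₀ W₀) (seq r₂ (seq r₃ (seq r₄ (seq (generate r₅) r₆)))))
      out
      (trans (unchanged r₆ (wordArray scratch) refl) (trans (unchanged r₅ (wordArray scratch) refl)
        (holds-scratch sentinel (finalState m T A) {σ₄} held₄)))
      (cong length (trans (unchanged r₆ (recordArray descriptors) refl) desc₅))
      (unused r₂ allocation refl) (words₃ , recs₃) (unused r₄ allocation refl) (unused r₅ allocation refl) (unused r₆ allocation refl)
      (unused r₂ generation refl) u₃≤ u₄≤ u₅≤ (unused r₆ generation refl)
    where
    open Assembly descriptors T s≤m sentinel using (halts-assembleOutput)
    σ₁ : Store W
    σ₁ = setWords (setReg σ rN n) scratch (replicate (n + 1) zeros)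
    held-cong : ∀ {Z : Vec Bool m} {τ τ′ : Store W} → words τ′ scratch ≡ words τ scratch → Holds sentinel Z τ → Holds sentinel Z τ′
    held-cong eq (len , cells) = trans (cong length eq) len , λ i → trans (cong (λ xs → get zeros xs i) eq) (cells i)
    spent : Usage → Usage → Usage → Usage → Usage → Usage
    spent u₂ u₃ u₄ u₅ u₆ = (cost 8 ⊹ usage (4 + (n + 1)) 0 0 (n + 1)) ⊹ (u₂ ⊹ (u₃ ⊹ (u₄ ⊹ (asGenerated u₅ ⊹ u₆))))
    untouchedRecs : ∀ {σ′ u} → Run κ reduceOnline σ σ′ u → ∀ a → a ≢ descriptors → recs σ′ a ≡ recs σ a
    untouchedRecs run support     _ = unchanged run (recordArray support) refl
    untouchedRecs run stages      _ = unchanged run (recordArray stages) refl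
    untouchedRecs run feedback    _ = unchanged run (recordArray feedback) refl
    untouchedRecs run assembly    _ = unchanged run (recordArray assembly) refl
    untouchedRecs run descriptors d = contradiction refl d
    space≤ : n + 1 + s ≤ 100 * (n + s)
    space≤ = begin
      n + 1 + s            ≡⟨ solve 2 (λ n s → n ⊞ con 1 ⊞ s ⊜ con 1 ⊞ (n ⊞ s)) refl n s ⟩
      -- The sentinel is absorbed into the linear bound because `n` is at least 1.
      1 + (n + s)          ≤⟨ +-monoˡ-≤ (n + s) (≤-trans (*<⇒<ceilDiv {m} {0} 1≤m) (m≤m+n n s)) ⟩
      (n + s) + (n + s)    ≤⟨ m≤m+n _ (98 * (n + s)) ⟩
      (n + s) + (n + s) + 98 * (n + s)  ≡⟨ solve 1 (λ x → x ⊞ x ⊞ con 98 ⊠ x ⊜ con 100 ⊠ x) refl (n + s) ⟩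
      100 * (n + s)        ∎
      where open ≤-Reasoning
    finish : ∀ {σ′ u₂ u₃ u₄ u₅ u₆} → Run κ reduceOnline σ σ′ (spent u₂ u₃ u₄ u₅ u₆) →
      words σ′ output ≡ pack W (frobeniusReduce m T A) →
      words σ′ scratch ≡ pack W (finalState m T A) ++ scratchTail sentinel →
      length (recs σ′ descriptors) ≡ s →
      allocdWords u₂ ≡ 0 × allocdRecs u₂ ≡ 0 → allocdWords u₃ ≡ 0 × allocdRecs u₃ ≡ s → allocdWords u₄ ≡ 0 × allocdRecs u₄ ≡ 0 →
      allocdWords u₅ ≡ 0 × allocdRecs u₅ ≡ 0 → allocdWords u₆ ≡ 0 × allocdRecs u₆ ≡ 0 →
      genOps u₂ ≡ 0 → measure total u₃ ≤ 30 + 25 * s → genOps u₄ ≤ 3 + r * (33 + 0) + (0 + 24) * S →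
      measure total u₅ ≤ 5 + s * 11 → genOps u₆ ≡ 0 →
      ∃₂ λ σ′ u → Run κ reduceOnline σ σ′ u
        × words σ′ output ≡ pack W (frobeniusReduce m T A)
        × words σ′ scratch ≡ pack W (finalState m T A) ++ scratchTail sentinel
        × words σ′ input ≡ words σ input
        × (∀ a → a ≢ descriptors → recs σ′ a ≡ recs σ a)
        × length (recs σ′ descriptors) ≡ s
        × allocdWords u ≡ n + 1
        × allocdRecs u ≡ s
        × allocdWords u + allocdRecs u ≤ 100 * (n + s)
        × genOps u ≤ 100 * scheduleSize m T
    finish {σ′} {u₂} {u₃} {u₄} {u₅} {u₆} run out scratch′ desc′ (w₂ , r₂) (w₃ , r₃) (w₄ , r₄) (w₅ , r₅) (w₆ , r₆) g₂ g₃ g₄ g₅ g₆ =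
      σ′ , spent u₂ u₃ u₄ u₅ u₆ , run , out , scratch′ , unchanged run (wordArray input) refl , untouchedRecs run , desc′ ,
      words≡ , recs≡ , subst₂ (λ a b → a + b ≤ 100 * (n + s)) (sym words≡) (sym recs≡) space≤ , gen≤
      where
      words≡ : n + 1 + (allocdWords u₂ + (allocdWords u₃ + (allocdWords u₄ + (allocdWords u₅ + allocdWords u₆)))) ≡ n + 1
      words≡ = trans (cong (n + 1 +_) (cong₂ _+_ w₂ (cong₂ _+_ w₃ (cong₂ _+_ w₄ (cong₂ _+_ w₅ w₆))))) (+-identityʳ (n + 1))
      recs≡ : allocdRecs u₂ + (allocdRecs u₃ + (allocdRecs u₄ + (allocdRecs u₅ + allocdRecs u₆))) ≡ s
      recs≡ = trans (cong₂ _+_ r₂ (cong₂ _+_ r₃ (cong₂ _+_ r₄ (cong₂ _+_ r₅ r₆)))) (+-identityʳ s)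
      gen≤ : genOps u₂ + (genOps u₃ + (genOps u₄ + (ops u₅ + genOps u₅ + genOps u₆))) ≤ 100 * scheduleSize m T
      gen≤ = begin
        genOps u₂ + (genOps u₃ + (genOps u₄ + (ops u₅ + genOps u₅ + genOps u₆)))
          ≤⟨ +-mono-≤ (≤-reflexive g₂) (+-mono-≤ (≤-trans (m≤n+m (genOps u₃) (ops u₃)) g₃) (+-mono-≤ g₄ (+-mono-≤ g₅ (≤-reflexive g₆)))) ⟩
        30 + 25 * s + (3 + r * 33 + 24 * S + (5 + s * 11 + 0))
          ≡⟨ solve 3 (λ s r S → con 30 ⊞ con 25 ⊠ s ⊞ (con 3 ⊞ r ⊠ con 33 ⊞ con 24 ⊠ S ⊞ (con 5 ⊞ s ⊠ con 11 ⊞ con 0)) ⊜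
               con 38 ⊞ con 36 ⊠ s ⊞ con 33 ⊠ r ⊞ con 24 ⊠ S) refl s r S ⟩
        38 + 36 * s + 33 * r + 24 * S
          ≤⟨ size≤ {38} {36} {33} {24} (m≤m+n 38 62) (m≤m+n 36 64) (m≤m+n 33 67) (m≤m+n 24 76) ⟩
        100 * scheduleSize m T ∎
        where open ≤-Reasoning

proposition5p4 : ∃₂ λ (build : Cmd) (C : ℕ) →
    (m W : ℕ) (T : List ℕ) → 1 ≤ m → 1 ≤ W → Linked _<_ T → All (_< m) T →
    ((A : Vec Bool (m + m)) → IsRemainder m T A (frobeniusReduce m T A))
    × (SetupAllocates W guarded m T (ceilDiv m W) × ReducesInPlace W guarded m T)
    × (SetupAllocates 1 guarded m T m × ReducesInPlace 1 guarded m T)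
    × (SetupAllocates W sentinel m T (ceilDiv m W + 1) × ReducesInPlace W sentinel m T)
    × (length (stageRecords (planFor W m T)) ≡ stageCount m T
    × length (feedbackRecords (planFor W m T)) ≡ feedbackCount m T
    × length (assemblyRecords (planFor W m T)) ≡ length T)
    × BuildsPlan build C W m T
    × ReducesOnline C W m T
proposition5p4 = buildPlan , 100 , λ where
  m (suc w) T 1≤m _ T↗ T<m →
    let open Building 1≤m w T↗ T<m
        module Bits = Plans 1≤m 0 T↗ T<m
    in frobeniusReduce-remainder 1≤m T<m ,
       (setupAllocates guarded , reducesInPlace guarded) ,
       -- At width one a word is a bit and `ceilDiv m 1` is `m`, so the guarded state consists of
       -- exactly `m` bits.
       (subst (SetupAllocates 1 guarded m T) (ceilDiv-1 m) (Bits.setupAllocates guarded) , Bits.reducesInPlace guarded) ,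
       (setupAllocates sentinel , reducesInPlace sentinel) ,
       (length-stages , length-F , refl) ,
       buildsPlan ,
       Online.reducesOnline 1≤m w T↗ T<m
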